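{- Let $\Gamma$ be a tetravalent graph of girth $5$. Then there exists a subgroup $G\le \mathrm{Aut}(\Gamma)$ which is half-arc-transitive on $\Gamma$ and relative to which $\Gamma$ is $G$-tightly-attached if and only if one of the following holds: (1) $\Gamma\cong\mathcal{X}_o(3,9;4)$ (the Doyle-Holt graph); (2) $\Gamma\cong\mathcal{X}_o(5,r;q)$ for some odd $r\ge3$ and $q\in\mathbb{Z}_r$ with $q\neq\pm1$ and $1+q+q^2+q^3+q^4=0$. Moreover, all such graphs $\Gamma$ are half-arc-transitive (i.e. $\mathrm{Aut}(\Gamma)$ itself is half-arc-transitive on $\Gamma$). Furthermore, the only tetravalent graph of girth $5$ admitting a half-arc-transitive group $G$ of automorphisms relative to which it is $G$-tightly-attached and has undirected $5$-cycles (with respect to a $G$-induced orientation) is the Doyle-Holt graph.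
   Context: Graphs are finite, simple, connected. A subgroup $G\le\mathrm{Aut}(\Gamma)$ is half-arc-transitive on $\Gamma$ if it is transitive on vertices and on edges but not on arcs (ordered pairs of adjacent vertices). Then $G$ has two orbits on arcs, each containing exactly one of $(u,v),(v,u)$ for each edge; each orbit is a $G$-induced orientation $\vec\Gamma$. For tetravalent $\Gamma$, a $G$-alternating cycle is a cycle of $\Gamma$ in which every two consecutive edges have opposite orientations in $\vec\Gamma$. All $G$-alternating cycles have the same even length $2r_G$ ($r_G$ is the $G$-radius) and any two $G$-alternating cycles sharing a vertex share the same number of vertices (the $G$-attachment number). $\Gamma$ is $G$-tightly-attached if the $G$-attachment number equals the $G$-radius. A $5$-cycle $C$ is directed with respect to $\vec\Gamma$ if each vertex of $C$ is the head of one and the tail of the other of the arcs of $\vec\Gamma$ on the two edges of $C$ at it; otherwise undirected. For integers $m\ge3$, odd $r\ge3$, and $q\in\mathbb{Z}_r$ with $q^m=\pm1$, $\mathcal{X}_o(m,r;q)$ is the graph with vertex set $\{u_i^j: i\in\mathbb{Z}_m, j\in\mathbb{Z}_r\}$ and edges $u_i^j\sim u_{i+1}^{j\pm q^i}$ (subscripts mod $m$, superscripts mod $r$). -}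

module Defs where

open import Data.Nat using (ℕ; zero; suc; _+_; _*_; _≤_; _<_)
open import Data.Fin using (Fin; toℕ)
open import Data.Fin.Subset using (Subset; _∈_; ∣_∣)
open import Data.Fin.Permutation using (Permutation′; _⟨$⟩ʳ_)
open import Data.Integer as ℤ using (ℤ; +_)
open import Data.Integer.Divisibility as ℤD using ()
open import Data.Bool using (Bool; T)
open import Data.Product using (Σ; ∃; _×_; _,_)
open import Data.Sum using (_⊎_)
open import Relation.Nullary using (¬_)
open import Relation.Binary.PropositionalEquality using (_≡_)
open import Function.Bundles using (_⇔_; _↔_; Inverse)
open import Level using (Level)

record Graph : Set where
  field
    n     : ℕ
    adj   : Fin n → Fin n → Bool
    sym   : ∀ u v → T (adj u v) → T (adj v u)
    irrefl : ∀ u → ¬ T (adj u u)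

infix 4 _≡[mod_]_
_≡[mod_]_ : ℤ → ℕ → ℤ → Set
x ≡[mod r ] y = (+ r) ℤD.∣ (x ℤ.- y)

XoArc : (m r : ℕ) (q : ℤ) → Fin m × Fin r → Fin m × Fin r → Set
XoArc m r q (i , j) (i' , j') =
  ((+ toℕ i') ≡[mod m ] ((+ toℕ i) ℤ.+ (+ 1))) ×
  (((+ toℕ j') ≡[mod r ] ((+ toℕ j) ℤ.+ (q ℤ.^ toℕ i))) ⊎
   ((+ toℕ j') ≡[mod r ] ((+ toℕ j) ℤ.- (q ℤ.^ toℕ i))))

XoAdj : (m r : ℕ) (q : ℤ) → Fin m × Fin r → Fin m × Fin r → Set
XoAdj m r q x y = XoArc m r q x y ⊎ XoArc m r q y x


module _ (Γ : Graph) where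
  open Graph Γ

  V : Set
  V = Fin n

  _~_ : V → V → Set
  u ~ v = T (adj u v)

  Tetravalent : Set
  Tetravalent = ∀ v → Σ (Subset n) λ S → (∀ u → (u ∈ S) ⇔ (v ~ u)) × ∣ S ∣ ≡ 4

  Connected : Set
  Connected = ∀ u v → Σ ℕ λ k → Σ (ℕ → V) λ w →
    (w 0 ≡ u) × (w k ≡ v) × (∀ i → i < k → w i ~ w (suc i))

  record Cycle (k : ℕ) : Set where
    field
      len≥3    : 3 ≤ k
      vtx      : ℕ → V
      periodic : ∀ i → vtx (i + k) ≡ vtx i
      distinct : ∀ i j → i < k → j < k → vtx i ≡ vtx j → i ≡ j
      edges    : ∀ i → vtx i ~ vtx (suc i)
  open Cycle public

  Girth : ℕ → Set
  Girth g = Cycle g × (∀ k → k < g → ¬ Cycle k)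

  OnCycle : ∀ {k} → Cycle k → V → Set
  OnCycle C v = ∃ λ i → vtx C i ≡ v

  EdgeOf : ∀ {k} → Cycle k → V → V → Set
  EdgeOf C u v = ∃ λ i → (vtx C i ≡ u × vtx C (suc i) ≡ v) ⊎ (vtx C i ≡ v × vtx C (suc i) ≡ u)

  SameCycle : ∀ {k k'} → Cycle k → Cycle k' → Set
  SameCycle C C' = ∀ u v → EdgeOf C u v ⇔ EdgeOf C' u v

  IsAut : Permutation′ n → Set
  IsAut g = ∀ u v → (u ~ v) ⇔ ((g ⟨$⟩ʳ u) ~ (g ⟨$⟩ʳ v))

  record IsSubgroup (mem : Permutation′ n → Set) : Set where
    field
      auts   : ∀ g → mem g → IsAut g
      hasId  : Σ (Permutation′ n) λ e → mem e × (∀ x → e ⟨$⟩ʳ x ≡ x)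
      hasMul : ∀ g h → mem g → mem h →
               Σ (Permutation′ n) λ k → mem k × (∀ x → k ⟨$⟩ʳ x ≡ g ⟨$⟩ʳ (h ⟨$⟩ʳ x))
      hasInv : ∀ g → mem g →
               Σ (Permutation′ n) λ k → mem k × (∀ x → k ⟨$⟩ʳ (g ⟨$⟩ʳ x) ≡ x)

  record Subgroup : Set₁ where
    field
      mem   : Permutation′ n → Set
      isSub : IsSubgroup mem
  open Subgroup public

  VertexTransitive : (Permutation′ n → Set) → Set
  VertexTransitive G = ∀ u v → ∃ λ g → G g × g ⟨$⟩ʳ u ≡ v

  EdgeTransitive : (Permutation′ n → Set) → Set
  EdgeTransitive G = ∀ u v x y → u ~ v → x ~ y → ∃ λ g → G g ×
    ((g ⟨$⟩ʳ u ≡ x × g ⟨$⟩ʳ v ≡ y) ⊎ (g ⟨$⟩ʳ u ≡ y × g ⟨$⟩ʳ v ≡ x))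

  ArcTransitive : (Permutation′ n → Set) → Set
  ArcTransitive G = ∀ u v x y → u ~ v → x ~ y → ∃ λ g → G g ×
    (g ⟨$⟩ʳ u ≡ x × g ⟨$⟩ʳ v ≡ y)

  HalfArcTransitiveOn : (Permutation′ n → Set) → Set
  HalfArcTransitiveOn G = VertexTransitive G × EdgeTransitive G × ¬ ArcTransitive G

  HalfArcTransitive : Set
  HalfArcTransitive = HalfArcTransitiveOn IsAut

  -- G-induced orientations: the G-orbit of the arc (a , b)

  Oriented : (Permutation′ n → Set) → V → V → V → V → Set
  Oriented G a b x y = ∃ λ g → G g × (g ⟨$⟩ʳ a ≡ x × g ⟨$⟩ʳ b ≡ y)

  -- alternating cycle w.r.t. orientation O: consecutive edges have
  -- opposite orientations (the middle vertex is head of both or tail of both)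
  Alternating : (V → V → Set) → ∀ {k} → Cycle k → Set
  Alternating O C = ∀ i →
    O (vtx C i) (vtx C (suc i)) ⇔ O (vtx C (suc (suc i))) (vtx C (suc i))

  Directed : (V → V → Set) → ∀ {k} → Cycle k → Set
  Directed O C = ∀ i →
    O (vtx C i) (vtx C (suc i)) ⇔ O (vtx C (suc i)) (vtx C (suc (suc i)))

  -- G-tightly-attached: for (either) G-induced orientation, any two distinct
  -- G-alternating cycles sharing a vertex share exactly r_G vertices, where
  -- 2 r_G is the length of the alternating cycles
  TightlyAttached : Subgroup → Set
  TightlyAttached G = ∀ a b → a ~ b →
    ∀ {k k'} (C : Cycle k) (C' : Cycle k') →
    Alternating (Oriented (mem G) a b) C →
    Alternating (Oriented (mem G) a b) C' →
    ¬ SameCycle C C' →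
    (∃ λ v → OnCycle C v × OnCycle C' v) →
    Σ (Subset n) λ S → (∀ v → (v ∈ S) ⇔ (OnCycle C v × OnCycle C' v)) ×
      2 * ∣ S ∣ ≡ k

  HasUndirected5Cycle : Subgroup → Set
  HasUndirected5Cycle G = ∃ λ a → ∃ λ b → a ~ b × Σ (Cycle 5) λ C →
    ¬ Directed (Oriented (mem G) a b) C

  IsoXo : (m r : ℕ) (q : ℤ) → Set
  IsoXo m r q = Σ ((Fin m × Fin r) ↔ V) λ φ →
    ∀ x y → XoAdj m r q x y ⇔ (Inverse.to φ x ~ Inverse.to φ y)

{-# OPTIONS --safe #-}
module Submission where

-- A half-arc-transitive group G orients Γ with in- and out-valency 2. Let ρ ∈ G rotate an alternating
-- cycle by one step, and let g ∈ G map an arc to an arc following it. Tight attachment means that the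
-- heads of an alternating cycle are the tails of the next one, so that ρ acts on all of them and
-- g ρ g⁻¹ = ρ^q on the next cycle; the vertices ρ^j g^i x then form layers i ∈ Z_m, and reflections
-- of the alternating cycles force the relation 2 t = 1 + q + ... + q^(m-1) for the shift t after one
-- turn. The layers of a 5-cycle show m ∈ {3 , 5}; hence r is odd, 2 can be divided out, and
-- Γ = X_o(m,r;q) with q^m = 1. Reading off the 5-cycles as ± 1 ± q ± q² ± q³ ± q⁴ = 0 (m = 5), where
-- all signs must agree, or 3 ± q ± q² = 0 (m = 3) leaves the graphs of the theorem.
-- Conversely, an automorphism of X_o(5,r;q) permutes the 5-cycles, each of which is directed and carries
-- a constant sign. If it kept the direction of one of two 5-cycles through a vertex and reversed the
-- other, the image of a closed hexagon of 5-cycles would give a relation in ℤ[ζ₅] / r which is impossible;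
-- if it reversed all of them, it would give q² = 1. So the layer orientation is preserved by all
-- automorphisms. For X_o(3,9;4) the same follows from a search of a small ball.

open import Defs
open import Data.Bool as Bool using (Bool; true; false; _∧_)
open import Data.Bool.ListAction using (any)
import Data.Bool.Properties as Boolₚ
open import Data.Empty using (⊥; ⊥-elim)
open import Data.Fin as Fin using (Fin; toℕ; fromℕ<)
open import Data.Fin.Permutation as Perm using (Permutation′; _⟨$⟩ʳ_; _⟨$⟩ˡ_; permutation)
import Data.Fin.Properties as Finₚ
open import Data.Fin.Subset as Sub using (Subset; inside; outside; ∣_∣)
open import Data.Integer as ℤ using (ℤ; +_; -[1+_]; _+_; _*_; _-_; -_; _^_)
import Data.Integer.DivMod as ℤM
import Data.Integer.Divisibility.Signed as ℤS
import Data.Integer.Properties as ℤₚ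
open import Data.Integer.Tactic.RingSolver using (solve-∀)
open import Data.List as List using (List; []; _∷_; length; map; _++_; upTo)
open import Data.List.Membership.Propositional using (_∈_)
import Data.List.Membership.Propositional.Properties as ∈ₚ
import Data.List.Properties as Listₚ
open import Data.List.Relation.Unary.All as All using (All; []; _∷_)
open import Data.List.Relation.Unary.AllPairs using ([]; _∷_)
open import Data.List.Relation.Unary.Any as Any using (here; there)
import Data.List.Relation.Unary.Any.Properties as Anyₚ
open import Data.List.Relation.Unary.Unique.Propositional using (Unique)
import Data.List.Relation.Unary.Unique.Propositional.Properties as Uniqueₚ
open import Data.Nat as ℕ using (ℕ; zero; suc; z≤n; s≤s; _≤_; _<_)
import Data.Nat.DivMod as ℕM
import Data.Nat.Divisibility as ℕD
open import Data.Nat.Divisibility using (_∣_)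
open import Data.Nat.Primality using (Prime; prime?; prime⇒irreducible)
import Data.Nat.Properties as ℕₚ
open import Data.Product using (Σ; ∃; ∃₂; _×_; _,_; proj₁; proj₂)
open import Data.Sum as Sum using (_⊎_; inj₁; inj₂; [_,_]′)
import Data.Vec as Vec
open import Data.Vec using ([]; _∷_; here; there)
import Data.Vec.Properties as Vecₚ
open import Function using (_∘_; Equivalence; mk⇔; _⇔_; Inverse; mk↔ₛ′)
open import Relation.Binary.PropositionalEquality using (_≡_; _≢_; refl; sym; trans; cong; cong₂; subst; subst₂)
open import Relation.Nullary using (¬_; Dec; yes; no)
open import Relation.Nullary.Decidable as Dec using (does; dec-true; _×-dec_; _⊎-dec_; _→-dec_)

-- Congruences

-- Since `r` need not be prime, one may divide only by explicit units of Z_r: 2, the powers of `q`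
-- and, for fifth roots of unity, elements such as 1 + q. Tight attachment merely counts common
-- vertices; that they are all the heads of a cycle has to be forced, by a reflection in `G` that
-- fixes a head. Girth 5 enters through common neighbours: a vertex is determined by two of its
-- neighbours, so a formula for an automorphism on one layer passes to the next. The natural
-- coordinates ρ^k g^i x have the asymmetric arcs k to k and k - q^i; the symmetric ones are 2 k + 1
-- + q + ... + q^(i-1), and the relation for 2 t says exactly that these survive a full turn. In
-- X_o(5,r;q) the 5-cycles behave like lines of two types: lines of different type meet in layer k
-- when their labels differ by 2 (1 + ... + q^(k-1)). The six differences around a hexagon of lines
-- cancel, and so must those of the image. This leaves four possible relations for each of two
-- hexagons; the first forces 2 q = 1, hence 31 = 0, and then all four relations of the second fail.

record Cong (r : ℕ) (x y : ℤ) : Set where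
  constructor by
  field
    quot : ℤ
    eq   : x ≡ y + quot * + r

module _ {r : ℕ} where

  ≡⇒≋ : ∀ {x y} → x ≡ y → Cong r x y
  ≡⇒≋ {x} refl = by (+ 0) (lem x (+ r))
    where lem : ∀ x r → x ≡ x + + 0 * r
          lem = solve-∀

  ≋-refl : ∀ {x} → Cong r x x
  ≋-refl = ≡⇒≋ refl

  ≋-diff : ∀ {x y} → (h : Cong r x y) → x - y ≡ Cong.quot h * + r
  ≋-diff {x} {y} (by k e) = trans (cong (_- y) e) (lem y k (+ r))
    where lem : ∀ y k r → (y + k * r) - y ≡ k * r
          lem = solve-∀

  ≋-mk : ∀ {x y} k → x - y ≡ k * + r → Cong r x y
  ≋-mk {x} {y} k e = by k (trans (lem x y) (cong (λ z → y + z) e))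
    where lem : ∀ x y → x ≡ y + (x - y)
          lem = solve-∀

  -- Congruences are proved by certificates: the difference is written as a combination of
  -- differences already known to vanish, and a polynomial identity over the integers remains for
  -- the ring solver. The cofactors passed to `lin₁`, `lin₂` and `lin₃` are the outcome of an
  -- elimination.
  lin₁ : ∀ {x y a b} (u : ℤ) → Cong r a b → x - y ≡ u * (a - b) → Cong r x y
  lin₁ u h e = ≋-mk (u * Cong.quot h)
    (trans e (trans (cong (u *_) (≋-diff h)) (sym (ℤₚ.*-assoc u (Cong.quot h) (+ r)))))

  ≋-sym : ∀ {x y} → Cong r x y → Cong r y x
  ≋-sym {x} {y} h = lin₁ (- (+ 1)) h (lem x y)
    where lem : ∀ x y → y - x ≡ - (+ 1) * (x - y)
          lem = solve-∀

  lin₂ : ∀ {x y a b c d} (u v : ℤ) → Cong r a b → Cong r c d →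
         x - y ≡ u * (a - b) + v * (c - d) → Cong r x y
  lin₂ u v h h' e = ≋-mk (u * Cong.quot h + v * Cong.quot h')
    (trans e (trans (cong₂ (λ s t → u * s + v * t) (≋-diff h) (≋-diff h'))
      (lem u v (Cong.quot h) (Cong.quot h') (+ r))))
    where lem : ∀ u v k l r → u * (k * r) + v * (l * r) ≡ (u * k + v * l) * r
          lem = solve-∀

  ≋-trans : ∀ {x y z} → Cong r x y → Cong r y z → Cong r x z
  ≋-trans {x} {y} {z} h h' = lin₂ (+ 1) (+ 1) h h' (lem x y z)
    where lem : ∀ x y z → x - z ≡ + 1 * (x - y) + + 1 * (y - z)
          lem = solve-∀

  lin₃ : ∀ {x y a b c d e f} (u v w : ℤ) → Cong r a b → Cong r c d → Cong r e f →
         x - y ≡ u * (a - b) + v * (c - d) + w * (e - f) → Cong r x y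
  lin₃ {a = a} {b} {c} {d} {e} {f} u v w h h' h'' eq =
    lin₂ (+ 1) w (lin₂ {x = u * (a - b) + v * (c - d)} {y = + 0} u v h h' (lem₀ (u * (a - b) + v * (c - d)))) h'' (trans eq (lem (u * (a - b) + v * (c - d)) (w * (e - f))))
    where lem : ∀ s t → s + t ≡ + 1 * (s - + 0) + t
          lem = solve-∀
          lem₀ : ∀ s → s - + 0 ≡ s
          lem₀ = solve-∀

  +-≋ : ∀ {x y x' y'} → Cong r x y → Cong r x' y' → Cong r (x + x') (y + y')
  +-≋ {x} {y} {x'} {y'} h h' = lin₂ (+ 1) (+ 1) h h' (lem x y x' y')
    where lem : ∀ x y x' y' → (x + x') - (y + y') ≡ + 1 * (x - y) + + 1 * (x' - y')
          lem = solve-∀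

  *-≋ : ∀ {x y x' y'} → Cong r x y → Cong r x' y' → Cong r (x * x') (y * y')
  *-≋ {x} {y} {x'} {y'} h h' = lin₂ x' y h h' (lem x y x' y')
    where lem : ∀ x y x' y' → (x * x') - (y * y') ≡ x' * (x - y) + y * (x' - y')
          lem = solve-∀

  neg-≋ : ∀ {x y} → Cong r x y → Cong r (- x) (- y)
  neg-≋ {x} {y} h = lin₁ (- (+ 1)) h (lem x y)
    where lem : ∀ x y → - x - - y ≡ - (+ 1) * (x - y)
          lem = solve-∀

  ^-≋ : ∀ {x y} k → Cong r x y → Cong r (x ℤ.^ k) (y ℤ.^ k)
  ^-≋ zero    h = ≋-refl
  ^-≋ (suc k) h = *-≋ h (^-≋ k h)

  ≋⇒mod : ∀ {x y} → Cong r x y → x ≡[mod r ] y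
  ≋⇒mod h = ℤS.∣⇒∣ᵤ (ℤS.divides (Cong.quot h) (≋-diff h))

  mod⇒≋ : ∀ {x y} → x ≡[mod r ] y → Cong r x y
  mod⇒≋ h with ℤS.∣ᵤ⇒∣ h
  ... | ℤS.divides k e = ≋-mk k e

  ≋? : ∀ x y → Dec (Cong r x y)
  ≋? x y = Dec.map′ mod⇒≋ ≋⇒mod (r ℕD.∣? ℤ.∣ x - y ∣)

  r≋0 : Cong r (+ r) (+ 0)
  r≋0 = by (+ 1) (lem (+ r))
    where lem : ∀ r → r ≡ + 0 + + 1 * r
          lem = solve-∀

  ≋0⇒∣ : ∀ {n} → Cong r (+ n) (+ 0) → r ℕD.∣ n
  ≋0⇒∣ {n} h = subst (r ℕD.∣_) (cong ℤ.∣_∣ (ℤₚ.+-identityʳ (+ n))) (≋⇒mod h)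

private
  ∣-small : ∀ {r a b} → a ℕ.< r → b ℕ.≤ a → r ℕD.∣ (a ℕ.∸ b) → a ≡ b
  ∣-small {r} {a} {b} a<r b≤a d with a ℕ.∸ b in e
  ... | zero  = ℕₚ.≤-antisym (ℕₚ.m∸n≡0⇒m≤n e) b≤a
  ... | suc k = ⊥-elim (ℕₚ.<⇒≱ a<r (ℕₚ.≤-trans (ℕD.∣⇒≤ d) (subst (ℕ._≤ a) e (ℕₚ.m∸n≤m a b))))

  ≋-small≤ : ∀ {r a b} → a ℕ.< r → b ℕ.≤ a → Cong r (+ a) (+ b) → a ≡ b
  ≋-small≤ {r} {a} {b} a<r b≤a h = ∣-small a<r b≤a
    (subst (r ℕD.∣_) (cong ℤ.∣_∣ (trans (ℤₚ.m-n≡m⊖n a b) (ℤₚ.⊖-≥ b≤a))) (≋⇒mod h))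

≋-small : ∀ {r a b} → a ℕ.< r → b ℕ.< r → Cong r (+ a) (+ b) → a ≡ b
≋-small {r} {a} {b} a<r b<r h with ℕₚ.≤-total b a
... | inj₁ b≤a = ≋-small≤ a<r b≤a h
... | inj₂ a≤b = sym (≋-small≤ b<r a≤b (≋-sym h))

≋-Fin : ∀ {r} {a b : Fin r} → Cong r (+ toℕ a) (+ toℕ b) → a ≡ b
≋-Fin {_} {a} {b} h = Finₚ.toℕ-injective (≋-small (Finₚ.toℕ<n a) (Finₚ.toℕ<n b) h)

opaque
  ≋-residue : ∀ {r} → 0 ℕ.< r → ∀ x → Σ (Fin r) λ a → Cong r x (+ toℕ a)
  ≋-residue {suc r} _ x = Fin.fromℕ< (ℤM.n%ℕd<d x (suc r)) ,
    by (x ℤM./ℕ suc r) (trans (ℤM.a≡a%ℕn+[a/ℕn]*n x (suc r))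
       (cong (λ t → + t + (x ℤM./ℕ suc r) * + suc r) (sym (Finₚ.toℕ-fromℕ< (ℤM.n%ℕd<d x (suc r))))))

3≤⇒2≢0 : ∀ {r} → 3 ℕ.≤ r → ¬ Cong r (+ 2) (+ 0)
3≤⇒2≢0 3≤r h with ≋-small 3≤r (ℕₚ.≤-trans (s≤s z≤n) 3≤r) h
... | ()

-- Finite sets

module FiniteSets where

  private variable
    A : Set
    n : ℕ

  lookup-injective : ∀ {xs : List A} → Unique xs → ∀ i j → List.lookup xs i ≡ List.lookup xs j → i ≡ j
  lookup-injective (_ ∷ _)  Fin.zero    Fin.zero    _ = refl
  lookup-injective (p ∷ _)  Fin.zero    (Fin.suc j) e = ⊥-elim (All.lookup p (∈ₚ.∈-lookup j) e)
  lookup-injective (p ∷ _)  (Fin.suc i) Fin.zero    e = ⊥-elim (All.lookup p (∈ₚ.∈-lookup i) (sym e))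
  lookup-injective (_ ∷ us) (Fin.suc i) (Fin.suc j) e = cong Fin.suc (lookup-injective us i j e)

  unique⊆⇒length≤ : ∀ {xs ys : List A} → Unique xs → (∀ {x} → x ∈ xs → x ∈ ys) → length xs ≤ length ys
  unique⊆⇒length≤ {xs = xs} {ys} u sub = Finₚ.injective⇒≤ {f = f} f-inj
    where
    f : Fin (length xs) → Fin (length ys)
    f i = Any.index (sub (∈ₚ.∈-lookup i))
    f-inj : ∀ {i j} → f i ≡ f j → i ≡ j
    f-inj {i} {j} e = lookup-injective u i j
      (trans (Anyₚ.lookup-index (sub (∈ₚ.∈-lookup i)))
        (trans (cong (List.lookup ys) e) (sym (Anyₚ.lookup-index (sub (∈ₚ.∈-lookup j))))))

  opaque
    -- A missing `y` could be put in front of `xs`, giving a duplicate-free list inside `ys` that is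
    -- too long.
    unique-covers : (_≟_ : (x y : A) → Dec (x ≡ y)) → ∀ {xs ys : List A} → Unique xs →
      (∀ {x} → x ∈ xs → x ∈ ys) → length ys ≤ length xs → ∀ {y} → y ∈ ys → y ∈ xs
    unique-covers _≟_ {xs} {ys} u sub len {y} y∈ with Any.any? (y ≟_) xs
    ... | yes p = p
    ... | no ¬p = ⊥-elim (ℕₚ.<⇒≱ (unique⊆⇒length≤ {xs = y ∷ xs}
      (All.tabulate (λ z∈ e → ¬p (subst (_∈ xs) (sym e) z∈)) ∷ u)
      (λ { (here refl) → y∈ ; (there z∈) → sub z∈ })) len)

  unique-length : ∀ {xs ys : List A} → Unique xs → Unique ys →
    (∀ {x} → x ∈ xs → x ∈ ys) → (∀ {x} → x ∈ ys → x ∈ xs) → length xs ≡ length ys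
  unique-length u v s t = ℕₚ.≤-antisym (unique⊆⇒length≤ u s) (unique⊆⇒length≤ v t)

  opaque
    injective⇒surjective : (f : Fin n → Fin n) → (∀ {x y} → f x ≡ f y → x ≡ y) → ∀ y → ∃ λ x → f x ≡ y
    injective⇒surjective {n} f inj y
      with ∈ₚ.∈-map⁻ f {xs = List.allFin n} (unique-covers Fin._≟_ {map f (List.allFin n)} {List.allFin n}
        (Uniqueₚ.map⁺ inj (Uniqueₚ.allFin⁺ n)) (λ _ → ∈ₚ.∈-allFin _)
        (ℕₚ.≤-reflexive (sym (Listₚ.length-map f (List.allFin n)))) (∈ₚ.∈-allFin y))
    ... | x , _ , e = x , sym e

  elements : Subset n → List (Fin n)
  elements []            = []
  elements (inside  ∷ S) = Fin.zero ∷ map Fin.suc (elements S)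
  elements (outside ∷ S) = map Fin.suc (elements S)

  length-elements : (S : Subset n) → length (elements S) ≡ ∣ S ∣
  length-elements []            = refl
  length-elements (inside  ∷ S) = cong suc (trans (Listₚ.length-map Fin.suc (elements S)) (length-elements S))
  length-elements (outside ∷ S) = trans (Listₚ.length-map Fin.suc (elements S)) (length-elements S)

  elements-unique : (S : Subset n) → Unique (elements S)
  elements-unique []            = []
  elements-unique (inside  ∷ S) = All.tabulate zero∉ ∷ Uniqueₚ.map⁺ Finₚ.suc-injective (elements-unique S)
    where
    zero∉ : ∀ {x} → x ∈ map Fin.suc (elements S) → Fin.zero ≢ x
    zero∉ x∈ refl with ∈ₚ.∈-map⁻ Fin.suc {xs = elements S} x∈
    ... | _ , _ , ()
  elements-unique (outside ∷ S) = Uniqueₚ.map⁺ Finₚ.suc-injective (elements-unique S)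

  ∈-elements⁺ : ∀ (S : Subset n) {x} → x Sub.∈ S → x ∈ elements S
  ∈-elements⁺ (inside  ∷ S) here       = here refl
  ∈-elements⁺ (inside  ∷ S) (there x∈) = there (∈ₚ.∈-map⁺ Fin.suc (∈-elements⁺ S x∈))
  ∈-elements⁺ (outside ∷ S) (there x∈) = ∈ₚ.∈-map⁺ Fin.suc (∈-elements⁺ S x∈)

  ∈-elements⁻ : ∀ (S : Subset n) {x} → x ∈ elements S → x Sub.∈ S
  ∈-elements⁻ (inside ∷ S) (here refl) = here
  ∈-elements⁻ (inside ∷ S) (there x∈) with ∈ₚ.∈-map⁻ Fin.suc {xs = elements S} x∈
  ... | _ , y∈ , refl = there (∈-elements⁻ S y∈)
  ∈-elements⁻ (outside ∷ S) x∈ with ∈ₚ.∈-map⁻ Fin.suc {xs = elements S} x∈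
  ... | _ , y∈ , refl = there (∈-elements⁻ S y∈)

  opaque
    least : {P : ℕ → Set} → (∀ k → Dec (P k)) → ∀ N → P N → ∃ λ k → P k × (∀ l → l < k → ¬ P l)
    least P? N p with P? 0
    ... | yes p₀ = 0 , p₀ , λ _ ()
    least P? zero    p | no ¬p₀ = ⊥-elim (¬p₀ p)
    least P? (suc N) p | no ¬p₀ with least (P? ∘ suc) N p
    ... | k , pk , min = suc k , pk , λ { zero _ → ¬p₀ ; (suc l) (s≤s l<k) → min l l<k }

open FiniteSets

-- Units, parity and signs modulo r

injective⇒unit : ∀ {r} → 1 < r → ∀ s → (∀ k l → Cong r (k * s) (l * s) → Cong r k l) → ∃ λ q → Cong r (q * s) (+ 1)
injective⇒unit {r} 1<r s inj = + toℕ k , ≋-trans (mult-≋ k)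
    (≡⇒≋ (cong +_ (trans (cong toℕ (proj₂ onto)) (Finₚ.toℕ-fromℕ< 1<r))))
  where
  mult : Fin r → Fin r
  mult k = proj₁ (≋-residue (ℕₚ.≤-trans (s≤s z≤n) 1<r) (+ toℕ k * s))
  mult-≋ : ∀ k → Cong r (+ toℕ k * s) (+ toℕ (mult k))
  mult-≋ k = proj₂ (≋-residue (ℕₚ.≤-trans (s≤s z≤n) 1<r) (+ toℕ k * s))
  -- Multiplication by `s` is injective on the finite set Z_r, hence onto; the preimage of 1 is the
  -- inverse.
  onto : ∃ λ k → mult k ≡ Fin.fromℕ< 1<r
  onto = injective⇒surjective mult (λ {k} {l} e → ≋-Fin (inj _ _ (≋-trans (mult-≋ k)
    (≋-trans (≡⇒≋ (cong (λ t → + toℕ t) e)) (≋-sym (mult-≋ l)))))) (Fin.fromℕ< 1<r)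
  k = proj₁ onto

parity : ∀ p → (∃ λ k → p ≡ k ℕ.* 2) ⊎ (∃ λ k → p ≡ suc (k ℕ.* 2))
parity 0 = inj₁ (0 , refl)
parity 1 = inj₂ (0 , refl)
parity (suc (suc p)) with parity p
... | inj₁ (k , refl) = inj₁ (suc k , refl)
... | inj₂ (k , refl) = inj₂ (suc k , refl)

^-unit : ∀ {r u v} k → Cong r (u * v) (+ 1) → Cong r (u ^ k * v ^ k) (+ 1)
^-unit zero h = ≋-refl
^-unit {_} {u} {v} (suc k) h = lin₂ (u ^ k * v ^ k) (+ 1) h (^-unit k h) (lem u v (u ^ k) (v ^ k))
  where lem : ∀ u v x y → u * x * (v * y) - + 1 ≡ x * y * (u * v - + 1) + + 1 * (x * y - + 1)
        lem = solve-∀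

unit≢0 : ∀ {r u v} → 2 ≤ r → Cong r (u * v) (+ 1) → ¬ Cong r u (+ 0)
unit≢0 {r} {u} {v} 2≤r h h' with ≋-small {r} {1} {0} 2≤r (ℕₚ.≤-trans (s≤s z≤n) 2≤r) (lin₂ (- (+ 1)) v h h' (lem u v))
  where lem : ∀ u v → + 1 - + 0 ≡ - (+ 1) * (u * v - + 1) + v * (u - + 0)
        lem = solve-∀
... | ()

-- Signs are encoded in Fin 2, so that statements about all patterns of signs are decided by Finₚ.all?.
sgn : Fin 2 → ℤ
sgn Fin.zero = + 1
sgn (Fin.suc _) = - (+ 1)

-- The number of layers will divide such a sum, so only 1, 3 and 5 are possible for it.
sum₅ : ∀ e₀ e₁ e₂ e₃ e₄ → let s = sgn e₀ + sgn e₁ + sgn e₂ + sgn e₃ + sgn e₄ in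
  ℤ.∣ s ∣ ≡ 1 ⊎ ℤ.∣ s ∣ ≡ 3 ⊎ ℤ.∣ s ∣ ≡ 5
sum₅ = Dec.toWitness {a? = Finₚ.all? λ e₀ → Finₚ.all? λ e₁ → Finₚ.all? λ e₂ → Finₚ.all? λ e₃ → Finₚ.all? λ e₄ →
  let s = sgn e₀ + sgn e₁ + sgn e₂ + sgn e₃ + sgn e₄ in
  (ℤ.∣ s ∣ ℕ.≟ 1) ⊎-dec ((ℤ.∣ s ∣ ℕ.≟ 3) ⊎-dec (ℤ.∣ s ∣ ℕ.≟ 5))} _

prime-3 : Prime 3
prime-3 = Dec.from-yes (prime? 3)

prime-5 : Prime 5
prime-5 = Dec.from-yes (prime? 5)

∣prime : ∀ {p d} → Prime p → d ℕD.∣ p → d ≡ 1 ⊎ d ≡ p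
∣prime pp = prime⇒irreducible pp

≋-∣ : ∀ {d r x y} → d ℕD.∣ r → Cong r x y → Cong d x y
≋-∣ {d} {x = x} {y} (ℕD.divides c refl) (by k e) = by (k * + c)
  (trans e (cong (λ z → y + z) (trans (cong (k *_) (ℤₚ.pos-* c d)) (sym (ℤₚ.*-assoc k (+ c) (+ d))))))

%-≋ : ∀ i m .{{_ : ℕ.NonZero m}} → Cong m (+ i) (+ (i ℕM.% m))
%-≋ i m = by (+ (i ℕM./ m)) (trans (cong +_ (ℕM.m≡m%n+[m/n]*n i m))
  (trans (ℤₚ.pos-+ (i ℕM.% m) _) (cong (λ z → + (i ℕM.% m) + z) (ℤₚ.pos-* (i ℕM./ m) m))))

half : ∀ {r} → ¬ (2 ℕD.∣ r) → ∃ λ h → Cong r (+ 2 * h) (+ 1)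
half {r} odd with parity r
... | inj₁ (k , e) = ⊥-elim (odd (ℕD.divides k e))
-- For `r` = 2 k + 1 the inverse of 2 is k + 1.
... | inj₂ (k , refl) = + 1 + + k , by (+ 1) (trans (lem (+ k)) (cong (λ z → + 1 + + 1 * (+ 1 + z)) (sym (ℤₚ.pos-* k 2))))
  where lem : ∀ k → + 2 * (+ 1 + k) ≡ + 1 + + 1 * (+ 1 + k * + 2)
        lem = solve-∀


-- It makes the step width `q ^ i` a function of the layer in Z_m.
^-periodic : ∀ {r m q} .{{_ : ℕ.NonZero m}} → Cong r (q ^ m) (+ 1) → ∀ {a b} → Cong m (+ a) (+ b) → Cong r (q ^ a) (q ^ b)
^-periodic {r} {m} {q} h {a} {b} c = ≋-trans (reduce a) (≋-trans (≡⇒≋ (cong (q ^_) a%≡b%)) (≋-sym (reduce b)))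
  where
  a%≡b% : a ℕM.% m ≡ b ℕM.% m
  a%≡b% = ≋-small (ℕM.m%n<n a m) (ℕM.m%n<n b m) (≋-trans (≋-sym (%-≋ a m)) (≋-trans c (%-≋ b m)))
  reduce : ∀ a → Cong r (q ^ a) (q ^ (a ℕM.% m))
  reduce a = ≋-trans (≡⇒≋ (trans (cong (q ^_) (ℕM.m≡m%n+[m/n]*n a m)) (ℤₚ.^-distribˡ-+-* q (a ℕM.% m) (a ℕM./ m ℕ.* m))))
    (≋-trans (*-≋ {x = q ^ (a ℕM.% m)} ≋-refl (≋-trans (≡⇒≋ (trans (cong (q ^_) (ℕₚ.*-comm (a ℕM./ m) m)) (sym (ℤₚ.^-*-assoc q m (a ℕM./ m)))))
      (≋-trans (^-≋ (a ℕM./ m) h) (≡⇒≋ (ℤₚ.^-zeroˡ (a ℕM./ m)))))) (≡⇒≋ (ℤₚ.*-identityʳ _)))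

sgn²≡1 : ∀ e → sgn e * sgn e ≡ + 1
sgn²≡1 Fin.zero = refl
sgn²≡1 (Fin.suc Fin.zero) = refl

sgn-* : ∀ e e' → ∃ λ f → sgn f ≡ sgn e * sgn e'
sgn-* Fin.zero Fin.zero = Fin.zero , refl
sgn-* Fin.zero (Fin.suc Fin.zero) = Fin.suc Fin.zero , refl
sgn-* (Fin.suc Fin.zero) Fin.zero = Fin.suc Fin.zero , refl
sgn-* (Fin.suc Fin.zero) (Fin.suc Fin.zero) = Fin.zero , refl

-- Coordinates for X_o(m,r;q)

Arc : (m r : ℕ) (q : ℤ) → ℕ → ℤ → ℕ → ℤ → Set
Arc m r q i j i' j' = Cong m (+ i') (+ i + + 1) × (Cong r j' (j + q ℤ.^ i) ⊎ Cong r j' (j - q ℤ.^ i))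

Arc⇒XoArc : ∀ {m r q} {i i' : Fin m} {j j' : Fin r} →
  Arc m r q (toℕ i) (+ toℕ j) (toℕ i') (+ toℕ j') → XoArc m r q (i , j) (i' , j')
Arc⇒XoArc (h , k) = ≋⇒mod h , Sum.map ≋⇒mod ≋⇒mod k

XoArc⇒Arc : ∀ {m r q} {i i' : Fin m} {j j' : Fin r} →
  XoArc m r q (i , j) (i' , j') → Arc m r q (toℕ i) (+ toℕ j) (toℕ i') (+ toℕ j')
XoArc⇒Arc (h , k) = mod⇒≋ h , Sum.map mod⇒≋ mod⇒≋ k

module _ (Γ : Graph) {m r : ℕ} {q : ℤ} (0<r : 0 < r) (U : ℕ → ℤ → V Γ)
  (U-≋ : ∀ i {j j'} → Cong r j j' → U i j ≡ U i j')
  (U-inj : ∀ {i i' j j'} → i < m → i' < m → U i j ≡ U i' j' → (i ≡ i') × Cong r j j')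
  (U-onto : ∀ v → ∃ λ i → i < m × ∃ λ j → U i j ≡ v)
  (adj⁻ : ∀ {i i' j j'} → i < m → i' < m → _~_ Γ (U i j) (U i' j') → Arc m r q i j i' j' ⊎ Arc m r q i' j' i j)
  (adj⁺ : ∀ {i i' j j'} → i < m → i' < m → Arc m r q i j i' j' → _~_ Γ (U i j) (U i' j'))
  where

  mkIso : IsoXo Γ m r q
  mkIso = mk↔ₛ′ to from to∘from from∘to , λ { (i , j) (i' , j') → mk⇔ (forth i j i' j') (back i j i' j') }
    where
    to : Fin m × Fin r → V Γ
    to (i , j) = U (toℕ i) (+ toℕ j)
    from : V Γ → Fin m × Fin r
    from v = let (i , i<m , j , _) = U-onto v in fromℕ< i<m , proj₁ (≋-residue 0<r j)
    to∘from : ∀ v → to (from v) ≡ v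
    to∘from v = let (i , i<m , j , e) = U-onto v in
      trans (cong (λ i → U i (+ toℕ (proj₁ (≋-residue 0<r j)))) (Finₚ.toℕ-fromℕ< i<m)) (trans (U-≋ i (≋-sym (proj₂ (≋-residue 0<r j)))) e)
    from∘to : ∀ x → from (to x) ≡ x
    from∘to (i , j) = let (e , h) = U-inj (Finₚ.toℕ<n _) (Finₚ.toℕ<n i) (to∘from (to (i , j))) in
      cong₂ _,_ (Finₚ.toℕ-injective e) (≋-Fin h)
    forth : ∀ i j i' j' → XoAdj m r q (i , j) (i' , j') → _~_ Γ (to (i , j)) (to (i' , j'))
    forth i j i' j' (inj₁ h) = adj⁺ (Finₚ.toℕ<n i) (Finₚ.toℕ<n i') (XoArc⇒Arc h)
    forth i j i' j' (inj₂ h) = Graph.sym Γ _ _ (adj⁺ (Finₚ.toℕ<n i') (Finₚ.toℕ<n i) (XoArc⇒Arc h))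
    back : ∀ i j i' j' → _~_ Γ (to (i , j)) (to (i' , j')) → XoAdj m r q (i , j) (i' , j')
    back i j i' j' h = Sum.map Arc⇒XoArc Arc⇒XoArc (adj⁻ (Finₚ.toℕ<n i) (Finₚ.toℕ<n i') h)

-- Groups acting half-arc-transitively

perm-injective : ∀ {n} (g : Permutation′ n) {x y} → g ⟨$⟩ʳ x ≡ g ⟨$⟩ʳ y → x ≡ y
perm-injective g {x} {y} e = trans (sym (Perm.inverseˡ g)) (trans (cong (g ⟨$⟩ˡ_) e) (Perm.inverseˡ g))

module _ (Γ : Graph) where

  cycle₄ : ∀ {a b c d : V Γ} → _~_ Γ a b → _~_ Γ b c → _~_ Γ c d → _~_ Γ d a → a ≢ c → b ≢ d → Cycle Γ 4
  cycle₄ {a} {b} {c} {d} ab bc cd da a≢c b≢d = record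
    { len≥3 = s≤s (s≤s (s≤s z≤n)) ; vtx = v
    ; periodic = λ i → cong v (ℕₚ.+-comm i 4) ; distinct = dist ; edges = edge }
    where
    v : ℕ → V Γ
    v 0 = a
    v 1 = b
    v 2 = c
    v 3 = d
    v (suc (suc (suc (suc i)))) = v i
    edge : ∀ i → _~_ Γ (v i) (v (suc i))
    edge 0 = ab
    edge 1 = bc
    edge 2 = cd
    edge 3 = da
    edge (suc (suc (suc (suc i)))) = edge i
    irr : ∀ {x y} → _~_ Γ x y → x ≢ y
    irr {x} xy refl = Graph.irrefl Γ x xy
    dist : ∀ i j → i < 4 → j < 4 → v i ≡ v j → i ≡ j
    dist 0 0 _ _ e = refl
    dist 0 1 _ _ e = ⊥-elim (irr ab e)
    dist 0 2 _ _ e = ⊥-elim (a≢c e)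
    dist 0 3 _ _ e = ⊥-elim (irr da (sym e))
    dist 1 0 _ _ e = ⊥-elim (irr ab (sym e))
    dist 1 1 _ _ e = refl
    dist 1 2 _ _ e = ⊥-elim (irr bc e)
    dist 1 3 _ _ e = ⊥-elim (b≢d e)
    dist 2 0 _ _ e = ⊥-elim (a≢c (sym e))
    dist 2 1 _ _ e = ⊥-elim (irr bc (sym e))
    dist 2 2 _ _ e = refl
    dist 2 3 _ _ e = ⊥-elim (irr cd e)
    dist 3 0 _ _ e = ⊥-elim (irr da e)
    dist 3 1 _ _ e = ⊥-elim (b≢d (sym e))
    dist 3 2 _ _ e = ⊥-elim (irr cd (sym e))
    dist 3 3 _ _ e = refl
    dist (suc (suc (suc (suc i)))) _ (s≤s (s≤s (s≤s (s≤s ())))) _ _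
    dist 0 (suc (suc (suc (suc j)))) _ (s≤s (s≤s (s≤s (s≤s ())))) _
    dist 1 (suc (suc (suc (suc j)))) _ (s≤s (s≤s (s≤s (s≤s ())))) _
    dist 2 (suc (suc (suc (suc j)))) _ (s≤s (s≤s (s≤s (s≤s ())))) _
    dist 3 (suc (suc (suc (suc j)))) _ (s≤s (s≤s (s≤s (s≤s ())))) _

module _ {A : Set} {P Q : A → Set} where

  split : (xs : List A) → Unique xs → (∀ {x} → x ∈ xs → P x ⊎ Q x) →
    ∃₂ λ ps qs → Unique ps × Unique qs × All P ps × All Q qs × length ps ℕ.+ length qs ≡ length xs ×
      (∀ {x} → x ∈ ps → x ∈ xs) × (∀ {x} → x ∈ qs → x ∈ xs) × (∀ {x} → x ∈ xs → x ∈ ps ⊎ x ∈ qs)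
  split [] _ _ = [] , [] , [] , [] , [] , [] , refl , (λ ()) , (λ ()) , λ ()
  split (x ∷ xs) (x∉ ∷ u) d with split xs u (d ∘ there) | d (here refl)
  ... | ps , qs , up , uq , ap , aq , len , sp , sq , cov | inj₁ px =
    x ∷ ps , qs , All.tabulate (λ y∈ → All.lookup x∉ (sp y∈)) ∷ up , uq , px ∷ ap , aq , cong suc len ,
    (λ { (here e) → here e ; (there y∈) → there (sp y∈) }) , there ∘ sq ,
    λ { (here e) → inj₁ (here e) ; (there y∈) → Sum.map₁ there (cov y∈) }
  ... | ps , qs , up , uq , ap , aq , len , sp , sq , cov | inj₂ qx =
    ps , x ∷ qs , up , All.tabulate (λ y∈ → All.lookup x∉ (sq y∈)) ∷ uq , ap , qx ∷ aq ,
    trans (ℕₚ.+-suc _ _) (cong suc len) , there ∘ sp ,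
    (λ { (here e) → here e ; (there y∈) → there (sq y∈) }) ,
    λ { (here e) → inj₂ (here e) ; (there y∈) → Sum.map₂ there (cov y∈) }

-- Both directions are stated with `+ 1 + k`, the index shift that occurs in powers of a permutation
-- and in alternating trails.
ℤ-ind : (P : ℤ → Set) → P (+ 0) → (∀ k → P k → P (+ 1 + k)) → (∀ k → P (+ 1 + k) → P k) → ∀ k → P k
ℤ-ind P z up down (+ zero)        = z
ℤ-ind P z up down (+ suc n)       = up (+ n) (ℤ-ind P z up down (+ n))
ℤ-ind P z up down -[1+ zero ]     = down -[1+ 0 ] z
ℤ-ind P z up down -[1+ suc n ]    = down -[1+ suc n ] (ℤ-ind P z up down -[1+ n ])

module _ {n : ℕ} (f : Permutation′ n) where

  iter : (Fin n → Fin n) → ℕ → Fin n → Fin n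
  iter h zero    x = x
  iter h (suc k) x = h (iter h k x)

  pow : ℤ → Fin n → Fin n
  pow (+ k)     x = iter (f ⟨$⟩ʳ_) k x
  pow -[1+ k ]  x = iter (f ⟨$⟩ˡ_) (suc k) x

  pow-suc : ∀ k x → pow (+ 1 + k) x ≡ f ⟨$⟩ʳ pow k x
  pow-suc (+ k)        x = refl
  pow-suc -[1+ zero ]  x = sym (Perm.inverseʳ f)
  pow-suc -[1+ suc k ] x = sym (Perm.inverseʳ f)

  opaque
    pow-+ : ∀ k l x → pow (k + l) x ≡ pow k (pow l x)
    pow-+ k l x = ℤ-ind (λ k → pow (k + l) x ≡ pow k (pow l x))
      (cong (λ z → pow z x) (ℤₚ.+-identityˡ l))
      (λ k e → trans (cong (λ z → pow z x) (ℤₚ.+-assoc (+ 1) k l))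
        (trans (pow-suc (k + l) x) (trans (cong (f ⟨$⟩ʳ_) e) (sym (pow-suc k (pow l x))))))
      (λ k e → perm-injective f (trans (sym (pow-suc (k + l) x)) (trans (cong (λ z → pow z x) (sym (ℤₚ.+-assoc (+ 1) k l)))
        (trans e (pow-suc k (pow l x)))))) k

  pow-injective : ∀ k {x y} → pow k x ≡ pow k y → x ≡ y
  pow-injective k {x} {y} = ℤ-ind (λ k → pow k x ≡ pow k y → x ≡ y) (λ e → e)
    (λ k ih e → ih (perm-injective f (trans (sym (pow-suc k x)) (trans e (pow-suc k y)))))
    (λ k ih e → ih (trans (pow-suc k x) (trans (cong (f ⟨$⟩ʳ_) e) (sym (pow-suc k y))))) k

  pow-lift₂ : {R : Fin n → Fin n → Set} → (∀ {x y} → R x y → R (f ⟨$⟩ʳ x) (f ⟨$⟩ʳ y)) →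
    (∀ {x y} → R (f ⟨$⟩ʳ x) (f ⟨$⟩ʳ y) → R x y) → ∀ k {x y} → R x y → R (pow k x) (pow k y)
  pow-lift₂ {R} up down k {x} {y} h = ℤ-ind (λ k → R (pow k x) (pow k y)) h
    (λ k → subst₂ R (sym (pow-suc k x)) (sym (pow-suc k y)) ∘ up)
    (λ k → down ∘ subst₂ R (pow-suc k x) (pow-suc k y)) k

  pow-mono : ∀ k l x → pow (k + l) x ≡ pow k x → pow l x ≡ x
  pow-mono k l x e = pow-injective k (trans (sym (pow-+ k l x)) e)

  pow-quot : ∀ r x → pow (+ r) x ≡ x → ∀ k → pow (k * + r) x ≡ x
  pow-quot r x e = ℤ-ind (λ k → pow (k * + r) x ≡ x) refl
    (λ k ih → trans (cong (λ z → pow z x) (lem k (+ r))) (trans (pow-+ (+ r) (k * + r) x) (trans (cong (pow (+ r)) ih) e)))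
    (λ k ih → pow-injective (+ r) (trans (sym (pow-+ (+ r) (k * + r) x))
       (trans (cong (λ z → pow z x) (sym (lem k (+ r)))) (trans ih (sym e)))))
    where lem : ∀ k r → (+ 1 + k) * r ≡ r + k * r
          lem = solve-∀

  opaque
    pow-≋ : ∀ r x → pow (+ r) x ≡ x → ∀ {k l} → Cong r k l → pow k x ≡ pow l x
    pow-≋ r x e {k} {l} (by c refl) = trans (pow-+ l (c * + r) x) (cong (pow l) (pow-quot r x e c))

  opaque
    -- By the pigeonhole principle two iterates coincide, and cancelling the smaller exponent gives
    -- a return to `x`. The least positive return divides all others, since a nonzero remainder
    -- would be a smaller one.
    period : ∀ x → ∃ λ r → 0 < r × pow (+ r) x ≡ x × (∀ k l → pow k x ≡ pow l x → Cong r k l)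
    period x with Finₚ.pigeonhole (ℕₚ.n<1+n n) (λ (i : Fin (suc n)) → pow (+ toℕ i) x)
    ... | i , j , i<j , e with least {λ k → pow (+ suc k) x ≡ x} (λ k → pow (+ suc k) x Fin.≟ x) (toℕ j ℕ.∸ suc (toℕ i)) hit
      where
      hit : pow (+ suc (toℕ j ℕ.∸ suc (toℕ i))) x ≡ x
      hit = pow-mono (+ toℕ i) (+ suc (toℕ j ℕ.∸ suc (toℕ i))) x (trans (cong (λ z → pow (+ z) x)
        (trans (ℕₚ.+-suc (toℕ i) _) (ℕₚ.m+[n∸m]≡n i<j))) (sym e))
    ... | r , e' , min = suc r , s≤s z≤n , e' , λ k l eq → ≋-trans (lem k l) (≋-trans (+-≋ (zero-diff k l eq) ≋-refl) (≡⇒≋ (ℤₚ.+-identityˡ l)))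
      where
      lem : ∀ k l → Cong (suc r) k ((k - l) + l)
      lem k l = ≡⇒≋ (lem' k l)
        where lem' : ∀ k l → k ≡ (k - l) + l
              lem' = solve-∀
      zero-diff : ∀ k l → pow k x ≡ pow l x → Cong (suc r) (k - l) (+ 0)
      zero-diff k l eq with ≋-residue {suc r} (s≤s z≤n) (k - l)
      ... | c , h with toℕ c in ec
      ... | zero  = h
      ... | suc c' = ⊥-elim (min c' (ℕ.s<s⁻¹ (subst (_< suc r) ec (Finₚ.toℕ<n c)))
              (trans (sym (pow-≋ (suc r) x e' h)) (pow-mono l (k - l) x
                (trans (cong (λ z → pow z x) (lem'' k l)) eq))))
        where lem'' : ∀ k l → l + (k - l) ≡ k
              lem'' = solve-∀

neg-^ : ∀ q i → (- q) ^ i ≡ q ^ i ⊎ (- q) ^ i ≡ - (q ^ i)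
neg-^ q zero = inj₁ refl
neg-^ q (suc i) = [ (λ e → inj₂ (trans (cong (- q *_) e) (sym (ℤₚ.neg-distribˡ-* q (q ^ i)))))
                  , (λ e → inj₁ (trans (cong (- q *_) e) (lem q (q ^ i)))) ]′ (neg-^ q i)
  where lem : ∀ q x → - q * - x ≡ q * x
        lem = solve-∀

-- Negating `q` at most exchanges the two alternatives + q^i and - q^i, so the graph stays the same.
-- This will turn q^m = -1 into q^m = 1.
Arc-neg : ∀ m r q i j i' j' → Arc m r q i j i' j' → Arc m r (- q) i j i' j'
Arc-neg m r q i j i' j' (c , d) with neg-^ q i
... | inj₁ e = c , subst (λ x → Cong r j' (j + x) ⊎ Cong r j' (j - x)) (sym e) d
... | inj₂ e = c , subst (λ x → Cong r j' (j + x) ⊎ Cong r j' (j - x)) (sym e)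
  ([ (λ h → inj₂ (subst (λ z → Cong r j' (j + z)) (sym (ℤₚ.neg-involutive (q ^ i))) h)) , inj₁ ]′ d)

-- The induced orientation and its valencies

module Attached (Γ : Graph) (tet : Tetravalent Γ) (girth : Girth Γ 5)
  (G : Subgroup Γ) (hat : HalfArcTransitiveOn Γ (mem G))
  (a b : V Γ) (a~b : _~_ Γ a b) where

  private
    n = Graph.n Γ
    _∼_ = _~_ Γ
    module S = IsSubgroup (isSub G)

  O : V Γ → V Γ → Set
  O = Oriented Γ (mem G) a b

  ∼-sym : ∀ {x y} → x ∼ y → y ∼ x
  ∼-sym {x} {y} = Graph.sym Γ x y

  O⇒∼ : ∀ {x y} → O x y → x ∼ y
  O⇒∼ (g , mg , refl , refl) = Equivalence.to (S.auts g mg a b) a~b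

  opaque
    O-act : ∀ {x y} g → mem G g → O x y → O (g ⟨$⟩ʳ x) (g ⟨$⟩ʳ y)
    O-act g mg (h , mh , refl , refl) with S.hasMul g h mg mh
    ... | k , mk , e = k , mk , e a , e b

  opaque
    O-transitive : ∀ {x y x' y'} → O x y → O x' y' → ∃ λ g → mem G g × (g ⟨$⟩ʳ x ≡ x') × (g ⟨$⟩ʳ y ≡ y')
    O-transitive (g , mg , refl , refl) (h , mh , refl , refl) with S.hasInv g mg
    ... | k , mk , inv with S.hasMul h k mh mk
    ... | l , ml , e = l , ml , trans (e _) (cong (h ⟨$⟩ʳ_) (inv a)) , trans (e _) (cong (h ⟨$⟩ʳ_) (inv b))

  opaque
    O-total : ∀ {x y} → x ∼ y → O x y ⊎ O y x
    O-total {x} {y} xy with proj₁ (proj₂ hat) a b x y a~b xy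
    ... | g , mg , inj₁ (e , f) = inj₁ (g , mg , e , f)
    ... | g , mg , inj₂ (e , f) = inj₂ (g , mg , e , f)

  opaque
    -- If one edge carried both directions, then by transitivity every edge would, and `G` could
    -- move any arc to any other.
    O-antisym : ∀ {x y} → O x y → O y x → ⊥
    O-antisym {x} {y} xy yx = proj₂ (proj₂ hat) λ u v u' v' uv u'v' → O-transitive (both uv) (both u'v')
      where
      both : ∀ {u v} → u ∼ v → O u v
      both uv with O-total uv
      ... | inj₁ o = o
      ... | inj₂ o with O-transitive xy o
      ... | g , mg , refl , refl = O-act g mg yx

  opaque
    -- A second common neighbour would close a 4-cycle. Later this serves to identify a vertex by
    -- two of its neighbours.
    noSquare : ∀ {u v x y} → u ≢ v → u ∼ x → v ∼ x → u ∼ y → v ∼ y → x ≡ y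
    noSquare {u} {v} {x} {y} u≢v ux vx uy vy with x Fin.≟ y
    ... | yes e = e
    ... | no x≢y = ⊥-elim (proj₂ girth 4 (s≤s (s≤s (s≤s (s≤s (s≤s z≤n)))))
      (cycle₄ Γ ux (∼-sym vx) vy (∼-sym uy) u≢v x≢y))

  opaque
    hasOut : ∀ v → ∃ λ y → O v y
    hasOut v with proj₁ hat a v
    ... | g , mg , refl with S.hasId
    ... | e , me , ide = g ⟨$⟩ʳ b , O-act g mg (e , me , ide a , ide b)

  opaque
    hasIn : ∀ v → ∃ λ y → O y v
    hasIn v with proj₁ hat b v
    ... | g , mg , refl with S.hasId
    ... | e , me , ide = g ⟨$⟩ʳ a , O-act g mg (e , me , ide a , ide b)

  private
    out⇒ : ∀ v v' → (∀ {y y'} → O v y → O v y' → y ≡ y') → ∀ {y y'} → O v' y → O v' y' → y ≡ y'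
    out⇒ v v' u {y} {y'} o o' with proj₁ hat v' v
    ... | g , mg , refl = perm-injective g (u (O-act g mg o) (O-act g mg o'))
    in⇒ : ∀ v v' → (∀ {y y'} → O y v → O y' v → y ≡ y') → ∀ {y y'} → O y v' → O y' v' → y ≡ y'
    in⇒ v v' u {y} {y'} o o' with proj₁ hat v' v
    ... | g , mg , refl = perm-injective g (u (O-act g mg o) (O-act g mg o'))

  -- If every vertex had a single out-neighbour, taking it would be a bijection of the finite vertex set.
  uniqueOut⇒uniqueIn : ∀ v → (∀ {y y'} → O v y → O v y' → y ≡ y') → ∀ {y y'} → O y v → O y' v → y ≡ y'
  uniqueOut⇒uniqueIn v u {y} {y'} o o' with onto y | onto y'
    where
    onto = injective⇒surjective (λ x → proj₁ (hasIn x))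
      (λ {x} {x'} e → out⇒ v _ u (subst (λ z → O z x) e (proj₂ (hasIn x))) (proj₂ (hasIn x')))
  ... | x , refl | x' , refl = cong (λ z → proj₁ (hasIn z))
    (trans (out⇒ v _ u (proj₂ (hasIn x)) o) (sym (out⇒ v _ u (proj₂ (hasIn x')) o')))

  uniqueIn⇒uniqueOut : ∀ v → (∀ {y y'} → O y v → O y' v → y ≡ y') → ∀ {y y'} → O v y → O v y' → y ≡ y'
  uniqueIn⇒uniqueOut v u {y} {y'} o o' with onto y | onto y'
    where
    onto = injective⇒surjective (λ x → proj₁ (hasOut x))
      (λ {x} {x'} e → in⇒ v _ u (subst (O x) e (proj₂ (hasOut x))) (proj₂ (hasOut x')))
  ... | x , refl | x' , refl = cong (λ z → proj₁ (hasOut z))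
    (trans (in⇒ v _ u (proj₂ (hasOut x)) o) (sym (in⇒ v _ u (proj₂ (hasOut x')) o')))

  record Two (P : V Γ → Set) : Set where
    constructor two
    field
      {p q}    : V Γ
      p≢q      : p ≢ q
      Pp       : P p
      Pq       : P q
      only     : ∀ {z} → P z → (z ≡ p) ⊎ (z ≡ q)

  opaque
    -- The four neighbours are split into out- and in-neighbours, and both kinds occur. A split 1 +
    -- 3 or 3 + 1 is impossible, because a single neighbour of one kind forces a single one of the
    -- other.
    degrees : ∀ v → Two (O v) × Two (λ y → O y v)
    degrees v with tet v
    ... | S , S⇔ , card with split {P = O v} {Q = λ y → O y v} (elements S) (elements-unique S)
                              (λ {x} x∈ → O-total (Equivalence.to (S⇔ x) (∈-elements⁻ S x∈)))
    ... | ps , qs , up , uq , ap , aq , len , _ , _ , cov =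
      analyse ps qs up uq ap aq (trans len (trans (length-elements S) card)) onlyP onlyQ
      where
      mem⁺ : ∀ {z} → v ∼ z → z ∈ ps ⊎ z ∈ qs
      mem⁺ {z} vz = cov (∈-elements⁺ S (Equivalence.from (S⇔ z) vz))
      onlyP : ∀ {z} → O v z → z ∈ ps
      onlyP o with mem⁺ (O⇒∼ o)
      ... | inj₁ z∈ = z∈
      ... | inj₂ z∈ = ⊥-elim (O-antisym o (All.lookup aq z∈))
      onlyQ : ∀ {z} → O z v → z ∈ qs
      onlyQ o with mem⁺ (∼-sym (O⇒∼ o))
      ... | inj₂ z∈ = z∈
      ... | inj₁ z∈ = ⊥-elim (O-antisym o (All.lookup ap z∈))
      ∈[] : ∀ {z : V Γ} {A : Set} → z ∈ [] → A
      ∈[] ()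
      ∈[x] : ∀ {z z' x : V Γ} → z ∈ x ∷ [] → z' ∈ x ∷ [] → z ≡ z'
      ∈[x] (here refl) (here refl) = refl
      ∈[xy] : ∀ {z x y : V Γ} → z ∈ x ∷ y ∷ [] → (z ≡ x) ⊎ (z ≡ y)
      ∈[xy] (here e) = inj₁ e
      ∈[xy] (there (here e)) = inj₂ e
      analyse : ∀ ps qs → Unique ps → Unique qs → All (O v) ps → All (λ y → O y v) qs →
        length ps ℕ.+ length qs ≡ 4 → (∀ {z} → O v z → z ∈ ps) → (∀ {z} → O z v → z ∈ qs) →
        Two (O v) × Two (λ y → O y v)
      analyse [] _ _ _ _ _ _ f _ = ∈[] (f (proj₂ (hasOut v)))
      analyse (_ ∷ []) (_ ∷ _ ∷ _) _ ((d ∷ _) ∷ _) _ (o ∷ o' ∷ _) _ f _ =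
        ⊥-elim (d (uniqueOut⇒uniqueIn v (λ p p' → ∈[x] (f p) (f p')) o o'))
      analyse (_ ∷ _ ∷ []) (_ ∷ _ ∷ []) ((d ∷ []) ∷ _) ((d' ∷ []) ∷ _) (o₁ ∷ o₂ ∷ []) (o₃ ∷ o₄ ∷ []) _ f h =
        two d o₁ o₂ (∈[xy] ∘ f) , two d' o₃ o₄ (∈[xy] ∘ h)
      analyse (_ ∷ _ ∷ _ ∷ _) (_ ∷ []) ((d ∷ _) ∷ _) _ (o ∷ o' ∷ _) _ _ _ h =
        ⊥-elim (d (uniqueIn⇒uniqueOut v (λ p p' → ∈[x] (h p) (h p')) o o'))
      analyse (_ ∷ _ ∷ _ ∷ _) [] _ _ _ _ _ _ h = ∈[] (h (proj₂ (hasIn v)))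
      analyse (_ ∷ []) [] _ _ _ _ ()
      analyse (_ ∷ []) (_ ∷ []) _ _ _ _ ()
      analyse (_ ∷ _ ∷ []) [] _ _ _ _ ()
      analyse (_ ∷ _ ∷ []) (_ ∷ []) _ _ _ _ ()
      analyse (_ ∷ _ ∷ []) (_ ∷ _ ∷ _ ∷ _) _ _ _ _ ()
      analyse (_ ∷ _ ∷ _ ∷ []) (_ ∷ _ ∷ _) _ _ _ _ ()
      analyse (_ ∷ _ ∷ _ ∷ _ ∷ []) (_ ∷ _ ∷ _) _ _ _ _ ()
      analyse (_ ∷ _ ∷ _ ∷ _ ∷ _ ∷ _) (_ ∷ _ ∷ _) _ _ _ _ ()

  opaque
    Two-other : ∀ {P} → Two P → ∀ {x} → P x → ∃ λ y → (y ≢ x) × P y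
    Two-other (two {p} {q} d pp pq only) px with only px
    ... | inj₁ refl = q , d ∘ sym , pq
    ... | inj₂ refl = p , d , pp

  opaque
    Two-same : ∀ {P} → Two P → ∀ {x y z} → P x → P y → P z → y ≢ x → z ≢ x → y ≡ z
    Two-same (two _ _ _ only) px py pz y≢x z≢x with only px | only py | only pz
    ... | inj₁ refl | inj₁ refl | _         = ⊥-elim (y≢x refl)
    ... | inj₁ refl | inj₂ refl | inj₁ refl = ⊥-elim (z≢x refl)
    ... | inj₁ refl | inj₂ refl | inj₂ refl = refl
    ... | inj₂ refl | inj₂ refl | _         = ⊥-elim (y≢x refl)
    ... | inj₂ refl | inj₁ refl | inj₂ refl = ⊥-elim (z≢x refl)
    ... | inj₂ refl | inj₁ refl | inj₁ refl = refl

  opaque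
    Two-only : ∀ {P} → Two P → ∀ {x y z} → P x → P y → x ≢ y → P z → (z ≡ x) ⊎ (z ≡ y)
    Two-only t {x} {y} {z} px py x≢y pz with z Fin.≟ x
    ... | yes e = inj₁ e
    ... | no z≢x = inj₂ (Two-same t px pz py z≢x (x≢y ∘ sym))

  outs : ∀ v → Two (O v)
  outs v = proj₁ (degrees v)
  ins : ∀ v → Two (λ y → O y v)
  ins v = proj₂ (degrees v)

  -- Alternating trails

  O-pow : ∀ g → mem G g → ∀ k {x y} → O x y → O (pow g k x) (pow g k y)
  O-pow g mg = pow-lift₂ g {O} (O-act g mg) down
    where
    down : ∀ {x y} → O (g ⟨$⟩ʳ x) (g ⟨$⟩ʳ y) → O x y
    down o with S.hasInv g mg
    ... | h , mh , inv = subst₂ O (inv _) (inv _) (O-act h mh o)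

  -- An alternating cycle unrolled over the integers, with tails `T` and heads `H`: T 0 → H 0 ← T 1
  -- → H 1 ← T 2 and so on. The last two fields forbid turning back.
  record Trail (T H : ℤ → V Γ) : Set where
    field
      fwd : ∀ k → O (T k) (H k)
      bwd : ∀ k → O (T (+ 1 + k)) (H k)
      T≢  : ∀ k → T (+ 1 + k) ≢ T k
      H≢  : ∀ k → H (+ 1 + k) ≢ H k

  module _ {T H : ℤ → V Γ} (t : Trail T H) where
    open Trail t

    shift : ∀ c → Trail (λ k → T (c + k)) (λ k → H (c + k))
    shift c = record
      { fwd = λ k → fwd (c + k)
      ; bwd = λ k → subst (λ z → O (T z) (H (c + k))) (lem c k) (bwd (c + k))
      ; T≢ = λ k → subst (λ z → T z ≢ T (c + k)) (lem c k) (T≢ (c + k))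
      ; H≢ = λ k → subst (λ z → H z ≢ H (c + k)) (lem c k) (H≢ (c + k)) }
      where lem : ∀ c k → + 1 + (c + k) ≡ c + (+ 1 + k)
            lem = solve-∀

    reverse : ∀ c → Trail (λ k → T (c - k)) (λ k → H (c - (+ 1 + k)))
    reverse c = record
      { fwd = λ k → subst (λ z → O (T z) (H (c - (+ 1 + k)))) (lem c k) (bwd (c - (+ 1 + k)))
      ; bwd = λ k → fwd (c - (+ 1 + k))
      ; T≢ = λ k e → T≢ (c - (+ 1 + k)) (trans (cong T (lem c k)) (sym e))
      ; H≢ = λ k e → H≢ (c - (+ 1 + (+ 1 + k))) (trans (cong H (lem c (+ 1 + k))) (sym e)) }
      where lem : ∀ c k → + 1 + (c - (+ 1 + k)) ≡ c - k
            lem = solve-∀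

    act : ∀ g → mem G g → Trail (λ k → g ⟨$⟩ʳ T k) (λ k → g ⟨$⟩ʳ H k)
    act g mg = record
      { fwd = λ k → O-act g mg (fwd k) ; bwd = λ k → O-act g mg (bwd k)
      ; T≢ = λ k → T≢ k ∘ perm-injective g ; H≢ = λ k → H≢ k ∘ perm-injective g }

    inOf : ∀ {x} k → O x (H k) → (x ≡ T k) ⊎ (x ≡ T (+ 1 + k))
    inOf k = Two-only (ins (H k)) (fwd k) (bwd k) (T≢ k ∘ sym)

    outOf : ∀ {y} k → O (T (+ 1 + k)) y → (y ≡ H k) ⊎ (y ≡ H (+ 1 + k))
    outOf k = Two-only (outs (T (+ 1 + k))) (bwd k) (fwd (+ 1 + k)) (H≢ k ∘ sym)

  opaque
    -- In- and out-valency 2 leave no choice: at every vertex the trail goes on along the other arc,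
    -- so one arc determines it in both directions.
    sync : ∀ {T H T' H'} → Trail T H → Trail T' H' → T (+ 0) ≡ T' (+ 0) → H (+ 0) ≡ H' (+ 0) →
           ∀ k → T k ≡ T' k × H k ≡ H' k
    sync {T} {H} {T'} {H'} t t' e f = ℤ-ind (λ k → T k ≡ T' k × H k ≡ H' k) (e , f) up down
      where
      module A = Trail t
      module B = Trail t'
      up : ∀ k → T k ≡ T' k × H k ≡ H' k → T (+ 1 + k) ≡ T' (+ 1 + k) × H (+ 1 + k) ≡ H' (+ 1 + k)
      up k (p , q) = eT , eH
        where
        eT : T (+ 1 + k) ≡ T' (+ 1 + k)
        eT = Two-same (ins (H k)) (A.fwd k) (A.bwd k) (subst (O _) (sym q) (B.bwd k)) (A.T≢ k)
               (λ z → B.T≢ k (trans z p))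
        eH : H (+ 1 + k) ≡ H' (+ 1 + k)
        eH = Two-same (outs (T (+ 1 + k))) (A.bwd k) (A.fwd (+ 1 + k)) (subst (λ z → O z _) (sym eT) (B.fwd (+ 1 + k)))
               (A.H≢ k) (λ z → B.H≢ k (trans z q))
      down : ∀ k → T (+ 1 + k) ≡ T' (+ 1 + k) × H (+ 1 + k) ≡ H' (+ 1 + k) → T k ≡ T' k × H k ≡ H' k
      down k (p , q) = eT , eH
        where
        eH : H k ≡ H' k
        eH = Two-same (outs (T (+ 1 + k))) (A.fwd (+ 1 + k)) (A.bwd k) (subst (λ z → O z _) (sym p) (B.bwd k))
               (A.H≢ k ∘ sym) (λ z → B.H≢ k (trans (sym q) (sym z)))
        eT : T k ≡ T' k
        eT = Two-same (ins (H k)) (A.bwd k) (A.fwd k) (subst (O _) (sym eH) (B.fwd k))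
               (A.T≢ k ∘ sym) (λ z → B.T≢ k (trans (sym p) (sym z)))

  opaque
    -- At the common tail the arc to `H c` is one of the two arcs of the second trail; which one
    -- decides between equal and opposite direction.
    sync-at : ∀ {T H T' H'} → Trail T H → Trail T' H' → ∀ c d → T c ≡ T' d →
      (∀ k → T (c + k) ≡ T' (d + k) × H (c + k) ≡ H' (d + k)) ⊎
      (∀ k → T (c + k) ≡ T' (d - k) × H (c + k) ≡ H' (d - (+ 1 + k)))
    sync-at {T} {H} {T'} {H'} t t' c d e with outOf t' {H c} (d - + 1)
        (subst (λ z → O z (H c)) (trans e (cong T' (lem d))) (Trail.fwd t c))
      where lem : ∀ d → d ≡ + 1 + (d - + 1)
            lem = solve-∀
    ... | inj₁ f = inj₂ (sync (shift t c) (reverse t' d) (trans (cong T (l₁ c)) (trans e (cong T' (l₂ d))))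
                     (trans (cong H (l₁ c)) (trans f (cong H' (l₃ d)))))
      where
      l₁ : ∀ c → c + + 0 ≡ c
      l₁ = solve-∀
      l₂ : ∀ d → d ≡ d - + 0
      l₂ = solve-∀
      l₃ : ∀ d → d - + 1 ≡ d - (+ 1 + + 0)
      l₃ = solve-∀
    ... | inj₂ f = inj₁ (sync (shift t c) (shift t' d) (trans (cong T (l₁ c)) (trans e (cong T' (sym (l₁ d)))))
                     (trans (cong H (l₁ c)) (trans f (cong H' (l₃ d)))))
      where
      l₁ : ∀ c → c + + 0 ≡ c
      l₁ = solve-∀
      l₃ : ∀ d → + 1 + (d - + 1) ≡ d + + 0
      l₃ = solve-∀

  zig : (T H : ℤ → V Γ) → ℕ → V Γ
  zig T H 0 = T (+ 0)
  zig T H 1 = H (+ 0)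
  zig T H (suc (suc p)) = zig (λ k → T (+ 1 + k)) (λ k → H (+ 1 + k)) p

  zig-even : ∀ T H k → zig T H (k ℕ.* 2) ≡ T (+ k)
  zig-even T H zero    = refl
  zig-even T H (suc k) = zig-even (λ k → T (+ 1 + k)) (λ k → H (+ 1 + k)) k

  zig-odd : ∀ T H k → zig T H (suc (k ℕ.* 2)) ≡ H (+ k)
  zig-odd T H zero    = refl
  zig-odd T H (suc k) = zig-odd (λ k → T (+ 1 + k)) (λ k → H (+ 1 + k)) k

  record ClosedTrail (r : ℕ) (T H : ℤ → V Γ) : Set where
    field
      trail : Trail T H
      T-≋   : ∀ {k l} → Cong r k l → T k ≡ T l
      H-≋   : ∀ {k l} → Cong r k l → H k ≡ H l
      T-inj : ∀ k l → T k ≡ T l → Cong r k l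
      H-inj : ∀ k l → H k ≡ H l → Cong r k l
      disj  : ∀ k l → T k ≢ H l
    open Trail trail public

  act-closed : ∀ {r T H} → ClosedTrail r T H → ∀ g → mem G g →
               ClosedTrail r (λ k → g ⟨$⟩ʳ T k) (λ k → g ⟨$⟩ʳ H k)
  act-closed c g mg = record
    { trail = act C.trail g mg
    ; T-≋ = λ h → cong (g ⟨$⟩ʳ_) (C.T-≋ h) ; H-≋ = λ h → cong (g ⟨$⟩ʳ_) (C.H-≋ h)
    ; T-inj = λ k l → C.T-inj k l ∘ perm-injective g ; H-inj = λ k l → C.H-inj k l ∘ perm-injective g
    ; disj = λ k l → C.disj k l ∘ perm-injective g }
    where module C = ClosedTrail c

  module _ {r T H} (c : ClosedTrail r T H) (3≤r : 3 ≤ r) where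
    open ClosedTrail c

    private
      v = zig T H

      halve : ∀ {k} → k ℕ.* 2 < r ℕ.* 2 → k < r
      halve {k} = ℕₚ.*-cancelʳ-< 2 k r

      per : ∀ i → v (i ℕ.+ r ℕ.* 2) ≡ v i
      per i with parity i
      ... | inj₁ (k , refl) = trans (cong v (sym (ℕₚ.*-distribʳ-+ 2 k r)))
              (trans (zig-even T H (k ℕ.+ r)) (trans (T-≋ (by (+ 1) (cong (λ z → + k + z) (sym (ℤₚ.*-identityˡ (+ r)))))) (sym (zig-even T H k))))
      ... | inj₂ (k , refl) = trans (cong (v ∘ suc) (sym (ℕₚ.*-distribʳ-+ 2 k r)))
              (trans (zig-odd T H (k ℕ.+ r)) (trans (H-≋ (by (+ 1) (cong (λ z → + k + z) (sym (ℤₚ.*-identityˡ (+ r)))))) (sym (zig-odd T H k))))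

      dist : ∀ i j → i < r ℕ.* 2 → j < r ℕ.* 2 → v i ≡ v j → i ≡ j
      dist i j i< j< e with parity i | parity j
      ... | inj₁ (k , refl) | inj₁ (l , refl) = cong (ℕ._* 2) (≋-small (halve i<) (halve j<)
              (T-inj (+ k) (+ l) (trans (sym (zig-even T H k)) (trans e (zig-even T H l)))))
      ... | inj₁ (k , refl) | inj₂ (l , refl) = ⊥-elim (disj (+ k) (+ l) (trans (sym (zig-even T H k)) (trans e (zig-odd T H l))))
      ... | inj₂ (k , refl) | inj₁ (l , refl) = ⊥-elim (disj (+ l) (+ k) (trans (sym (zig-even T H l)) (trans (sym e) (zig-odd T H k))))
      ... | inj₂ (k , refl) | inj₂ (l , refl) = cong (λ z → suc (z ℕ.* 2)) (≋-small (halve (ℕₚ.<-trans (ℕₚ.n<1+n _) i<)) (halve (ℕₚ.<-trans (ℕₚ.n<1+n _) j<))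
              (H-inj (+ k) (+ l) (trans (sym (zig-odd T H k)) (trans e (zig-odd T H l)))))

      edge : ∀ i → _~_ Γ (v i) (v (suc i))
      edge i with parity i
      ... | inj₁ (k , refl) = subst₂ (_~_ Γ) (sym (zig-even T H k)) (sym (zig-odd T H k)) (O⇒∼ (fwd (+ k)))
      ... | inj₂ (k , refl) = subst₂ (_~_ Γ) (sym (zig-odd T H k)) (sym (zig-even T H (suc k))) (∼-sym (O⇒∼ (bwd (+ k))))

    zigzag : Cycle Γ (r ℕ.* 2)
    zigzag = record
      { len≥3 = ℕₚ.≤-trans 3≤r (ℕₚ.m≤m*n r 2) ; vtx = v ; periodic = per ; distinct = dist ; edges = edge }

    zigzag-alternating : Alternating Γ O zigzag
    zigzag-alternating i with parity i
    ... | inj₁ (k , refl) = mk⇔ (λ _ → subst₂ O (sym (zig-even T H (suc k))) (sym (zig-odd T H k)) (bwd (+ k)))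
                                (λ _ → subst₂ O (sym (zig-even T H k)) (sym (zig-odd T H k)) (fwd (+ k)))
    ... | inj₂ (k , refl) = mk⇔ (λ o → ⊥-elim (O-antisym (bwd (+ k)) (subst₂ O (zig-odd T H k) (zig-even T H (suc k)) o)))
                                (λ o → ⊥-elim (O-antisym (fwd (+ suc k)) (subst₂ O (zig-odd T H (suc k)) (zig-even T H (suc k)) o)))

    OnZ : V Γ → Set
    OnZ x = (∃ λ k → x ≡ T k) ⊎ (∃ λ k → x ≡ H k)

    onZigzag⁻ : ∀ {x} → OnCycle Γ zigzag x → OnZ x
    onZigzag⁻ (i , refl) with parity i
    ... | inj₁ (k , refl) = inj₁ (+ k , zig-even T H k)
    ... | inj₂ (k , refl) = inj₂ (+ k , zig-odd T H k)

    private 0<r = ℕₚ.≤-trans (s≤s z≤n) 3≤r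

    onZigzag⁺ : ∀ {x} → OnZ x → OnCycle Γ zigzag x
    onZigzag⁺ (inj₁ (k , refl)) with ≋-residue 0<r k
    ... | c , h = toℕ c ℕ.* 2 , trans (zig-even T H (toℕ c)) (T-≋ (≋-sym h))
    onZigzag⁺ (inj₂ (k , refl)) with ≋-residue 0<r k
    ... | c , h = suc (toℕ c ℕ.* 2) , trans (zig-odd T H (toℕ c)) (H-≋ (≋-sym h))

    zigzag-edge : ∀ {x y} → EdgeOf Γ zigzag x y → ∃₂ λ k l → O (T k) (H l) × ((x ≡ T k × y ≡ H l) ⊎ (x ≡ H l × y ≡ T k))
    zigzag-edge (i , e) with parity i
    zigzag-edge (_ , inj₁ (refl , refl)) | inj₁ (k , refl) = + k , + k , fwd (+ k) , inj₁ (zig-even T H k , zig-odd T H k)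
    zigzag-edge (_ , inj₂ (refl , refl)) | inj₁ (k , refl) = + k , + k , fwd (+ k) , inj₂ (zig-odd T H k , zig-even T H k)
    zigzag-edge (_ , inj₁ (refl , refl)) | inj₂ (k , refl) = + suc k , + k , bwd (+ k) , inj₂ (zig-odd T H k , zig-even T H (suc k))
    zigzag-edge (_ , inj₂ (refl , refl)) | inj₂ (k , refl) = + suc k , + k , bwd (+ k) , inj₁ (zig-even T H (suc k) , zig-odd T H k)

  -- Tight attachment: the heads of one cycle are the tails of the next

  module Keep (tight : TightlyAttached Γ G)
    {r : ℕ} (3≤r : 3 ≤ r) {T H : ℤ → V Γ} (closed : ClosedTrail r T H)
    (ρ : Permutation′ (Graph.n Γ)) (mρ : mem G ρ)
    (ρT : ∀ k → ρ ⟨$⟩ʳ T k ≡ T (+ 1 + k)) (ρH : ∀ k → ρ ⟨$⟩ʳ H k ≡ H (+ 1 + k))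
    (g : Permutation′ (Graph.n Γ)) (mg : mem G g) (gT₀ : g ⟨$⟩ʳ T (+ 0) ≡ H (+ 0)) where

    open ClosedTrail closed

    private
      0<r : 0 < r
      0<r = ℕₚ.≤-trans (s≤s z≤n) 3≤r

      2≢0 : ¬ Cong r (+ 2) (+ 0)
      2≢0 = 3≤⇒2≢0 3≤r

    T' H' : ℤ → V Γ
    T' k = g ⟨$⟩ʳ T k
    H' k = g ⟨$⟩ʳ H k

    closed' : ClosedTrail r T' H'
    closed' = act-closed closed g mg

    private module C' = ClosedTrail closed'

    -- A common tail would identify the two trails up to shift or reversal, and then `H 0` = `T' 0`
    -- would be a tail of the first.
    T≢T' : ∀ k l → T k ≢ T' l
    T≢T' k l e with sync-at trail C'.trail k l e
    ... | inj₁ s = disj (k + - l) (+ 0) (trans (proj₁ (s (- l))) (trans (cong T' (ℤₚ.+-inverseʳ l)) gT₀))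
    ... | inj₂ s = disj (k + l) (+ 0) (trans (proj₁ (s l)) (trans (cong T' (ℤₚ.+-inverseʳ l)) gT₀))

    H≢H' : ∀ k l → H k ≢ H' l
    H≢H' k l e = [ (λ f → T≢T' k l (sym f)) , (λ f → T≢T' (+ 1 + k) l (sym f)) ]′
      (inOf trail k (subst (O (T' l)) (sym e) (C'.fwd l)))

    keepT : ∀ h → mem G h → ∀ {l l'} → h ⟨$⟩ʳ T' l ≡ T' l' →
      (∀ k → ∃ λ k' → h ⟨$⟩ʳ T' k ≡ T' k') × (∀ k → ∃ λ k' → h ⟨$⟩ʳ H' k ≡ H' k')
    keepT h mh {l} {l'} e with sync-at (act C'.trail h mh) C'.trail l l' e
    ... | inj₁ s = (λ k → _ , trans (cong (λ i → h ⟨$⟩ʳ T' i) (lem k l)) (proj₁ (s (k - l)))) ,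
                   (λ k → _ , trans (cong (λ i → h ⟨$⟩ʳ H' i) (lem k l)) (proj₂ (s (k - l))))
      where lem : ∀ k l → k ≡ l + (k - l)
            lem = solve-∀
    ... | inj₂ s = (λ k → _ , trans (cong (λ i → h ⟨$⟩ʳ T' i) (lem k l)) (proj₁ (s (k - l)))) ,
                   (λ k → _ , trans (cong (λ i → h ⟨$⟩ʳ H' i) (lem k l)) (proj₂ (s (k - l))))
      where lem : ∀ k l → k ≡ l + (k - l)
            lem = solve-∀

    -- This is all that tight attachment has to deliver: `H 0` is a tail of the image trail by the
    -- choice of `g`, and once `H 1` is one too, the rotation carries this on to all heads.
    Keep : Set
    Keep = ∃ λ s → H (+ 1) ≡ T' s

    keepTT : ∀ {l l'} → ρ ⟨$⟩ʳ T' l ≡ T' l' → Keep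
    keepTT e with proj₁ (keepT ρ mρ e) (+ 0)
    ... | s , f = s , trans (sym (ρH (+ 0))) (trans (cong (ρ ⟨$⟩ʳ_) (sym gT₀)) f)

    keepHH : ∀ {l l'} → ρ ⟨$⟩ʳ H' l ≡ H' l' → Keep
    keepHH {l} {l'} e = [ keepTT , keepTT ]′ (inOf C'.trail l' (subst (O _) e (O-act ρ mρ (C'.fwd l))))

    module _ (¬keep : ¬ Keep) where

      private
        C = zigzag closed 3≤r
        D = zigzag closed' 3≤r

        ¬same : ¬ SameCycle Γ C D
        ¬same same with zigzag-edge closed 3≤r (Equivalence.from (same (H (+ 0)) (g ⟨$⟩ʳ H (+ 0))) (0 , inj₁ (gT₀ , refl)))
        ... | k , l , o , inj₁ (e , _) = disj k (+ 0) (sym e)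
        ... | k , l , o , inj₂ (e , f) = O-antisym o (subst₂ O e f (subst (λ v → O v (g ⟨$⟩ʳ H (+ 0))) gT₀ (O-act g mg (fwd (+ 0)))))

        shared : Σ (Sub.Subset (Graph.n Γ)) λ S → (∀ v → (v Sub.∈ S) ⇔ (OnCycle Γ C v × OnCycle Γ D v)) × 2 ℕ.* Sub.∣ S ∣ ≡ r ℕ.* 2
        shared = tight a b a~b C D (zigzag-alternating closed 3≤r) (zigzag-alternating closed' 3≤r) ¬same
          (H (+ 0) , (1 , refl) , (0 , gT₀))

        S = proj₁ shared

        ∣S∣≡r : Sub.∣ S ∣ ≡ r
        ∣S∣≡r = ℕₚ.*-cancelˡ-≡ Sub.∣ S ∣ r 2 (trans (proj₂ (proj₂ shared)) (ℕₚ.*-comm r 2))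

        onC : ∀ {v} → v ∈ elements S → OnZ closed 3≤r v
        onC v∈ = onZigzag⁻ closed 3≤r (proj₁ (Equivalence.to (proj₁ (proj₂ shared) _) (∈-elements⁻ S v∈)))

        onD : ∀ {v} → v ∈ elements S → OnZ closed' 3≤r v
        onD v∈ = onZigzag⁻ closed' 3≤r (proj₂ (Equivalence.to (proj₁ (proj₂ shared) _) (∈-elements⁻ S v∈)))

        onS : ∀ {v} → OnZ closed 3≤r v → OnZ closed' 3≤r v → v ∈ elements S
        onS c d = ∈-elements⁺ S (Equivalence.from (proj₁ (proj₂ shared) _) (onZigzag⁺ closed 3≤r c , onZigzag⁺ closed' 3≤r d))

        -- A shared vertex is a tail of one cycle and a head of the other. Rotation keeps its role
        -- on the first cycle, hence also that on the second; so `ρ` would map the image trail to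
        -- itself, which is `Keep`.
        apart : ∀ {v} → v ∈ elements S → ρ ⟨$⟩ʳ v ∈ elements S → ⊥
        apart v∈ ρv∈ with onC v∈ | onD v∈ | onD ρv∈
        ... | _ | inj₁ (l , e) | inj₁ (l' , e') = ¬keep (keepTT (trans (cong (ρ ⟨$⟩ʳ_) (sym e)) e'))
        ... | _ | inj₂ (l , e) | inj₂ (l' , e') = ¬keep (keepHH (trans (cong (ρ ⟨$⟩ʳ_) (sym e)) e'))
        ... | inj₁ (k , f) | inj₁ (l , e) | inj₂ _ = T≢T' k l (trans (sym f) e)
        ... | inj₂ (k , f) | inj₁ _ | inj₂ (l , e) = H≢H' (+ 1 + k) l (trans (sym (ρH k)) (trans (cong (ρ ⟨$⟩ʳ_) (sym f)) e))
        ... | inj₁ (k , f) | inj₂ _ | inj₁ (l , e) = T≢T' (+ 1 + k) l (trans (sym (ρT k)) (trans (cong (ρ ⟨$⟩ʳ_) (sym f)) e))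
        ... | inj₂ (k , f) | inj₂ (l , e) | inj₁ _ = H≢H' k l (trans (sym f) e)

        Ts Hs Cs : List (V Γ)
        Ts = map (λ (k : Fin r) → T (+ toℕ k)) (List.allFin r)
        Hs = map (λ (k : Fin r) → H (+ toℕ k)) (List.allFin r)
        Cs = Ts ++ Hs

        ∈Cs : ∀ {v} → OnZ closed 3≤r v → v ∈ Cs
        ∈Cs (inj₁ (k , refl)) with ≋-residue 0<r k
        ... | c , h = ∈ₚ.∈-++⁺ˡ {xs = Ts} (subst (_∈ Ts) (T-≋ (≋-sym h)) (∈ₚ.∈-map⁺ (λ (k : Fin r) → T (+ toℕ k)) (∈ₚ.∈-allFin c)))
        ∈Cs (inj₂ (k , refl)) with ≋-residue 0<r k
        ... | c , h = ∈ₚ.∈-++⁺ʳ Ts (subst (_∈ Hs) (H-≋ (≋-sym h)) (∈ₚ.∈-map⁺ (λ (k : Fin r) → H (+ toℕ k)) (∈ₚ.∈-allFin c)))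

        ρS : List (V Γ)
        ρS = map (ρ ⟨$⟩ʳ_) (elements S)

        -- `S` and its rotate are disjoint subsets of size `r` in a cycle with 2 r vertices.
        covered : ∀ {v} → OnZ closed 3≤r v → v ∈ elements S ++ ρS
        covered c = unique-covers Fin._≟_
          (Uniqueₚ.++⁺ (elements-unique S) (Uniqueₚ.map⁺ (perm-injective ρ) (elements-unique S))
            (λ { (v∈ , w∈) → [apart] v∈ (∈ₚ.∈-map⁻ (ρ ⟨$⟩ʳ_) w∈) }))
          sub (ℕₚ.≤-reflexive lengths) (∈Cs c)
          where
          [apart] : ∀ {v} → v ∈ elements S → (∃ λ w → w ∈ elements S × v ≡ ρ ⟨$⟩ʳ w) → ⊥
          [apart] v∈ (w , w∈ , refl) = apart w∈ v∈
          rot : ∀ {v} → OnZ closed 3≤r v → OnZ closed 3≤r (ρ ⟨$⟩ʳ v)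
          rot (inj₁ (k , refl)) = inj₁ (_ , ρT k)
          rot (inj₂ (k , refl)) = inj₂ (_ , ρH k)
          sub : ∀ {v} → v ∈ elements S ++ ρS → v ∈ Cs
          sub v∈ = [ ∈Cs ∘ onC , (λ p → rotated (∈ₚ.∈-map⁻ (ρ ⟨$⟩ʳ_) p)) ]′ (∈ₚ.∈-++⁻ (elements S) v∈)
            where
            rotated : ∀ {v} → (∃ λ w → w ∈ elements S × v ≡ ρ ⟨$⟩ʳ w) → v ∈ Cs
            rotated (w , w∈ , refl) = ∈Cs (rot (onC w∈))
          lenS = trans (length-elements S) ∣S∣≡r
          lengths : length Cs ≡ length (elements S ++ ρS)
          lengths = trans (trans (Listₚ.length-++ Ts)
            (cong₂ ℕ._+_ (trans (Listₚ.length-map _ (List.allFin r)) (Listₚ.length-tabulate {n = r} (λ k → k))) (trans (Listₚ.length-map _ (List.allFin r)) (Listₚ.length-tabulate {n = r} (λ k → k)))))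
            (sym (trans (Listₚ.length-++ (elements S)) (cong₂ ℕ._+_ lenS (trans (Listₚ.length-map _ (elements S)) lenS))))

        split-T : ∀ k → T (+ 1 + k) ∈ elements S ⊎ T k ∈ elements S
        split-T k with ∈ₚ.∈-++⁻ (elements S) (covered (inj₁ (+ 1 + k , refl)))
        ... | inj₁ p = inj₁ p
        ... | inj₂ p with ∈ₚ.∈-map⁻ (ρ ⟨$⟩ʳ_) p
        ... | w , w∈ , e = inj₂ (subst (_∈ elements S) (perm-injective ρ (trans (sym e) (sym (ρT k)))) w∈)

        T∈⇒ : ∀ {k} → T k ∈ elements S → ∃ λ l → T k ≡ H' l
        T∈⇒ {k} p with onD p
        ... | inj₁ (l , e) = ⊥-elim (T≢T' k l e)
        ... | inj₂ q = q

        ¬consecutive : ∀ k → T k ∈ elements S → T (+ 1 + k) ∈ elements S → ⊥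
        ¬consecutive k p q = apart p (subst (_∈ elements S) (sym (ρT k)) q)

        -- A reflection of the trail: it fixes `H 0` and exchanges the two tails next to it.
        σ₀ : ∃ λ σ → mem G σ × (σ ⟨$⟩ʳ T (+ 0) ≡ T (+ 1)) × (σ ⟨$⟩ʳ H (+ 0) ≡ H (+ 0))
        σ₀ = O-transitive (fwd (+ 0)) (bwd (+ 0))

        σ = proj₁ σ₀
        mσ = proj₁ (proj₂ σ₀)

        σ-T : ∀ k → σ ⟨$⟩ʳ T k ≡ T (+ 1 - k)
        σ-T k = proj₁ (sync (act trail σ mσ) (reverse trail (+ 1)) (proj₁ (proj₂ (proj₂ σ₀))) (proj₂ (proj₂ (proj₂ σ₀))) k)

        -- Fixing `H 0` = `T' 0`, the reflection maps the image trail to itself as well, so it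
        -- preserves the set of shared vertices.
        σ-S : ∀ {k} → T k ∈ elements S → T (+ 1 - k) ∈ elements S
        σ-S {k} p with T∈⇒ p
        ... | l , e with proj₂ (keepT σ mσ {+ 0} {+ 0} (trans (cong (σ ⟨$⟩ʳ_) gT₀) (trans (proj₂ (proj₂ (proj₂ σ₀))) (sym gT₀)))) l
        ... | l' , f = onS (inj₁ (_ , refl)) (inj₂ (l' , trans (sym (σ-T k)) (trans (cong (σ ⟨$⟩ʳ_) e) f)))

      -- Otherwise the shared vertices and their rotates partition the trail, whereas the reflection
      -- at b exchanges the consecutive vertices T 0, T 1 as well as T -1, T 2.
      keep-stable : ⊥
      keep-stable with split-T -[1+ 0 ]
      ... | inj₁ p = ¬consecutive (+ 0) p (σ-S p)
      ... | inj₂ p with split-T (+ 0)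
      ... | inj₂ p₀ = ¬consecutive (+ 0) p₀ (σ-S p₀)
      ... | inj₁ p₁ = ¬consecutive (+ 1) p₁ (σ-S p)

    opaque
      -- Only the residue of `s` modulo `r` matters, so `Keep` is decidable and refuting its
      -- negation suffices.
      keep : Keep
      keep with Finₚ.any? (λ (s : Fin r) → H (+ 1) Fin.≟ T' (+ toℕ s))
      ... | yes (s , e) = + toℕ s , e
      ... | no ¬e = ⊥-elim (keep-stable λ { (s , e) → ¬e (proj₁ (≋-residue 0<r s) , trans e (C'.T-≋ (proj₂ (≋-residue 0<r s)))) })

    private
      s : ℤ
      s = proj₁ keep

      opaque
        ρT' : ∀ k → ρ ⟨$⟩ʳ T' k ≡ T' (s + k)
        ρT' with sync-at (act C'.trail ρ mρ) C'.trail (+ 0) s (trans (cong (ρ ⟨$⟩ʳ_) gT₀) (trans (ρH (+ 0)) (proj₂ keep)))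
        ... | inj₁ f = λ k → trans (cong (λ i → ρ ⟨$⟩ʳ T' i) (sym (ℤₚ.+-identityˡ k))) (proj₁ (f k))
        -- If `ρ` reversed the image trail, it would send `H 1` = `T' s` back to `T' 0` = `H 0`; but
        -- it sends `H 1` to `H 2`.
        ... | inj₂ f = ⊥-elim (2≢0 (H-inj (+ 2) (+ 0) (trans (sym (ρH (+ 1))) (trans (cong (ρ ⟨$⟩ʳ_) (proj₂ keep))
                (trans (cong (λ i → ρ ⟨$⟩ʳ T' i) (sym (ℤₚ.+-identityˡ s))) (trans (proj₁ (f s)) (trans (cong T' (ℤₚ.+-inverseʳ s)) gT₀)))))))

      H≡T' : ∀ k → H k ≡ T' (k * s)
      H≡T' = ℤ-ind (λ k → H k ≡ T' (k * s)) (sym gT₀)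
        (λ k e → trans (sym (ρH k)) (trans (cong (ρ ⟨$⟩ʳ_) e) (trans (ρT' (k * s)) (cong T' (lem k s)))))
        (λ k e → perm-injective ρ (trans (ρH k) (trans e (trans (cong T' (sym (lem k s))) (sym (ρT' (k * s)))))))
        where lem : ∀ k s → s + k * s ≡ (+ 1 + k) * s
              lem = solve-∀

      opaque
        inverse : ∃ λ q → Cong r (q * s) (+ 1)
        inverse = injective⇒unit (ℕₚ.≤-trans (s≤s (s≤s z≤n)) 3≤r) s
          (λ k l h → H-inj k l (trans (H≡T' k) (trans (C'.T-≋ h) (sym (H≡T' l)))))

    -- The rotation moves the heads by 1, but by `s` when they are counted as tails of the next
    -- cycle; so H k = T' (k s). Since distinct heads stay distinct, `s` is a unit, and `q` is its
    -- inverse.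
    multiplier : ∃₂ λ q q⁻¹ → Cong r (q * q⁻¹) (+ 1) × (∀ k → g ⟨$⟩ʳ T k ≡ H (q * k))
    multiplier = proj₁ inverse , s , proj₂ inverse ,
        λ k → sym (trans (H≡T' (proj₁ inverse * k)) (C'.T-≋ (lin₁ k (proj₂ inverse) (lem (proj₁ inverse) k s))))
      where lem : ∀ q k s → q * k * s - k ≡ k * (q * s - + 1)
            lem = solve-∀

  -- The rotation of an alternating cycle

  module Rotation where

    o₀ : O a b
    o₀ with S.hasId
    ... | e , me , ide = e , me , ide a , ide b

    private
      -- The trail runs a → b ← z → y, with the other in-neighbour `z` of `b` and the other
      -- out-neighbour y of `z`; `ρ` maps the arc from `a` to `b` to the arc from `z` to y.
      z₀ = Two-other (ins b) o₀
      z = proj₁ z₀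
      y₀ = Two-other (outs z) (proj₂ (proj₂ z₀))
      ρ₀ = O-transitive o₀ (proj₂ (proj₂ y₀))

    -- The automorphism rotating by one step the alternating trail through the arc (a , b).
    ρ : Permutation′ (Graph.n Γ)
    ρ = proj₁ ρ₀

    mρ : mem G ρ
    mρ = proj₁ (proj₂ ρ₀)

    ρa≡z : ρ ⟨$⟩ʳ a ≡ z
    ρa≡z = proj₁ (proj₂ (proj₂ ρ₀))

    T H : ℤ → V Γ
    T k = pow ρ k a
    H k = pow ρ k b

    pow-comm : ∀ k x → pow ρ (+ 1 + k) x ≡ pow ρ k (ρ ⟨$⟩ʳ x)
    pow-comm k x = trans (cong (λ i → pow ρ i x) (ℤₚ.+-comm (+ 1) k)) (pow-+ ρ k (+ 1) x)

    trail : Trail T H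
    trail = record
      { fwd = λ k → O-pow ρ mρ k o₀
      ; bwd = λ k → subst (λ v → O v (H k)) (sym (trans (pow-comm k a) (cong (pow ρ k) ρa≡z)))
                      (O-pow ρ mρ k (proj₂ (proj₂ z₀)))
      ; T≢ = λ k e → proj₁ (proj₂ z₀) (pow-injective ρ k (trans (cong (pow ρ k) (sym ρa≡z)) (trans (sym (pow-comm k a)) e)))
      ; H≢ = λ k e → proj₁ (proj₂ y₀) (pow-injective ρ k (trans (cong (pow ρ k) (sym (proj₂ (proj₂ (proj₂ ρ₀))))) (trans (sym (pow-comm k b)) e))) }

    open Trail trail

    r : ℕ
    r = proj₁ (period ρ a)

    T-≋ : ∀ {k l} → Cong r k l → T k ≡ T l
    T-≋ = pow-≋ ρ r a (proj₁ (proj₂ (proj₂ (period ρ a))))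

    T-inj : ∀ k l → T k ≡ T l → Cong r k l
    T-inj = proj₂ (proj₂ (proj₂ (period ρ a)))

    -- Radius 1 or 2 would give a loop or a 4-cycle.
    opaque
      3≤r : 3 ≤ r
      3≤r with r in er | proj₁ (proj₂ (period ρ a)) | proj₁ (proj₂ (proj₂ (period ρ a)))
      ... | 1 | _ | e = ⊥-elim (T≢ (+ 0) e)
      ... | 2 | _ | e = ⊥-elim (H≢ (+ 0) (sym (noSquare (T≢ (+ 0) ∘ sym) (O⇒∼ (fwd (+ 0))) (O⇒∼ (bwd (+ 0)))
              (subst (λ v → _~_ Γ v (H (+ 1))) e (O⇒∼ (bwd (+ 1)))) (O⇒∼ (fwd (+ 1))))))
      ... | suc (suc (suc _)) | _ | _ = s≤s (s≤s (s≤s z≤n))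

    2≢0 : ¬ Cong r (+ 2) (+ 0)
    2≢0 = 3≤⇒2≢0 3≤r

    -- `H r` is one of the two out-neighbours of `T r` = `T 0`. If it were the wrong one, `H (-1)`,
    -- then T (1 + r) = T 1 would be T 0 or T (-1), which `T≢` and `2≢0` exclude.
    H-period : H (+ r) ≡ H (+ 0)
    H-period with outOf trail -[1+ 0 ] (subst (λ v → O v (H (+ r))) (T-≋ (r≋0)) (fwd (+ r)))
    ... | inj₂ e = e
    ... | inj₁ e with inOf trail -[1+ 0 ] (subst (O _) e (bwd (+ r)))
    ... | inj₂ f = ⊥-elim (T≢ (+ 0) (trans (T-≋ (≋-trans (+-≋ {x = + 1} ≋-refl (≋-sym r≋0)) ≋-refl)) f))
    ... | inj₁ f = ⊥-elim (2≢0 (+-≋ {x' = + 1} {y' = + 1} (≋-trans (≋-trans (+-≋ {x = + 1} ≋-refl (≋-sym r≋0)) ≋-refl) (T-inj (+ 1 + + r) -[1+ 0 ] f)) ≋-refl))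

    H-≋ : ∀ {k l} → Cong r k l → H k ≡ H l
    H-≋ = pow-≋ ρ r b H-period

    H-inj : ∀ k l → H k ≡ H l → Cong r k l
    H-inj k l e with inOf trail l (subst (O _) e (fwd k)) | inOf trail l (subst (O _) e (bwd k))
    ... | inj₁ f | _ = T-inj k l f
    ... | inj₂ f | inj₁ f' = ⊥-elim (2≢0 (lin₂ (- (+ 1)) (+ 1) (T-inj k (+ 1 + l) f) (T-inj (+ 1 + k) l f') (lem k l)))
      where lem : ∀ k l → + 2 - + 0 ≡ - (+ 1) * (k - (+ 1 + l)) + + 1 * ((+ 1 + k) - l)
            lem = solve-∀
    ... | inj₂ f | inj₂ f' = lin₁ (+ 1) (T-inj (+ 1 + k) (+ 1 + l) f') (lem k l)
      where lem : ∀ k l → k - l ≡ + 1 * ((+ 1 + k) - (+ 1 + l))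
            lem = solve-∀

    private
      reflect : ∃ λ τ → mem G τ × (τ ⟨$⟩ʳ a ≡ a) × (τ ⟨$⟩ʳ b ≡ H -[1+ 0 ])
      reflect = O-transitive o₀ (bwd -[1+ 0 ])

    τ : Permutation′ (Graph.n Γ)
    τ = proj₁ reflect

    mτ : mem G τ
    mτ = proj₁ (proj₂ reflect)

    τ-T : ∀ k → τ ⟨$⟩ʳ T k ≡ T (+ 0 - k)
    τ-T k = proj₁ (sync (act trail τ mτ) (reverse trail (+ 0)) (proj₁ (proj₂ (proj₂ reflect))) (proj₂ (proj₂ (proj₂ reflect))) k)

    -- If the trail met itself with H j = T (j + c), then reflecting at T 0 would show that
    -- T (- c) is an out-neighbour as well as an in-neighbour of T 0.
    disj : ∀ k l → T k ≢ H l
    disj k l e = O-antisym (subst (O (T (+ 0))) H₋₁ (bwd -[1+ 0 ])) (subst (O (T (+ 0 - c))) (trans (HT (+ 0 - c)) (cong T (lem₁ c))) (fwd (+ 0 - c)))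
      where
      c = k - l
      lem : ∀ j l → j ≡ (j - l) + l
      lem = solve-∀
      lem₂ : ∀ j k l → (j - l) + k ≡ j + (k - l)
      lem₂ = solve-∀
      lem₁ : ∀ c → (+ 0 - c) + c ≡ + 0
      lem₁ = solve-∀
      HT : ∀ j → H j ≡ T (j + c)
      HT j = trans (cong H (lem j l)) (trans (pow-+ ρ (j - l) l b) (trans (cong (pow ρ (j - l)) (sym e))
               (trans (sym (pow-+ ρ (j - l) k a)) (cong T (lem₂ j k l)))))
      H₋₁ : H -[1+ 0 ] ≡ T (+ 0 - c)
      H₋₁ = trans (sym (proj₂ (proj₂ (proj₂ reflect)))) (trans (cong (τ ⟨$⟩ʳ_) (trans (HT (+ 0)) (cong T (ℤₚ.+-identityˡ c)))) (τ-T c))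

    closed : ClosedTrail r T H
    closed = record { trail = trail ; T-≋ = T-≋ ; H-≋ = H-≋ ; T-inj = T-inj ; H-inj = H-inj ; disj = disj }

    private
      step : ∃ λ g → mem G g × (g ⟨$⟩ʳ a ≡ b) × (g ⟨$⟩ʳ b ≡ proj₁ (hasOut b))
      step = O-transitive o₀ (proj₂ (hasOut b))

    g : Permutation′ (Graph.n Γ)
    g = proj₁ step

    mg : mem G g
    mg = proj₁ (proj₂ step)

    ga≡b : g ⟨$⟩ʳ a ≡ b
    ga≡b = proj₁ (proj₂ (proj₂ step))

  Labelling : Set
  Labelling = ∃ λ m → ∃₂ λ r q → (m ≡ 3 ⊎ m ≡ 5) × 3 ≤ r × ¬ (2 ℕD.∣ r) × Cong r (q ^ m) (+ 1) × IsoXo Γ m r q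

  -- Closing up the layers after one turn

  module Wrapped
    (conn : Connected Γ)
    {r : ℕ} (3≤r : 3 ≤ r)
    (q q⁻¹ : ℤ) (q-unit : Cong r (q * q⁻¹) (+ 1))
    (g τ : Permutation′ (Graph.n Γ)) (mτ : mem G τ)
    (U : ℕ → ℤ → V Γ)
    (gU    : ∀ i k → g ⟨$⟩ʳ U i k ≡ U (suc i) (q * k))
    (U-≋   : ∀ i {k l} → Cong r k l → U i k ≡ U i l)
    (U-inj : ∀ i k l → U i k ≡ U i l → Cong r k l)
    (fw    : ∀ i k → O (U i k) (U (suc i) k))
    (bw    : ∀ i k → O (U i (k + q ^ i)) (U (suc i) k))
    (inU   : ∀ {v} i k → O v (U (suc i) k) → (v ≡ U i k) ⊎ (v ≡ U i (k + q ^ i)))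
    (outU  : ∀ {v} i k → O (U i k) v → (v ≡ U (suc i) k) ⊎ (v ≡ U (suc i) (k - q ^ i)))
    (τU₀   : ∀ k → τ ⟨$⟩ʳ U 0 k ≡ U 0 (+ 0 - k))
    (m' : ℕ) (t : ℤ) (wrap₀ : ∀ k → U (suc m') k ≡ U 0 (k + t))
    (strip : ∀ i {d k l} → U i k ≡ U (i ℕ.+ d) l → ∃ λ k → U d k ≡ U 0 (+ 0))
    (min   : ∀ l → l < m' → ¬ (∃ λ k → U (suc l) k ≡ U 0 (+ 0)))
    where

    m : ℕ
    m = suc m'

    -- One turn shifts layer 0 by `t`. As `g` multiplies positions by `q` from each layer to the
    -- next, the shift has become t q^i in layer i.
    wrap : ∀ i k → U (i ℕ.+ m) k ≡ U i (k + t * q ^ i)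
    wrap zero k = trans (wrap₀ k) (cong (λ z → U 0 (k + z)) (sym (ℤₚ.*-identityʳ t)))
    wrap (suc i) k = trans (U-≋ (suc (i ℕ.+ m)) (lin₁ (- k) q-unit (lem₁ q q⁻¹ k)))
      (trans (sym (gU (i ℕ.+ m) (q⁻¹ * k))) (trans (cong (g ⟨$⟩ʳ_) (wrap i (q⁻¹ * k)))
      (trans (gU i _) (U-≋ (suc i) (lin₁ k q-unit (lem₂ q q⁻¹ k t (q ^ i)))))))
      where
      lem₁ : ∀ q p k → k - q * (p * k) ≡ - k * (q * p - + 1)
      lem₁ = solve-∀
      lem₂ : ∀ q p k t x → q * (p * k + t * x) - (k + t * (q * x)) ≡ k * (q * p - + 1)
      lem₂ = solve-∀

    wraps : ∀ c i k → ∃ λ l → U (i ℕ.+ c ℕ.* m) k ≡ U i l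
    wraps zero    i k = k , cong (λ i → U i k) (ℕₚ.+-identityʳ i)
    wraps (suc c) i k = let (l , e) = wraps c i (k + t * q ^ (i ℕ.+ c ℕ.* m)) in
      l , trans (cong (λ i → U i k) lem) (trans (wrap (i ℕ.+ c ℕ.* m) k) e)
      where
      lem : i ℕ.+ (m ℕ.+ c ℕ.* m) ≡ (i ℕ.+ c ℕ.* m) ℕ.+ m
      lem = trans (cong (i ℕ.+_) (ℕₚ.+-comm m (c ℕ.* m))) (sym (ℕₚ.+-assoc i (c ℕ.* m) m))

    Returns : ℕ → Set
    Returns d = ∃ λ k → U d k ≡ U 0 (+ 0)

    -- Whole turns are removed by division with remainder; a nonzero remainder would be an earlier
    -- return than `m`.
    returns⇒≋ : ∀ d → Returns d → Cong m (+ d) (+ 0)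
    returns⇒≋ d (k , e) = subst (λ z → Cong m (+ z) (+ 0)) (sym (ℕM.m≡m%n+[m/n]*n d m))
      (residue (d ℕM.% m) (ℕM.m%n<n d m) (let (l , f) = wraps (d ℕM./ m) (d ℕM.% m) k in
        l , trans (sym f) (trans (cong (λ z → U z k) (sym (ℕM.m≡m%n+[m/n]*n d m))) e)))
      where
      residue : ∀ c → c < m → Returns c → Cong m (+ (c ℕ.+ (d ℕM./ m) ℕ.* m)) (+ 0)
      residue zero    _         _ = by (+ (d ℕM./ m)) (trans (ℤₚ.pos-* (d ℕM./ m) m) (sym (ℤₚ.+-identityˡ _)))
      residue (suc c) (s≤s c<m) h = ⊥-elim (min c c<m h)

    private
      layer-≤ : ∀ {i i' k l} → i ≤ i' → U i k ≡ U i' l → Cong m (+ i') (+ i)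
      layer-≤ {i} {i'} {k} {l} i≤i' e = lin₁ (+ 1)
        (returns⇒≋ (i' ℕ.∸ i) (strip i (trans e (cong (λ z → U z l) (sym (ℕₚ.m+[n∸m]≡n i≤i'))))))
        (trans (cong (_- (+ i)) (trans (cong +_ (sym (ℕₚ.m+[n∸m]≡n i≤i'))) (ℤₚ.pos-+ i (i' ℕ.∸ i)))) (lem (+ i) (+ (i' ℕ.∸ i))))
        where lem : ∀ x y → x + y - x ≡ + 1 * (y - + 0)
              lem = solve-∀

    layer-≋ : ∀ {i i' k l} → U i k ≡ U i' l → Cong m (+ i) (+ i')
    layer-≋ {i} {i'} e with ℕₚ.≤-total i i'
    ... | inj₁ h = ≋-sym (layer-≤ h e)
    ... | inj₂ h = layer-≤ h (sym e)

    pred : ∀ i k → ∃ λ l → U i k ≡ U (suc (i ℕ.+ m')) l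
    pred i k = k - t * q ^ i , sym (trans (cong (λ z → U z (k - t * q ^ i)) (sym (ℕₚ.+-suc i m')))
      (trans (wrap i _) (cong (U i) (lem k (t * q ^ i)))))
      where lem : ∀ k x → k - x + x ≡ k
            lem = solve-∀

    +suc : ∀ i → + suc i ≡ + i + + 1
    +suc i = ℤₚ.+-comm (+ 1) (+ i)

    neighbour : ∀ {i k v} → _~_ Γ (U i k) v → ∃₂ λ i' l → v ≡ U i' l × (Cong m (+ i') (+ i + + 1) ⊎ Cong m (+ i) (+ i' + + 1))
    neighbour {i} {k} {v} h = [ forth , back ]′ (O-total h)
      where
      forth : O (U i k) v → ∃₂ λ i' l → v ≡ U i' l × (Cong m (+ i') (+ i + + 1) ⊎ Cong m (+ i) (+ i' + + 1))
      forth o = [ (λ e → _ , _ , e , inj₁ (≡⇒≋ (+suc i))) , (λ e → _ , _ , e , inj₁ (≡⇒≋ (+suc i))) ]′ (outU i k o)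
      back : O v (U i k) → ∃₂ λ i' l → v ≡ U i' l × (Cong m (+ i') (+ i + + 1) ⊎ Cong m (+ i) (+ i' + + 1))
      back o = let (l , e) = pred i k
                   c = ≋-trans (layer-≋ e) (≡⇒≋ (+suc (i ℕ.+ m')))
        in [ (λ f → _ , _ , f , inj₂ c) , (λ f → _ , _ , f , inj₂ c) ]′ (inU (i ℕ.+ m') l (subst (O v) e o))

    opaque
      cover : ∀ v → ∃₂ λ i k → v ≡ U i k
      cover v = let (k , w , e , f , h) = conn (U 0 (+ 0)) v in subst (λ v → ∃₂ λ i k → v ≡ U i k) f (walk w e k h)
        where
        walk : (w : ℕ → V Γ) → w 0 ≡ U 0 (+ 0) → ∀ k → (∀ i → i < k → _~_ Γ (w i) (w (suc i))) → ∃₂ λ i l → w k ≡ U i l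
        walk w e zero    h = 0 , + 0 , e
        walk w e (suc k) h = let (i , l , f) = walk w e k (λ i i<k → h i (ℕₚ.m<n⇒m<1+n i<k))
                                 (i' , l' , f' , _) = neighbour {i} {l} (subst (λ z → _~_ Γ z (w (suc k))) f (h k (ℕₚ.n<1+n k)))
                             in i' , l' , f'

    lay : V Γ → ℕ
    lay v = proj₁ (cover v)

    lay-edge : ∀ {u v} → _~_ Γ u v → ∃ λ (e : Fin 2) → Cong m (+ lay v) (+ lay u + sgn e)
    lay-edge {u} {v} h = let (i , k , e) = cover u ; (i' , k' , e') = cover v
                             (j , l , f , c) = neighbour {i} {k} {v} (subst (λ z → _~_ Γ z v) e h)
                             d : Cong m (+ i') (+ j)
                             d = layer-≋ (trans (sym e') f)
      in [ (λ c → Fin.zero , ≋-trans d c) , (λ c → Fin.suc Fin.zero , ≋-trans d (lin₁ (- (+ 1)) c (lem (+ i) (+ j)))) ]′ c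
      where lem : ∀ i j → j - (i + - (+ 1)) ≡ - (+ 1) * (i - (j + + 1))
            lem = solve-∀

    -- Around a 5-cycle the layer changes five times by ± 1 and returns modulo `m`, so `m` divides a
    -- sum of five signs.
    m∈[1,3,5] : m ≡ 1 ⊎ m ≡ 3 ⊎ m ≡ 5
    m∈[1,3,5] =
      let C = proj₁ girth
          l = λ i → + lay (vtx C i)
          (e₀ , h₀) = lay-edge (edges C 0) ; (e₁ , h₁) = lay-edge (edges C 1) ; (e₂ , h₂) = lay-edge (edges C 2)
          (e₃ , h₃) = lay-edge (edges C 3) ; (e₄ , h₄) = lay-edge (edges C 4)
          h₅ : Cong m (l 0) (l 4 + sgn e₄)
          h₅ = subst (λ z → Cong m (+ lay z) (l 4 + sgn e₄)) (periodic C 0) h₄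
          s = sgn e₀ + sgn e₁ + sgn e₂ + sgn e₃ + sgn e₄
          s≋0 : Cong m s (+ 0)
          s≋0 = lin₃ (- (+ 1)) (- (+ 1)) (- (+ 1)) h₀ h₁
                  (lin₃ {x = l 3 + l 0} {y = l 2 + sgn e₂ + (l 3 + sgn e₃) + (l 4 + sgn e₄) - l 4} (+ 1) (+ 1) (+ 1) h₂ h₃ h₅ (lem₁ (l 0) (l 2) (l 3) (l 4) (sgn e₂) (sgn e₃) (sgn e₄)))
                  (lem₂ (l 0) (l 1) (l 2) (l 3) (l 4) (sgn e₀) (sgn e₁) (sgn e₂) (sgn e₃) (sgn e₄))
          ∣s = ≋⇒mod s≋0
      in divisor s (sum₅ e₀ e₁ e₂ e₃ e₄) (subst (m ℕD.∣_) (cong ℤ.∣_∣ (ℤₚ.+-identityʳ s)) ∣s)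
      where
      lem₁ : ∀ l₀ l₂ l₃ l₄ e₂ e₃ e₄ → l₃ + l₀ - (l₂ + e₂ + (l₃ + e₃) + (l₄ + e₄) - l₄) ≡
        + 1 * (l₃ - (l₂ + e₂)) + + 1 * (l₄ - (l₃ + e₃)) + + 1 * (l₀ - (l₄ + e₄))
      lem₁ = solve-∀
      lem₂ : ∀ l₀ l₁ l₂ l₃ l₄ e₀ e₁ e₂ e₃ e₄ → e₀ + e₁ + e₂ + e₃ + e₄ - + 0 ≡
        - (+ 1) * (l₁ - (l₀ + e₀)) + - (+ 1) * (l₂ - (l₁ + e₁)) + - (+ 1) * (l₃ + l₀ - (l₂ + e₂ + (l₃ + e₃) + (l₄ + e₄) - l₄))
      lem₂ = solve-∀
      divisor : ∀ s → ℤ.∣ s ∣ ≡ 1 ⊎ ℤ.∣ s ∣ ≡ 3 ⊎ ℤ.∣ s ∣ ≡ 5 → m ℕD.∣ ℤ.∣ s ∣ → m ≡ 1 ⊎ m ≡ 3 ⊎ m ≡ 5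
      divisor s (inj₁ e) d = inj₁ (ℕD.∣1⇒≡1 (subst (m ℕD.∣_) e d))
      divisor s (inj₂ (inj₁ e)) d = [ inj₁ , inj₂ ∘ inj₁ ]′ (∣prime prime-3 (subst (m ℕD.∣_) e d))
      divisor s (inj₂ (inj₂ e)) d = [ inj₁ , inj₂ ∘ inj₂ ]′ (∣prime prime-5 (subst (m ℕD.∣_) e d))

    -- The partial sums 1 + q + ... + q^(i-1), by which the centre of the reflection `τ` drifts from
    -- layer to layer.
    p : ℕ → ℤ
    p zero    = + 0
    p (suc i) = p i + q ^ i

    U-apart : ∀ i k → U i k ≢ U i (k + q ^ i)
    U-apart i k e = unit≢0 {u = q ^ i} {v = q⁻¹ ^ i} (ℕₚ.≤-trans (s≤s (s≤s z≤n)) 3≤r) (^-unit i q-unit) (lin₁ (- (+ 1)) (U-inj i k (k + q ^ i) e) (lem k (q ^ i)))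
      where lem : ∀ k x → x - + 0 ≡ - (+ 1) * (k - (k + x))
            lem = solve-∀

    -- `U (suc i) k` is the only common neighbour of `U i k` and `U i (k + q ^ i)`, so the action of
    -- `τ` on one layer determines that on the next.
    τU : ∀ i k → τ ⟨$⟩ʳ U i k ≡ U i (- k - p i)
    τU zero k = trans (τU₀ k) (cong (U 0) (lem k))
      where lem : ∀ k → + 0 - k ≡ - k - + 0
            lem = solve-∀
    τU (suc i) k = noSquare (U-apart i k ∘ perm-injective τ) (O⇒∼ (O-act τ mτ (fw i k))) (O⇒∼ (O-act τ mτ (bw i k)))
      (subst (λ v → _~_ Γ v (U (suc i) l)) (sym (trans (τU i k) (cong (U i) (lem₁ k (p i) (q ^ i))))) (O⇒∼ (bw i l)))
      (subst (λ v → _~_ Γ v (U (suc i) l)) (sym (trans (τU i (k + q ^ i)) (cong (U i) (lem₂ k (p i) (q ^ i))))) (O⇒∼ (fw i l)))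
      where
      l = - k - (p i + q ^ i)
      lem₁ : ∀ k p x → - k - p ≡ - k - (p + x) + x
      lem₁ = solve-∀
      lem₂ : ∀ k p x → - (k + x) - p ≡ - k - (p + x)
      lem₂ = solve-∀

    -- The reflected vertex of `U m 0` = `U 0 t` is computed in layer `m` and in layer 0.
    2t≋p : Cong r (+ 2 * t) (p m)
    2t≋p = lin₁ (+ 1) (U-inj 0 _ _ (trans (sym (wrap₀ (- (+ 0) - p m))) (trans (sym (τU m (+ 0)))
        (trans (cong (τ ⟨$⟩ʳ_) (wrap₀ (+ 0))) (τU₀ (+ 0 + t)))))) (lem t (p m))
      where lem : ∀ t p → + 2 * t - p ≡ + 1 * (- (+ 0) - p + t - (+ 0 - (+ 0 + t)))
            lem = solve-∀

    -- The out-neighbours of a vertex in layer i are q^i apart. In layer `m`, which is layer 0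
    -- again, the distance must agree with 1 up to sign and the common factor of the numbering.
    q^m : Cong r (q ^ m) (+ 1) ⊎ Cong r (q ^ m) (- (+ 1))
    q^m = [ same , swapped ]′ (image (+ 0) (fw m (+ 0)))
      where
      -- Compares the out-neighbours of U m 0 = U 0 t in both descriptions.
      image : ∀ k → O (U m (+ 0)) (U (suc m) k) → Cong r (k + t * q) t ⊎ Cong r (k + t * q) (t - + 1)
      image k o = Sum.map (get (+ 0 + t) (lem t)) (get (+ 0 + t - + 1) (cong (_- (+ 1)) (lem t)))
          (outU 0 (+ 0 + t) (subst (λ z → O z (U (suc m) k)) (wrap₀ (+ 0)) o))
        where
        lem : ∀ t → + 0 + t ≡ t
        lem = solve-∀
        lem₂ : ∀ k t q → k + t * q ≡ k + t * (q * + 1)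
        lem₂ = solve-∀
        get : ∀ l {l'} → l ≡ l' → U (suc m) k ≡ U 1 l → Cong r (k + t * q) l'
        get l refl e = U-inj 1 _ _ (trans (cong (U 1) (lem₂ k t q)) (trans (sym (wrap 1 k)) e))
      second : Cong r (- (q ^ m) + t * q) t ⊎ Cong r (- (q ^ m) + t * q) (t - + 1)
      second = image (- (q ^ m)) (subst (λ z → O (U m z) (U (suc m) (- (q ^ m)))) (ℤₚ.+-inverseˡ (q ^ m)) (bw m (- (q ^ m))))
      absurd : Cong r (q ^ m) (+ 0) → ⊥
      absurd = unit≢0 {u = q ^ m} {v = q⁻¹ ^ m} (ℕₚ.≤-trans (s≤s (s≤s z≤n)) 3≤r) (^-unit {u = q} {v = q⁻¹} m q-unit)
      l₀ : ∀ x t y → x - + 0 ≡ + 1 * (+ 0 + t - y) + - (+ 1) * (- x + t - y)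
      l₀ = solve-∀
      l₁ : ∀ x t q → x - + 1 ≡ + 1 * (+ 0 + t * q - t) + - (+ 1) * (- x + t * q - (t - + 1))
      l₁ = solve-∀
      l₂ : ∀ x t q → x - - (+ 1) ≡ + 1 * (+ 0 + t * q - (t - + 1)) + - (+ 1) * (- x + t * q - t)
      l₂ = solve-∀
      same : Cong r (+ 0 + t * q) t → Cong r (q ^ m) (+ 1) ⊎ Cong r (q ^ m) (- (+ 1))
      same h = [ (λ h' → ⊥-elim (absurd (lin₂ (+ 1) (- (+ 1)) h h' (l₀ (q ^ m) (t * q) t))))
               , (λ h' → inj₁ (lin₂ (+ 1) (- (+ 1)) h h' (l₁ (q ^ m) t q))) ]′ second
      swapped : Cong r (+ 0 + t * q) (t - + 1) → Cong r (q ^ m) (+ 1) ⊎ Cong r (q ^ m) (- (+ 1))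
      swapped h = [ (λ h' → inj₂ (lin₂ (+ 1) (- (+ 1)) h h' (l₂ (q ^ m) t q)))
                  , (λ h' → ⊥-elim (absurd (lin₂ (+ 1) (- (+ 1)) h h' (l₀ (q ^ m) (t * q) (t - + 1))))) ]′ second

    module _ (m-odd : m ≡ 3 ⊎ m ≡ 5) where

      -- In Z_r with r even, q would be odd and 2 t = 1 + q + ... + q^(m-1) a sum of an odd number of odd terms.
      r-odd : ¬ (2 ℕD.∣ r)
      r-odd 2∣r = go (≋-residue {2} (s≤s z≤n) q)
        where
        2∤m : ¬ (2 ℕD.∣ m)
        2∤m d = [ (λ e → Dec.from-no (2 ℕD.∣? 3) (subst (2 ℕD.∣_) e d)) , (λ e → Dec.from-no (2 ℕD.∣? 5) (subst (2 ℕD.∣_) e d)) ]′ m-odd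
        p-odd : Cong 2 q (+ 1) → ∀ i → Cong 2 (p i) (+ i)
        p-odd h zero    = ≋-refl
        p-odd h (suc i) = ≋-trans (+-≋ (p-odd h i) (≋-trans (^-≋ i h) (≡⇒≋ (ℤₚ.^-zeroˡ i)))) (≡⇒≋ (ℤₚ.+-comm (+ i) (+ 1)))
        go : (Σ (Fin 2) λ c → Cong 2 q (+ toℕ c)) → ⊥
        go (Fin.zero , h) with ≋-small {2} {0} {1} (s≤s z≤n) (s≤s (s≤s z≤n)) (lin₂ (+ 1) (- q⁻¹) (≋-∣ 2∣r q-unit) h (lem q q⁻¹))
          where lem : ∀ q p → + 0 - + 1 ≡ + 1 * (q * p - + 1) + - p * (q - + 0)
                lem = solve-∀
        ... | ()
        go (Fin.suc Fin.zero , h) = 2∤m (≋0⇒∣ (≋-trans (≋-sym (p-odd h m)) (≋-trans (≋-sym (≋-∣ 2∣r 2t≋p)) (by t (lem t)))))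
          where lem : ∀ t → + 2 * t ≡ + 0 + t * + 2
                lem = solve-∀

      module _ (h : ℤ) (2h≋1 : Cong r (+ 2 * h) (+ 1)) where

        -- In the coordinates of `U` the arcs lead from k to k and to k - q^i. With j = 2 k + p i
        -- they lead from j to j ± q^i; `h` = 1/2 inverts this substitution.
        W : ℕ → ℤ → V Γ
        W i j = U i (h * (j - p i))

        p-+ : ∀ i k → p (i ℕ.+ k) ≡ p i + q ^ i * p k
        p-+ i zero = trans (cong p (ℕₚ.+-identityʳ i)) (lem (p i) (q ^ i))
          where lem : ∀ x y → x ≡ x + y * + 0
                lem = solve-∀
        p-+ i (suc k) = trans (cong p (ℕₚ.+-suc i k)) (trans (cong₂ _+_ (p-+ i k) (ℤₚ.^-distribˡ-+-* q i k)) (lem (p i) (q ^ i) (p k) (q ^ k)))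
          where lem : ∀ x y z w → x + y * z + y * w ≡ x + y * (z + w)
                lem = solve-∀

        W-≋ : ∀ i {j j'} → Cong r j j' → W i j ≡ W i j'
        W-≋ i c = U-≋ i (*-≋ {x = h} ≋-refl (+-≋ c ≋-refl))

        -- Passing from layer i + m to layer i raises k by t q^i and lowers the partial sum by q^i p
        -- m = 2 t q^i, so that j = 2 k + p i does not change.
        W-period : ∀ i j → W (i ℕ.+ m) j ≡ W i j
        W-period i j = trans (wrap i _) (U-≋ i (lin₂ (h * q ^ i) (- (t * q ^ i)) 2t≋p 2h≋1
          (trans (cong (λ z → h * (j - z) + t * q ^ i - h * (j - p i)) (p-+ i m)) (lem h j (p i) (q ^ i) (p m) t))))
          where lem : ∀ h j p x P t → h * (j - (p + x * P)) + t * x - h * (j - p) ≡ h * x * (+ 2 * t - P) + - (t * x) * (+ 2 * h - + 1)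
                lem = solve-∀

        W-periods : ∀ c i j → W (i ℕ.+ c ℕ.* m) j ≡ W i j
        W-periods zero    i j = cong (λ i → W i j) (ℕₚ.+-identityʳ i)
        W-periods (suc c) i j = trans (cong (λ i → W i j) lem) (trans (W-period (i ℕ.+ c ℕ.* m) j) (W-periods c i j))
          where
          lem : i ℕ.+ (m ℕ.+ c ℕ.* m) ≡ (i ℕ.+ c ℕ.* m) ℕ.+ m
          lem = trans (cong (i ℕ.+_) (ℕₚ.+-comm m (c ℕ.* m))) (sym (ℕₚ.+-assoc i (c ℕ.* m) m))

        W-layer : ∀ {i i'} j → Cong m (+ i) (+ i') → W i j ≡ W i' j
        W-layer {i} {i'} j c = trans (reduce i) (trans (cong (λ i → W i j) eq) (sym (reduce i')))
          where
          reduce : ∀ i → W i j ≡ W (i ℕM.% m) j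
          reduce i = trans (cong (λ i → W i j) (ℕM.m≡m%n+[m/n]*n i m)) (W-periods (i ℕM./ m) (i ℕM.% m) j)
          eq : i ℕM.% m ≡ i' ℕM.% m
          eq = ≋-small (ℕM.m%n<n i m) (ℕM.m%n<n i' m) (≋-trans (≋-sym (%-≋ i m)) (≋-trans c (%-≋ i' m)))

        W-inj : ∀ {i i' j j'} → W i j ≡ W i' j' → Cong m (+ i) (+ i') × Cong r j j'
        W-inj {i} {i'} {j} {j'} e = c , lin₂ (- (j - j')) (+ 2) 2h≋1 (U-inj i _ _ (trans e (sym (W-layer j' c)))) (lem h j j' (p i))
          where
          c : Cong m (+ i) (+ i')
          c = layer-≋ e
          lem : ∀ h j j' p → j - j' ≡ - (j - j') * (+ 2 * h - + 1) + + 2 * (h * (j - p) - h * (j' - p))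
          lem = solve-∀

        W-arc⁺ : ∀ i {j j'} → Cong r j' (j + q ^ i) ⊎ Cong r j' (j - q ^ i) → O (W i j) (W (suc i) j')
        W-arc⁺ i {j} {j'} (inj₁ c) = subst (O (W i j)) (U-≋ (suc i) (lin₁ (- h) c (lem h j j' (p i) (q ^ i)))) (fw i _)
          where lem : ∀ h j j' p x → h * (j - p) - h * (j' - (p + x)) ≡ - h * (j' - (j + x))
                lem = solve-∀
        W-arc⁺ i {j} {j'} (inj₂ c) = subst (λ v → O v (W (suc i) j')) (U-≋ i (lin₂ h (- (q ^ i)) c 2h≋1 (lem h j j' (p i) (q ^ i)))) (bw i _)
          where lem : ∀ h j j' p x → h * (j' - (p + x)) + x - h * (j - p) ≡ h * (j' - (j - x)) + - x * (+ 2 * h - + 1)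
                lem = solve-∀

        W-arc⁻ : ∀ i {j v} → O (W i j) v → ∃ λ j' → v ≡ W (suc i) j' × (Cong r j' (j + q ^ i) ⊎ Cong r j' (j - q ^ i))
        W-arc⁻ i {j} {v} o = [ plus , minus ]′ (outU i (h * (j - p i)) o)
          where
          lem : ∀ h j p x → h * (j - p) ≡ h * (j + x - (p + x))
          lem = solve-∀
          lem₂ : ∀ h j p x → h * (j - p) - x - h * (j - x - (p + x)) ≡ x * (+ 2 * h - + 1)
          lem₂ = solve-∀
          plus : v ≡ U (suc i) (h * (j - p i)) → ∃ λ j' → v ≡ W (suc i) j' × (Cong r j' (j + q ^ i) ⊎ Cong r j' (j - q ^ i))
          plus e = j + q ^ i , trans e (cong (U (suc i)) (lem h j (p i) (q ^ i))) , inj₁ ≋-refl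
          minus : v ≡ U (suc i) (h * (j - p i) - q ^ i) → ∃ λ j' → v ≡ W (suc i) j' × (Cong r j' (j + q ^ i) ⊎ Cong r j' (j - q ^ i))
          minus e = j - q ^ i , trans e (U-≋ (suc i) (lin₁ (q ^ i) 2h≋1 (lem₂ h j (p i) (q ^ i)))) , inj₂ ≋-refl

        W-onto : ∀ v → ∃ λ i → i < m × ∃ λ j → W i j ≡ v
        W-onto v = let (i , k , e) = cover v in i ℕM.% m , ℕM.m%n<n i m , + 2 * k + p i ,
            trans (W-layer {i ℕM.% m} {i} (+ 2 * k + p i) (≋-sym (%-≋ i m))) (trans (U-≋ i (lin₁ k 2h≋1 (lem h k (p i)))) (sym e))
          where lem : ∀ h k p → h * (+ 2 * k + p - p) - k ≡ k * (+ 2 * h - + 1)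
                lem = solve-∀

        adj⁻ : ∀ {i i' j j'} → _~_ Γ (W i j) (W i' j') → Arc m r q i j i' j' ⊎ Arc m r q i' j' i j
        adj⁻ {i} {i'} {j} {j'} h = Sum.map (arc {i} {i'} {j} {j'}) (arc {i'} {i} {j'} {j}) (O-total h)
          where
          arc : ∀ {i i' j j'} → O (W i j) (W i' j') → Arc m r q i j i' j'
          arc {i} {i'} {j} {j'} o = let (j'' , e , c) = W-arc⁻ i {j} o ; (d , d') = W-inj {i'} {suc i} {j'} {j''} e in
            ≋-trans d (≡⇒≋ (+suc i)) , Sum.map (≋-trans d') (≋-trans d') c

        adj⁺ : ∀ {i i' j j'} → Arc m r q i j i' j' → _~_ Γ (W i j) (W i' j')
        adj⁺ {i} {i'} {j} {j'} (c , d) = subst (_~_ Γ (W i j)) (W-layer {suc i} {i'} j' (≋-sym (≋-trans c (≡⇒≋ (sym (+suc i)))))) (O⇒∼ (W-arc⁺ i {j} {j'} d))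

        iso : ∃ λ q' → Cong r (q' ^ m) (+ 1) × IsoXo Γ m r q'
        iso = [ pos , neg ]′ q^m
          where
          0<r : 0 < r
          0<r = ℕₚ.≤-trans (s≤s z≤n) 3≤r
          inj : ∀ {i i' j j'} → i < m → i' < m → W i j ≡ W i' j' → (i ≡ i') × Cong r j j'
          inj {i} {i'} {j} {j'} i<m i'<m e = let (c , d) = W-inj {i} {i'} {j} {j'} e in ≋-small i<m i'<m c , d
          neg-odd : ∀ {m} → m ≡ 3 ⊎ m ≡ 5 → (- q) ^ m ≡ - (q ^ m)
          neg-odd (inj₁ refl) = lem q
            where lem : ∀ q → - q * (- q * (- q * + 1)) ≡ - (q * (q * (q * + 1)))
                  lem = solve-∀
          neg-odd (inj₂ refl) = lem q
            where lem : ∀ q → - q * (- q * (- q * (- q * (- q * + 1)))) ≡ - (q * (q * (q * (q * (q * + 1)))))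
                  lem = solve-∀
          Result : Set
          Result = ∃ λ q' → Cong r (q' ^ m) (+ 1) × IsoXo Γ m r q'
          pos : Cong r (q ^ m) (+ 1) → Result
          pos c = q , c , mkIso Γ 0<r W W-≋ inj W-onto (λ {i} {i'} {j} {j'} _ _ → adj⁻ {i} {i'} {j} {j'}) (λ {i} {i'} {j} {j'} _ _ → adj⁺ {i} {i'} {j} {j'})
          -- As `m` is odd, (-q)^m = 1, and -q defines the same arcs as `q`.
          neg : Cong r (q ^ m) (- (+ 1)) → Result
          neg c = - q , ≋-trans (≡⇒≋ (neg-odd m-odd)) (neg-≋ c) , mkIso Γ 0<r W W-≋ inj W-onto
            (λ {i} {i'} {j} {j'} _ _ x → Sum.map (Arc-neg m r q i j i' j') (Arc-neg m r q i' j' i j) (adj⁻ {i} {i'} {j} {j'} x))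
            (λ {i} {i'} {j} {j'} _ _ x → adj⁺ {i} {i'} {j} {j'} (subst (λ q → Arc m r q i j i' j') (ℤₚ.neg-involutive q) (Arc-neg m r (- q) i j i' j' x)))

    labelling : m ≢ 1 → Labelling
    labelling m≢1 = let (q' , c , X) = iso m∈ (proj₁ (half odd)) (proj₂ (half odd)) in m , r , q' , m∈ , 3≤r , odd , c , X
      where
      m∈ : m ≡ 3 ⊎ m ≡ 5
      m∈ = [ (λ e → ⊥-elim (m≢1 e)) , (λ x → x) ]′ m∈[1,3,5]
      odd : ¬ (2 ℕD.∣ r)
      odd = r-odd m∈

  -- Layers numbered by the rotation

  module Layering
    {r : ℕ} (3≤r : 3 ≤ r) (ρ : Permutation′ (Graph.n Γ)) (mρ : mem G ρ)
    (closed : ClosedTrail r (λ k → pow ρ k a) (λ k → pow ρ k b))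
    (g : Permutation′ (Graph.n Γ)) (mg : mem G g) (ga≡b : g ⟨$⟩ʳ a ≡ b)
    (q q⁻¹ : ℤ) (q-unit : Cong r (q * q⁻¹) (+ 1))
    (gT≡H : ∀ k → g ⟨$⟩ʳ pow ρ k a ≡ pow ρ (q * k) b)
    (τ : Permutation′ (Graph.n Γ)) (mτ : mem G τ) (τ-T : ∀ k → τ ⟨$⟩ʳ pow ρ k a ≡ pow ρ (+ 0 - k) a)
    where

    0<r : 0 < r
    0<r = ℕₚ.≤-trans (s≤s z≤n) 3≤r

    q^≢0 : ∀ i → ¬ Cong r (q ^ i) (+ 0)
    q^≢0 i = unit≢0 (ℕₚ.≤-trans (s≤s (s≤s z≤n)) 3≤r) (^-unit i q-unit)

    2q^≢0 : ∀ i → ¬ Cong r (+ 2 * q ^ i) (+ 0)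
    2q^≢0 i h = 3≤⇒2≢0 3≤r (lin₂ (- (+ 2)) (q⁻¹ ^ i) (^-unit i q-unit) h (lem (q ^ i) (q⁻¹ ^ i)))
      where lem : ∀ u v → + 2 - + 0 ≡ - (+ 2) * (u * v - + 1) + v * (+ 2 * u - + 0)
            lem = solve-∀

    X : ℕ → V Γ
    X i = pow g (+ i) a

    -- Every layer is numbered by powers of the one rotation `ρ`, not by carrying a numbering along
    -- with `g`. One arc then leads from k to k in every layer, and the factor q^i appears only in
    -- the other.
    U : ℕ → ℤ → V Γ
    U i k = pow ρ k (X i)

    U-+ : ∀ i k l → pow ρ k (U i l) ≡ U i (k + l)
    U-+ i k l = sym (pow-+ ρ k l (X i))

    record Layer (i : ℕ) : Set where
      field
        gU    : ∀ k → g ⟨$⟩ʳ U i k ≡ U (suc i) (q * k)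
        U-≋   : ∀ {k l} → Cong r k l → U i k ≡ U i l
        U-inj : ∀ k l → U i k ≡ U i l → Cong r k l
        fw    : ∀ k → O (U i k) (U (suc i) k)
        bw    : ∀ k → O (U i (k + q ^ i)) (U (suc i) k)

      U-apart : ∀ k → U i k ≢ U i (k + q ^ i)
      U-apart k e = q^≢0 i (lin₁ (- (+ 1)) (U-inj k (k + q ^ i) e) (lem k (q ^ i)))
        where lem : ∀ k x → x - + 0 ≡ - (+ 1) * (k - (k + x))
              lem = solve-∀

    private
      module C = ClosedTrail closed

      layer₀ : Layer 0
      layer₀ = record
        { gU = λ k → trans (gT≡H k) (cong (pow ρ (q * k)) (sym ga≡b))
        ; U-≋ = C.T-≋ ; U-inj = C.T-inj
        ; fw = λ k → subst (λ v → O (U 0 k) (pow ρ k v)) (sym ga≡b) (C.fwd k)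
        ; bw = λ k → subst₂ (λ l v → O (U 0 l) (pow ρ k v)) (ℤₚ.+-comm (+ 1) k) (sym ga≡b) (C.bwd k) }

      -- `g` provides the arcs at one vertex and `ρ` spreads them over the layer. What `g` does on
      -- the new layer, and when its vertices agree, follows from `noSquare` applied to the two
      -- in-neighbours.
      layer₊ : ∀ i → Layer i → Layer (suc i)
      layer₊ i L = record { gU = gU' ; U-≋ = U-≋' ; U-inj = U-inj' ; fw = fw' ; bw = bw' }
        where
        open Layer L
        fw' : ∀ k → O (U (suc i) k) (U (suc (suc i)) k)
        fw' k = O-pow ρ mρ k (O-act g mg (fw (+ 0)))
        bw' : ∀ k → O (U (suc i) (k + q ^ suc i)) (U (suc (suc i)) k)
        bw' k = subst (λ v → O v (U (suc (suc i)) k))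
          (trans (cong (pow ρ k) (gU (+ 0 + q ^ i))) (trans (U-+ (suc i) k (q * (+ 0 + q ^ i))) (cong (U (suc i)) (lem k q (q ^ i)))))
          (O-pow ρ mρ k (O-act g mg (bw (+ 0))))
          where lem : ∀ k q x → k + q * (+ 0 + x) ≡ k + q * x
                lem = solve-∀
        gU' : ∀ k → g ⟨$⟩ʳ U (suc i) k ≡ U (suc (suc i)) (q * k)
        gU' k = noSquare (U-apart k ∘ perm-injective g) (O⇒∼ (O-act g mg (fw k))) (O⇒∼ (O-act g mg (bw k)))
          (subst (λ v → _~_ Γ v (U (suc (suc i)) (q * k))) (sym (gU k)) (O⇒∼ (fw' (q * k))))
          (subst (λ v → _~_ Γ v (U (suc (suc i)) (q * k))) (sym (trans (gU (k + q ^ i)) (cong (U (suc i)) (ℤₚ.*-distribˡ-+ q k (q ^ i))))) (O⇒∼ (bw' (q * k))))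
        U-≋' : ∀ {k l} → Cong r k l → U (suc i) k ≡ U (suc i) l
        U-≋' {k} {l} h = noSquare (U-apart k) (O⇒∼ (fw k)) (O⇒∼ (bw k))
          (subst (λ v → _~_ Γ v (U (suc i) l)) (sym (U-≋ h)) (O⇒∼ (fw l)))
          (subst (λ v → _~_ Γ v (U (suc i) l)) (sym (U-≋ (+-≋ h ≋-refl))) (O⇒∼ (bw l)))
        inOf' : ∀ {v} k → O v (U (suc i) k) → (v ≡ U i k) ⊎ (v ≡ U i (k + q ^ i))
        inOf' k = Two-only (ins _) (fw k) (bw k) (U-apart k)
        U-inj' : ∀ k l → U (suc i) k ≡ U (suc i) l → Cong r k l
        U-inj' k l e = [ U-inj k l , other ]′ (inOf' l (subst (O _) e (fw k)))
          where
          lem : ∀ k l x → + 2 * x - + 0 ≡ - (+ 1) * (k - (l + x)) + + 1 * ((k + x) - l)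
          lem = solve-∀
          lem₂ : ∀ k l x → k - l ≡ + 1 * ((k + x) - (l + x))
          lem₂ = solve-∀
          -- If the in-neighbours k, k + q^i and l, l + q^i were matched crosswise, then 2 q^i would
          -- vanish.
          other : U i k ≡ U i (l + q ^ i) → Cong r k l
          other e₁ = [ (λ e₂ → ⊥-elim (2q^≢0 i (lin₂ (- (+ 1)) (+ 1) (U-inj k (l + q ^ i) e₁) (U-inj (k + q ^ i) l e₂) (lem k l (q ^ i)))))
                     , (λ e₂ → lin₁ (+ 1) (U-inj (k + q ^ i) (l + q ^ i) e₂) (lem₂ k l (q ^ i))) ]′ (inOf' l (subst (O _) e (bw k)))

    opaque
      layer : ∀ i → Layer i
      layer zero    = layer₀
      layer (suc i) = layer₊ i (layer i)

    module L (i : ℕ) = Layer (layer i)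

    inU : ∀ {v} i k → O v (U (suc i) k) → (v ≡ U i k) ⊎ (v ≡ U i (k + q ^ i))
    inU i k = Two-only (ins _) (L.fw i k) (L.bw i k) (L.U-apart i k)

    outU : ∀ {v} i k → O (U i k) v → (v ≡ U (suc i) k) ⊎ (v ≡ U (suc i) (k - q ^ i))
    outU i k = Two-only (outs _) (L.fw i k)
      (subst (λ l → O (U i l) (U (suc i) (k - q ^ i))) (lem k (q ^ i)) (L.bw i (k - q ^ i)))
      (λ e → q^≢0 i (lin₁ (+ 1) (L.U-inj (suc i) k (k - q ^ i) e) (lem₂ k (q ^ i))))
      where lem : ∀ k x → k - x + x ≡ k
            lem = solve-∀
            lem₂ : ∀ k x → x - + 0 ≡ + 1 * (k - (k - x))
            lem₂ = solve-∀

    Hit : ℕ → Set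
    Hit d = ∃ λ k → U d k ≡ a

    Hit? : ∀ d → Dec (Hit d)
    Hit? d with Finₚ.any? (λ (k : Fin r) → U d (+ toℕ k) Fin.≟ a)
    ... | yes (k , e) = yes (+ toℕ k , e)
    ... | no ¬e = no λ { (k , e) → ¬e (proj₁ (≋-residue 0<r k) , trans (L.U-≋ d (≋-sym (proj₂ (≋-residue 0<r k)))) e) }

    private
      -- Some power of `g` fixes `a`, so some later layer meets layer 0; the least such layer is
      -- taken.
      first : ∃ λ m → Hit (suc m) × (∀ l → l < m → ¬ Hit (suc l))
      first = go (period g a)
        where
        go : (∃ λ N → 0 < N × pow g (+ N) a ≡ a × (∀ k l → pow g k a ≡ pow g l a → Cong N k l)) →
             ∃ λ m → Hit (suc m) × (∀ l → l < m → ¬ Hit (suc l))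
        go (suc N , _ , e , _) = least (Hit? ∘ suc) N (+ 0 , e)

    opaque
      firstReturn : ∃ λ m → Hit (suc m) × (∀ l → l < m → ¬ Hit (suc l))
      firstReturn = first

    -- The powers of `g` common to both sides are cancelled one at a time, and a rotation moves the
    -- remaining position to 0.
    strip : ∀ i {d k l} → U i k ≡ U (i ℕ.+ d) l → Hit d
    strip zero {d} {k} {l} e = - k + l , trans (sym (U-+ d (- k) l)) (trans (cong (pow ρ (- k)) (sym e))
      (trans (U-+ 0 (- k) k) (cong (U 0) (ℤₚ.+-inverseˡ k))))
    strip (suc i) {d} {k} {l} e = strip i {d} {q⁻¹ * k} {q⁻¹ * l} (perm-injective g
      (trans (back i k) (trans e (sym (back (i ℕ.+ d) l)))))
      where
      lem : ∀ q p k → q * (p * k) - k ≡ k * (q * p - + 1)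
      lem = solve-∀
      back : ∀ i k → g ⟨$⟩ʳ U i (q⁻¹ * k) ≡ U (suc i) k
      back i k = trans (L.gU i (q⁻¹ * k)) (L.U-≋ (suc i) {q * (q⁻¹ * k)} {k} (lin₁ k q-unit (lem q q⁻¹ k)))

    -- Layer 1 consists of the heads of the first cycle, layer 0 of its tails. This removes the case
    -- of a single layer.
    ¬Hit₁ : ¬ Hit 1
    ¬Hit₁ (k , e) = C.disj (+ 0) k (trans (sym e) (cong (pow ρ k) ga≡b))

    labelling : Connected Γ → Labelling
    labelling conn = Wrapped.labelling conn 3≤r q q⁻¹ q-unit g τ mτ U L.gU L.U-≋ L.U-inj L.fw L.bw inU outU τ-T
        (proj₁ firstReturn) (- t₀) wrap₀ strip (proj₂ (proj₂ firstReturn))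
        (λ e → ¬Hit₁ (subst Hit e (proj₁ (proj₂ firstReturn))))
      where
      t₀ : ℤ
      t₀ = proj₁ (proj₁ (proj₂ firstReturn))
      wrap₀ : ∀ k → U (suc (proj₁ firstReturn)) k ≡ U 0 (k + - t₀)
      wrap₀ k = trans (cong (U (suc (proj₁ firstReturn))) (lem k t₀)) (trans (sym (U-+ (suc (proj₁ firstReturn)) (k + - t₀) t₀))
        (cong (pow ρ (k + - t₀)) (proj₂ (proj₁ (proj₂ firstReturn)))))
        where lem : ∀ k t → k ≡ k + - t + t
              lem = solve-∀

  opaque
    TightHAT⇒Xo : Connected Γ → TightlyAttached Γ G → Labelling
    TightHAT⇒Xo conn tight = finish (Keep.multiplier tight 3≤r closed ρ mρ
        (λ k → sym (pow-suc ρ k a)) (λ k → sym (pow-suc ρ k b)) g mg ga≡b)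
      where
      open Rotation
      finish : (∃₂ λ q q⁻¹ → Cong r (q * q⁻¹) (+ 1) × (∀ k → g ⟨$⟩ʳ T k ≡ H (q * k))) → Labelling
      finish (q , q⁻¹ , q-unit , gT≡H) = Layering.labelling 3≤r ρ mρ closed g mg ga≡b q q⁻¹ q-unit gT≡H τ mτ τ-T conn

-- Affine automorphisms of X_o(m,r;q)

-- X_o(m,r;q) with both coordinates extended periodically to ℤ; w i stands for q^i.
record Pres (Γ : Graph) (m r : ℕ) (q : ℤ) : Set where
  field
    U      : ℤ → ℤ → V Γ
    w      : ℤ → ℤ
    w-≋    : ∀ {i i'} → Cong m i i' → Cong r (w i) (w i')
    w-0    : Cong r (w (+ 0)) (+ 1)
    w-suc  : ∀ i → Cong r (w (i + + 1)) (q * w i)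
    U-≋    : ∀ {i i' j j'} → Cong m i i' → Cong r j j' → U i j ≡ U i' j'
    U-inj  : ∀ {i i' j j'} → U i j ≡ U i' j' → Cong m i i' × Cong r j j'
    U-onto : ∀ v → ∃₂ λ i j → v ≡ U i j
    adj⁺   : ∀ i j e → _~_ Γ (U i j) (U (i + + 1) (j + sgn e * w i))

  Step : ℤ → ℤ → ℤ → ℤ → Set
  Step i j i' j' = Cong m i' (i + + 1) × ∃ λ e → Cong r j' (j + sgn e * w i)

  field
    adj⁻   : ∀ {i j i' j'} → _~_ Γ (U i j) (U i' j') → Step i j i' j' ⊎ Step i' j' i j

-- All integers are reduced to residues; because q^m = 1, reducing the layer does not spoil its step
-- width.
IsoXo⇒Pres : ∀ {Γ m r q} → 0 < m → 0 < r → Cong r (q ^ m) (+ 1) → IsoXo Γ m r q → Pres Γ m r q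
IsoXo⇒Pres {Γ} {m@(suc _)} {r} {q} 0<m 0<r q^m≋1 (φ , φ-adj) = record
  { U = U ; w = w
  ; w-≋ = λ {i} {i'} c → ^-periodic q^m≋1 (≋-trans (≋-sym (res-≋ 0<m i)) (≋-trans c (res-≋ 0<m i')))
  ; w-0 = ^-periodic q^m≋1 {toℕ (res 0<m (+ 0))} {0} (≋-sym (res-≋ 0<m (+ 0)))
  ; w-suc = λ i → ^-periodic q^m≋1 {toℕ (res 0<m (i + + 1))} {suc (toℕ (res 0<m i))}
      (≋-trans (≋-sym (res-≋ 0<m (i + + 1))) (≋-trans (+-≋ (res-≋ 0<m i) ≋-refl) (≡⇒≋ (ℤₚ.+-comm (+ toℕ (res 0<m i)) (+ 1)))))
  ; U-≋ = λ c d → cong₂ (λ x y → Inverse.to φ (x , y)) (res-cong 0<m c) (res-cong 0<r d)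
  ; U-inj = λ {i} {i'} {j} {j'} e → let f = trans (sym (Inverse.strictlyInverseʳ φ _)) (trans (cong (Inverse.from φ) e) (Inverse.strictlyInverseʳ φ _)) in
      res-inj 0<m (cong proj₁ f) , res-inj 0<r (cong proj₂ f)
  ; U-onto = λ v → let (x , y) = Inverse.from φ v in + toℕ x , + toℕ y ,
      sym (trans (cong₂ (λ x y → Inverse.to φ (x , y)) (res-id 0<m x) (res-id 0<r y)) (Inverse.strictlyInverseˡ φ v))
  ; adj⁺ = λ i j e → Equivalence.to (φ-adj _ _) (inj₁ (Arc⇒XoArc (arc⁺ i j e)))
  ; adj⁻ = λ {i} {j} {i'} {j'} h → Sum.map (arc⁻ i j i' j' ∘ XoArc⇒Arc) (arc⁻ i' j' i j ∘ XoArc⇒Arc) (Equivalence.from (φ-adj _ _) h) }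
  where
  res : ∀ {n} → 0 < n → ℤ → Fin n
  res 0<n x = proj₁ (≋-residue 0<n x)
  res-≋ : ∀ {n} (0<n : 0 < n) x → Cong n x (+ toℕ (res 0<n x))
  res-≋ 0<n x = proj₂ (≋-residue 0<n x)
  res-cong : ∀ {n} (0<n : 0 < n) {x y} → Cong n x y → res 0<n x ≡ res 0<n y
  res-cong 0<n {x} {y} c = ≋-Fin (≋-trans (≋-sym (res-≋ 0<n x)) (≋-trans c (res-≋ 0<n y)))
  res-inj : ∀ {n} (0<n : 0 < n) {x y} → res 0<n x ≡ res 0<n y → Cong n x y
  res-inj 0<n {x} {y} e = ≋-trans (res-≋ 0<n x) (≋-trans (≡⇒≋ (cong (λ z → + toℕ z) e)) (≋-sym (res-≋ 0<n y)))
  res-id : ∀ {n} (0<n : 0 < n) x → res 0<n (+ toℕ x) ≡ x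
  res-id 0<n x = ≋-Fin (≋-sym (res-≋ 0<n (+ toℕ x)))
  U : ℤ → ℤ → V Γ
  U i j = Inverse.to φ (res 0<m i , res 0<r j)
  w : ℤ → ℤ
  w i = q ^ toℕ (res 0<m i)
  layer⁺ : ∀ i → Cong m (+ toℕ (res 0<m (i + + 1))) (+ toℕ (res 0<m i) + + 1)
  layer⁺ i = ≋-trans (≋-sym (res-≋ 0<m (i + + 1))) (+-≋ (res-≋ 0<m i) ≋-refl)
  arc⁺ : ∀ i j e → Arc m r q (toℕ (res 0<m i)) (+ toℕ (res 0<r j)) (toℕ (res 0<m (i + + 1))) (+ toℕ (res 0<r (j + sgn e * w i)))
  arc⁺ i j Fin.zero = layer⁺ i , inj₁ (≋-trans (≋-sym (res-≋ 0<r (j + + 1 * w i))) (+-≋ (res-≋ 0<r j) (≡⇒≋ (ℤₚ.*-identityˡ (w i)))))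
  arc⁺ i j (Fin.suc Fin.zero) = layer⁺ i , inj₂ (≋-trans (≋-sym (res-≋ 0<r (j + - (+ 1) * w i))) (+-≋ (res-≋ 0<r j) (≡⇒≋ (ℤₚ.-1*i≡-i (w i)))))
  arc⁻ : ∀ i j i' j' → Arc m r q (toℕ (res 0<m i)) (+ toℕ (res 0<r j)) (toℕ (res 0<m i')) (+ toℕ (res 0<r j')) →
    Cong m i' (i + + 1) × ∃ λ e → Cong r j' (j + sgn e * w i)
  arc⁻ i j i' j' (c , d) = ≋-trans (res-≋ 0<m i') (≋-trans c (+-≋ (≋-sym (res-≋ 0<m i)) ≋-refl)) ,
    [ (λ d → Fin.zero , ≋-trans (res-≋ 0<r j') (≋-trans d (+-≋ (≋-sym (res-≋ 0<r j)) (≡⇒≋ (sym (ℤₚ.*-identityˡ (w i)))))))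
    , (λ d → Fin.suc Fin.zero , ≋-trans (res-≋ 0<r j') (≋-trans d (+-≋ (≋-sym (res-≋ 0<r j)) (≡⇒≋ (sym (ℤₚ.-1*i≡-i (w i))))))) ]′ d

module Affine {Γ : Graph} {m r : ℕ} {q : ℤ} (P : Pres Γ m r q) (0<m : 0 < m) where
  open Pres P

  private _∼_ = _~_ Γ

  ∼-sym : ∀ {u v} → u ∼ v → v ∼ u
  ∼-sym {u} {v} = Graph.sym Γ u v

  -- `w-suc` only leads upwards; periodicity allows replacing `i` by a natural number, on which
  -- induction works.
  w-+ : ∀ i b → Cong r (w (i + b)) (w i * w b)
  w-+ i b = let (a , c) = ≋-residue 0<m i in
      ≋-trans (w-≋ (+-≋ c (≋-refl {x = b}))) (≋-trans (nat (toℕ a)) (*-≋ (w-≋ (≋-sym c)) ≋-refl))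
    where
    lem₀ : ∀ x y → y - x * y ≡ - y * (x - + 1)
    lem₀ = solve-∀
    lem : ∀ a b → + 1 + a + b ≡ (a + b) + + 1
    lem = solve-∀
    lem₂ : ∀ q x y z v u → v - x * u ≡ + 1 * (v - q * z) + q * (z - y * u) + - u * (x - q * y)
    lem₂ = solve-∀
    nat : ∀ a → Cong r (w (+ a + b)) (w (+ a) * w b)
    nat zero = ≋-trans (≡⇒≋ (cong w (ℤₚ.+-identityˡ b))) (lin₁ (- w b) w-0 (lem₀ (w (+ 0)) (w b)))
    nat (suc a) = ≋-trans (≡⇒≋ (cong w (lem (+ a) b)))
      (lin₃ (+ 1) q (- w b) (w-suc (+ a + b)) (nat a) (≋-trans (≡⇒≋ (cong w (ℤₚ.+-comm (+ 1) (+ a)))) (w-suc (+ a)))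
        (lem₂ q (w (+ suc a)) (w (+ a)) (w (+ a + b)) (w (+ a + b + + 1)) (w b)))

  w-inv : ∀ i → Cong r (w i * w (- i)) (+ 1)
  w-inv i = ≋-trans (≋-sym (w-+ i (- i))) (≋-trans (≡⇒≋ (cong w (ℤₚ.+-inverseʳ i))) w-0)

  -- Moving layers by `b` multiplies the step widths by `w b`, so positions are scaled by the same
  -- factor; besides, they may be reflected and shifted.
  aff : ℤ → Fin 2 → ℤ → V Γ → V Γ
  aff b e c v = let (i , j , _) = U-onto v in U (i + b) (sgn e * w b * j + c)

  aff-U : ∀ b e c i j → aff b e c (U i j) ≡ U (i + b) (sgn e * w b * j + c)
  aff-U b e c i j = let (i' , j' , eq) = U-onto (U i j) ; (h , k) = U-inj eq in
    U-≋ (+-≋ (≋-sym h) ≋-refl) (+-≋ (*-≋ {x = sgn e * w b} ≋-refl (≋-sym k)) ≋-refl)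

  private
    aff-inverse : ∀ b e c c' → Cong r (sgn e * w b * c' + c) (+ 0) → ∀ v → aff b e c (aff (- b) e c' v) ≡ v
    aff-inverse b e c c' h v = let (i , j , eq) = U-onto v in
      trans (cong (aff b e c ∘ aff (- b) e c') eq) (trans (cong (aff b e c) (aff-U (- b) e c' i j))
      (trans (aff-U b e c (i + - b) _) (trans (U-≋ (≡⇒≋ (lem i b))
        (lin₃ (sgn e * sgn e * j) j (+ 1) (w-inv b) (≡⇒≋ (sgn²≡1 e)) h (lem₂ (sgn e) (w b) (w (- b)) j c c'))) (sym eq))))
      where
      lem : ∀ i b → i + - b + b ≡ i
      lem = solve-∀
      lem₂ : ∀ s w v j c c' → s * w * (s * v * j + c') + c - j ≡
        s * s * j * (w * v - + 1) + j * (s * s - + 1) + + 1 * (s * w * c' + c - + 0)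
      lem₂ = solve-∀

    aff-adj : ∀ b e c {u v} → u ∼ v → aff b e c u ∼ aff b e c v
    aff-adj b e c {u} {v} uv = let (i , j , eq) = U-onto u ; (i' , j' , eq') = U-onto v in
      [ (λ s → subst₂ _∼_ (sym (cong (aff b e c) eq)) (sym (cong (aff b e c) eq')) (step i j i' j' s))
      , (λ s → ∼-sym (subst₂ _∼_ (sym (cong (aff b e c) eq')) (sym (cong (aff b e c) eq)) (step i' j' i j s))) ]′
      (adj⁻ (subst₂ _∼_ eq eq' uv))
      where
      lem : ∀ i b → i + b + + 1 ≡ i + + 1 + b
      lem = solve-∀
      lem₂ : ∀ s w j c d x j' y → s * w * j + c + s * d * y - (s * w * j' + c) ≡ s * d * (y - x * w) + - (s * w) * (j' - (j + d * x))
      lem₂ = solve-∀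
      step : ∀ i j i' j' → Step i j i' j' → aff b e c (U i j) ∼ aff b e c (U i' j')
      step i j i' j' (h , d , k) = let (f , eq) = sgn-* e d in
        subst₂ _∼_ (sym (aff-U b e c i j))
          (trans (U-≋ (≋-trans (≡⇒≋ (lem i b)) (+-≋ (≋-sym h) ≋-refl))
            (≋-trans (≡⇒≋ (cong (λ z → sgn e * w b * j + c + z * w (i + b)) eq))
              (lin₂ (sgn e * sgn d) (- (sgn e * w b)) (w-+ i b) k (lem₂ (sgn e) (w b) j c (sgn d) (w i) j' (w (i + b))))))
            (sym (aff-U b e c i' j')))
          (adj⁺ (i + b) (sgn e * w b * j + c) f)

  affine : ℤ → Fin 2 → ℤ → Permutation′ (Graph.n Γ)
  affine b e c = permutation (aff b e c) (aff (- b) e c')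
    (aff-inverse b e c c' (lin₂ (- (sgn e * sgn e * c)) (- c) (w-inv b) (≡⇒≋ (sgn²≡1 e)) (lem (sgn e) (w b) (w (- b)) c)))
    (λ v → subst (λ z → aff (- b) e c' (aff z e c v) ≡ v) (ℤₚ.neg-involutive b)
      (aff-inverse (- b) e c' c (≡⇒≋ (ℤₚ.+-inverseʳ (sgn e * w (- b) * c))) v))
    where
    c' = - (sgn e * w (- b) * c)
    lem : ∀ s w v c → s * w * (- (s * v * c)) + c - + 0 ≡ - (s * s * c) * (w * v - + 1) + - c * (s * s - + 1)
    lem = solve-∀

  affine-aut : ∀ b e c → IsAut Γ (affine b e c)
  affine-aut b e c u v = mk⇔ (aff-adj b e c) (λ h → subst₂ _∼_ (Perm.inverseˡ (affine b e c)) (Perm.inverseˡ (affine b e c)) (aff-adj (- b) e _ h))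

  -- The arcs leading up one layer. They will turn out to form one of the two orientations induced
  -- by the full automorphism group.
  F : V Γ → V Γ → Set
  F u v = ∃₂ λ i j → ∃ λ e → u ≡ U i j × v ≡ U (i + + 1) (j + sgn e * w i)

  ∼⇒F : ∀ {u v} → u ∼ v → F u v ⊎ F v u
  ∼⇒F {u} {v} uv = let (i , j , eq) = U-onto u ; (i' , j' , eq') = U-onto v in
    [ (λ { (h , e , k) → inj₁ (i , j , e , eq , trans eq' (U-≋ h k)) })
    , (λ { (h , e , k) → inj₂ (i' , j' , e , eq' , trans eq (U-≋ h k)) }) ]′ (adj⁻ (subst₂ _∼_ eq eq' uv))

  F⇒∼ : ∀ {u v} → F u v → u ∼ v
  F⇒∼ (i , j , e , refl , refl) = adj⁺ i j e

  vertex-transitive : VertexTransitive Γ (IsAut Γ)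
  vertex-transitive u v = let (i , j , eq) = U-onto u ; (i' , j' , eq') = U-onto v
                              b = i' - i ; c = j' - + 1 * w b * j in
    affine b Fin.zero c , affine-aut b Fin.zero c ,
    trans (cong (aff b Fin.zero c) eq) (trans (aff-U b Fin.zero c i j)
      (trans (U-≋ (≡⇒≋ (lem i i')) (≡⇒≋ (lem (+ 1 * w b * j) j'))) (sym eq')))
    where
    lem : ∀ i i' → i + (i' - i) ≡ i'
    lem = solve-∀

  F-transitive : ∀ {u v u' v'} → F u v → F u' v' → ∃ λ g → IsAut Γ g × g ⟨$⟩ʳ u ≡ u' × g ⟨$⟩ʳ v ≡ v'
  F-transitive (i , j , e , refl , refl) (i' , j' , e' , refl , refl) =
    let b = i' - i ; (f , eq) = sgn-/ e e' ; c = j' - sgn f * w b * j in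
    affine b f c , affine-aut b f c ,
    trans (aff-U b f c i j) (U-≋ (≡⇒≋ (lem i i')) (≡⇒≋ (lem (sgn f * w b * j) j'))) ,
    trans (aff-U b f c (i + + 1) _) (U-≋ (≡⇒≋ (lem₂ i i'))
      (lin₂ (- sgn e') (w b * w i) (≋-trans (w-≋ (≡⇒≋ (sym (lem i i')))) (w-+ i b)) (≡⇒≋ eq) (lem₃ (sgn f) (sgn e) (sgn e') (w b) (w i) (w i') j j')))
    where
    lem : ∀ i i' → i + (i' - i) ≡ i'
    lem = solve-∀
    lem₂ : ∀ i i' → i + + 1 + (i' - i) ≡ i' + + 1
    lem₂ = solve-∀
    lem₃ : ∀ f e e' b x y j j' → f * b * (j + e * x) + (j' - f * b * j) - (j' + e' * y) ≡ - e' * (y - x * b) + b * x * (f * e - e')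
    lem₃ = solve-∀
    sgn-/ : ∀ e e' → ∃ λ f → sgn f * sgn e ≡ sgn e'
    sgn-/ Fin.zero e' = e' , ℤₚ.*-identityʳ _
    sgn-/ (Fin.suc Fin.zero) Fin.zero = Fin.suc Fin.zero , refl
    sgn-/ (Fin.suc Fin.zero) (Fin.suc Fin.zero) = Fin.zero , refl

-- A closed walk of length 5 on the 5-cycle of layers winds around it.
windings : ∀ d₀ d₁ d₂ d₃ d₄ → 5 ℕD.∣ ℤ.∣ sgn d₀ + sgn d₁ + sgn d₂ + sgn d₃ + sgn d₄ ∣ →
  d₁ ≡ d₀ × d₂ ≡ d₀ × d₃ ≡ d₀ × d₄ ≡ d₀
windings = Dec.toWitness {a? = Finₚ.all? λ d₀ → Finₚ.all? λ d₁ → Finₚ.all? λ d₂ → Finₚ.all? λ d₃ → Finₚ.all? λ d₄ →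
  (5 ℕD.∣? ℤ.∣ sgn d₀ + sgn d₁ + sgn d₂ + sgn d₃ + sgn d₄ ∣) →-dec
  ((d₁ Fin.≟ d₀) ×-dec ((d₂ Fin.≟ d₀) ×-dec ((d₃ Fin.≟ d₀) ×-dec (d₄ Fin.≟ d₀))))} _

-- Closed walks of length five

module Walks {Γ : Graph} {m r : ℕ} {q : ℤ} (P : Pres Γ m r q) (0<m : 0 < m) where
  open Pres P
  open Affine P 0<m

  private _∼_ = _~_ Γ

  -- Directions share the encoding of signs, so that `sgn d` is the change of layer.
  Along : Fin 2 → V Γ → V Γ → Set
  Along Fin.zero    u v = F u v
  Along (Fin.suc _) u v = F v u

  lay : V Γ → ℤ
  lay v = proj₁ (U-onto v)

  F-lay : ∀ {u v} → F u v → Cong m (lay v) (lay u + + 1)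
  F-lay {u} {v} (i , j , e , x , y) = let (_ , _ , x') = U-onto u ; (_ , _ , y') = U-onto v in
    ≋-trans (proj₁ (U-inj (trans (sym y') y))) (+-≋ (proj₁ (U-inj (trans (sym x) x'))) ≋-refl)

  ∼⇒Along : ∀ {u v} → u ∼ v → ∃ λ d → Along d u v × Cong m (lay v) (lay u + sgn d)
  ∼⇒Along {u} {v} uv = [ (λ f → Fin.zero , f , F-lay f) , (λ f → Fin.suc Fin.zero , f , lin₁ (- (+ 1)) (F-lay f) (lem (lay u) (lay v))) ]′ (∼⇒F uv)
    where lem : ∀ x y → y - (x + - (+ 1)) ≡ - (+ 1) * (x - (y + + 1))
          lem = solve-∀

  follow : ∀ {i j u v} → u ≡ U i j → F u v → ∃ λ e → v ≡ U (i + + 1) (j + sgn e * w i)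
  follow x (i' , j' , e , x' , y) = let (c , d) = U-inj (trans (sym x') x) in
    e , trans y (U-≋ (+-≋ c ≋-refl) (+-≋ d (*-≋ (≋-refl {x = sgn e}) (w-≋ c))))

  closed-walk : ∀ {v₀ v₁ v₂ v₃ v₄} → v₀ ∼ v₁ → v₁ ∼ v₂ → v₂ ∼ v₃ → v₃ ∼ v₄ → v₄ ∼ v₀ →
    ∃ λ d₀ → ∃ λ d₁ → ∃ λ d₂ → ∃ λ d₃ → ∃ λ d₄ →
    Along d₀ v₀ v₁ × Along d₁ v₁ v₂ × Along d₂ v₂ v₃ × Along d₃ v₃ v₄ × Along d₄ v₄ v₀ ×
    m ℕD.∣ ℤ.∣ sgn d₀ + sgn d₁ + sgn d₂ + sgn d₃ + sgn d₄ ∣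
  closed-walk {v₀} {v₁} {v₂} {v₃} {v₄} s₀ s₁ s₂ s₃ s₄ =
    let (d₀ , a₀ , c₀) = ∼⇒Along s₀ ; (d₁ , a₁ , c₁) = ∼⇒Along s₁ ; (d₂ , a₂ , c₂) = ∼⇒Along s₂
        (d₃ , a₃ , c₃) = ∼⇒Along s₃ ; (d₄ , a₄ , c₄) = ∼⇒Along s₄
        s = sgn d₀ + sgn d₁ + sgn d₂ + sgn d₃ + sgn d₄
        c : Cong m (lay v₀ + s) (lay v₀)
        c = ≋-sym (≋-trans c₄ (≋-trans (+-≋ (≋-trans c₃ (+-≋ (≋-trans c₂ (+-≋ (≋-trans c₁ (+-≋ c₀ (≋-refl {x = sgn d₁}))) (≋-refl {x = sgn d₂}))) (≋-refl {x = sgn d₃}))) (≋-refl {x = sgn d₄}))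
              (≡⇒≋ (lem (lay v₀) (sgn d₀) (sgn d₁) (sgn d₂) (sgn d₃) (sgn d₄)))))
    in d₀ , d₁ , d₂ , d₃ , d₄ , a₀ , a₁ , a₂ , a₃ , a₄ ,
       subst (m ℕD.∣_) (cong ℤ.∣_∣ (ℤₚ.+-identityʳ s)) (≋⇒mod (lin₁ {x = s} {y = + 0} (+ 1) c (lem₂ (lay v₀) s)))
    where
    lem : ∀ l a b c d e → l + a + b + c + d + e ≡ l + (a + b + c + d + e)
    lem = solve-∀
    lem₂ : ∀ l s → s - + 0 ≡ + 1 * (l + s - l)
    lem₂ = solve-∀

module FiveWalks {Γ : Graph} {r : ℕ} {q : ℤ} (P : Pres Γ 5 r q) where
  open Pres P
  open Affine P (s≤s z≤n)
  open Walks P (s≤s z≤n) public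

  private _∼_ = _~_ Γ

  wq : ∀ i → Cong r (w (i + + 1)) (w i * q)
  wq i = ≋-trans (w-suc i) (≡⇒≋ (ℤₚ.*-comm q (w i)))

  wq² : ∀ i → Cong r (w (i + + 2)) (w i * (q * q))
  wq² i = ≋-trans (≡⇒≋ (cong w (lem i))) (lin₂ (+ 1) q (wq (i + + 1)) (wq i) (lem₂ q (w i) (w (i + + 1)) (w (i + + 1 + + 1))))
    where lem : ∀ i → i + + 2 ≡ i + + 1 + + 1
          lem = solve-∀
          lem₂ : ∀ q x y z → z - x * (q * q) ≡ + 1 * (z - y * q) + q * (y - x * q)
          lem₂ = solve-∀

  wq³ : ∀ i → Cong r (w (i + + 3)) (w i * (q * q * q))
  wq³ i = ≋-trans (≡⇒≋ (cong w (lem i))) (lin₂ (+ 1) q (wq (i + + 2)) (wq² i) (lem₂ q (w i) (w (i + + 2)) (w (i + + 2 + + 1))))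
    where lem : ∀ i → i + + 3 ≡ i + + 2 + + 1
          lem = solve-∀
          lem₂ : ∀ q x y z → z - x * (q * q * q) ≡ + 1 * (z - y * q) + q * (y - x * (q * q))
          lem₂ = solve-∀

  wq⁴ : ∀ i → Cong r (w (i + + 4)) (w i * (q * q * q * q))
  wq⁴ i = ≋-trans (≡⇒≋ (cong w (lem i))) (lin₂ (+ 1) q (wq (i + + 3)) (wq³ i) (lem₂ q (w i) (w (i + + 3)) (w (i + + 3 + + 1))))
    where lem : ∀ i → i + + 4 ≡ i + + 3 + + 1
          lem = solve-∀
          lem₂ : ∀ q x y z → z - x * (q * q * q * q) ≡ + 1 * (z - y * q) + q * (y - x * (q * q * q))
          lem₂ = solve-∀

  cancel-w : ∀ i {x} → Cong r (w i * x) (+ 0) → Cong r x (+ 0)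
  cancel-w i {x} c = lin₂ (- x) (w (- i)) (w-inv i) c (lem (w i) (w (- i)) x)
    where lem : ∀ w v x → x - + 0 ≡ - x * (w * v - + 1) + v * (w * x - + 0)
          lem = solve-∀

  -- The total change of position vanishes; dividing it by the unit `w i` turns the step widths into
  -- 1, q, ..., q⁴.
  winding-sum : ∀ {v₀ v₁ v₂ v₃ v₄} → F v₀ v₁ → F v₁ v₂ → F v₂ v₃ → F v₃ v₄ → F v₄ v₀ →
    ∃₂ λ i j → ∃ λ e₀ → ∃ λ e₁ → ∃ λ e₂ → ∃ λ e₃ → ∃ λ e₄ →
    let j₁ = j + sgn e₀ * w i ; j₂ = j₁ + sgn e₁ * w (i + + 1) ; j₃ = j₂ + sgn e₂ * w (i + + 1 + + 1) ; j₄ = j₃ + sgn e₃ * w (i + + 1 + + 1 + + 1) in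
    v₀ ≡ U i j × v₁ ≡ U (i + + 1) j₁ × v₂ ≡ U (i + + 1 + + 1) j₂ × v₃ ≡ U (i + + 1 + + 1 + + 1) j₃ × v₄ ≡ U (i + + 1 + + 1 + + 1 + + 1) j₄ ×
    Cong r (sgn e₀ + sgn e₁ * q + sgn e₂ * (q * q) + sgn e₃ * (q * q * q) + sgn e₄ * (q * q * q * q)) (+ 0)
  winding-sum (i , j , e₀ , x₀ , y₁) f₁ f₂ f₃ f₄ =
    let (e₁ , y₂) = follow y₁ f₁ ; (e₂ , y₃) = follow y₂ f₂ ; (e₃ , y₄) = follow y₃ f₃ ; (e₄ , y₅) = follow y₄ f₄
        c = proj₂ (U-inj (trans (sym x₀) y₅))
    in i , j , e₀ , e₁ , e₂ , e₃ , e₄ , x₀ , y₁ , y₂ , y₃ , y₄ ,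
       cancel-w i (lin₃ (- (+ 1)) (- (+ 1)) (- (+ 1)) c
             (+-≋ (*-≋ (≋-refl {x = sgn e₁}) (wq i)) (*-≋ (≋-refl {x = sgn e₂}) (wq₂ i)))
             (+-≋ (*-≋ (≋-refl {x = sgn e₃}) (wq₃ i)) (*-≋ (≋-refl {x = sgn e₄}) (wq₄ i)))
             (lem j (sgn e₀) (sgn e₁) (sgn e₂) (sgn e₃) (sgn e₄) q (w i) (w (i + + 1)) (w (i + + 1 + + 1)) (w (i + + 1 + + 1 + + 1)) (w (i + + 1 + + 1 + + 1 + + 1))))
    where
    n₂ : ∀ i → i + + 1 + + 1 ≡ i + + 2
    n₂ = solve-∀
    n₃ : ∀ i → i + + 1 + + 1 + + 1 ≡ i + + 3
    n₃ = solve-∀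
    n₄ : ∀ i → i + + 1 + + 1 + + 1 + + 1 ≡ i + + 4
    n₄ = solve-∀
    wq₂ : ∀ i → Cong r (w (i + + 1 + + 1)) (w i * (q * q))
    wq₂ i = ≋-trans (≡⇒≋ (cong w (n₂ i))) (wq² i)
    wq₃ : ∀ i → Cong r (w (i + + 1 + + 1 + + 1)) (w i * (q * q * q))
    wq₃ i = ≋-trans (≡⇒≋ (cong w (n₃ i))) (wq³ i)
    wq₄ : ∀ i → Cong r (w (i + + 1 + + 1 + + 1 + + 1)) (w i * (q * q * q * q))
    wq₄ i = ≋-trans (≡⇒≋ (cong w (n₄ i))) (wq⁴ i)
    lem : ∀ j e₀ e₁ e₂ e₃ e₄ q w₀ w₁ w₂ w₃ w₄ →
      w₀ * (e₀ + e₁ * q + e₂ * (q * q) + e₃ * (q * q * q) + e₄ * (q * q * q * q)) - + 0 ≡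
      - (+ 1) * (j - (j + e₀ * w₀ + e₁ * w₁ + e₂ * w₂ + e₃ * w₃ + e₄ * w₄)) +
      - (+ 1) * (e₁ * w₁ + e₂ * w₂ - (e₁ * (w₀ * q) + e₂ * (w₀ * (q * q)))) +
      - (+ 1) * (e₃ * w₃ + e₄ * w₄ - (e₃ * (w₀ * (q * q * q)) + e₄ * (w₀ * (q * q * q * q))))
    lem = solve-∀

  five-cycle-directed : ∀ {v₀ v₁ v₂ v₃ v₄} → v₀ ∼ v₁ → v₁ ∼ v₂ → v₂ ∼ v₃ → v₃ ∼ v₄ → v₄ ∼ v₀ →
    ∃ λ d → Along d v₀ v₁ × Along d v₁ v₂ × Along d v₂ v₃ × Along d v₃ v₄ × Along d v₄ v₀
  five-cycle-directed {v₀} {v₁} {v₂} {v₃} {v₄} s₀ s₁ s₂ s₃ s₄ =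
    let (d₀ , d₁ , d₂ , d₃ , d₄ , a₀ , a₁ , a₂ , a₃ , a₄ , c) = closed-walk s₀ s₁ s₂ s₃ s₄
        (e₁ , e₂ , e₃ , e₄) = windings d₀ d₁ d₂ d₃ d₄ c
    in d₀ , a₀ , subst (λ d → Along d v₁ v₂) e₁ a₁ , subst (λ d → Along d v₂ v₃) e₂ a₂ , subst (λ d → Along d v₃ v₄) e₃ a₃ , subst (λ d → Along d v₄ v₀) e₄ a₄

-- Alternating cycles of X_o(m,r;q)

Aut : (Γ : Graph) → Subgroup Γ
Aut Γ = record { mem = IsAut Γ ; isSub = record
  { auts = λ _ h → h
  ; hasId = Perm.id , (λ _ _ → mk⇔ (λ h → h) (λ h → h)) , λ _ → refl
  ; hasMul = λ g h mg mh → h Perm.∘ₚ g ,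
      (λ u v → mk⇔ (Equivalence.to (mg _ _) ∘ Equivalence.to (mh u v)) (Equivalence.from (mh u v) ∘ Equivalence.from (mg _ _))) , λ _ → refl
  ; hasInv = λ g mg → Perm.flip g ,
      (λ u v → mk⇔ (λ h → Equivalence.from (mg _ _) (subst₂ (_~_ Γ) (sym (Perm.inverseʳ g)) (sym (Perm.inverseʳ g)) h))
                   (λ h → subst₂ (_~_ Γ) (Perm.inverseʳ g) (Perm.inverseʳ g) (Equivalence.to (mg _ _) h))) , λ _ → Perm.inverseˡ g } }

vtx-inj : ∀ {Γ k} (C : Cycle Γ k) {x y} → vtx C x ≡ vtx C y → Cong k (+ x) (+ y)
vtx-inj {Γ} {zero} C {x} {y} _ with len≥3 C
... | ()
vtx-inj {Γ} {k@(suc _)} C {x} {y} e = ≋-trans (%-≋ x k) (≋-trans (≡⇒≋ (cong +_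
    (distinct C _ _ (ℕM.m%n<n x k) (ℕM.m%n<n y k) (trans (sym (reduce x)) (trans e (reduce y)))))) (≋-sym (%-≋ y k)))
  where
  periods : ∀ c x → vtx C (x ℕ.+ c ℕ.* k) ≡ vtx C x
  periods zero    x = cong (vtx C) (ℕₚ.+-identityʳ x)
  periods (suc c) x = trans (cong (vtx C) (trans (cong (x ℕ.+_) (ℕₚ.+-comm k (c ℕ.* k))) (sym (ℕₚ.+-assoc x (c ℕ.* k) k))))
    (trans (periodic C (x ℕ.+ c ℕ.* k)) (periods c x))
  reduce : ∀ x → vtx C x ≡ vtx C (x ℕM.% k)
  reduce x = trans (cong (vtx C) (ℕM.m≡m%n+[m/n]*n x k)) (periods (x ℕM./ k) (x ℕM.% k))

no-backtrack : ∀ {Γ k} (C : Cycle Γ k) x → vtx C (suc (suc x)) ≢ vtx C x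
no-backtrack C x e = 3≤⇒2≢0 (len≥3 C) (lin₁ (+ 1) (vtx-inj C e) (lem (+ x)))
  where lem : ∀ x → + 2 - + 0 ≡ + 1 * (+ 2 + x - x)
        lem = solve-∀

-- All that is used of the automorphisms of X_o(m,r;q) is `key`: they keep the direction of the arcs
-- between layers. Half-arc-transitivity and tight attachment follow uniformly; only the proof of
-- `key` differs for the two families.
module Consequences {Γ : Graph} {m r : ℕ} {q : ℤ} (P : Pres Γ m r q) (0<m : 0 < m) (3≤m : 3 ≤ m) (3≤r : 3 ≤ r)
  (h : ℤ) (2h≋1 : Cong r (+ 2 * h) (+ 1))
  (key : ∀ α → IsAut Γ α → ∀ {u v} → Affine.F P 0<m u v → Affine.F P 0<m (α ⟨$⟩ʳ u) (α ⟨$⟩ʳ v))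
  where

  open Pres P
  open Affine P 0<m

  private _∼_ = _~_ Γ

  0<r : 0 < r
  0<r = ℕₚ.≤-trans (s≤s z≤n) 3≤r

  F-excl : ∀ {u v} → F u v → F v u → ⊥
  F-excl (i , j , e , eu , ev) (i' , j' , e' , ev' , eu') = 3≤⇒2≢0 3≤m
    (lin₂ (+ 1) (+ 1) (proj₁ (U-inj (trans (sym ev) ev'))) (proj₁ (U-inj (trans (sym eu') eu))) (lem i i'))
    where lem : ∀ i i' → + 2 - + 0 ≡ + 1 * (i + + 1 - i') + + 1 * (i' + + 1 - i)
          lem = solve-∀

  edge-transitive : EdgeTransitive Γ (IsAut Γ)
  edge-transitive u v x y uv xy with ∼⇒F uv | ∼⇒F xy
  ... | inj₁ f | inj₁ f' = let (g , mg , e , e') = F-transitive f f' in g , mg , inj₁ (e , e')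
  ... | inj₁ f | inj₂ f' = let (g , mg , e , e') = F-transitive f f' in g , mg , inj₂ (e , e')
  ... | inj₂ f | inj₁ f' = let (g , mg , e , e') = F-transitive f f' in g , mg , inj₂ (e' , e)
  ... | inj₂ f | inj₂ f' = let (g , mg , e , e') = F-transitive f f' in g , mg , inj₁ (e' , e)

  Oriented⇒F : ∀ {a b x y} → F a b → Oriented Γ (IsAut Γ) a b x y → F x y
  Oriented⇒F f (g , mg , refl , refl) = key g mg f

  half-arc-transitive : HalfArcTransitive Γ
  half-arc-transitive = vertex-transitive , edge-transitive , λ at →
    F-excl arc (Oriented⇒F arc (at _ _ _ _ (F⇒∼ arc) (∼-sym (F⇒∼ arc))))
    where
    arc : F (U (+ 0) (+ 0)) (U (+ 0 + + 1) (+ 0 + + 1 * w (+ 0)))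
    arc = + 0 , + 0 , Fin.zero , refl , refl

  AlternatingF : ∀ {k} → Cycle Γ k → Set
  AlternatingF C = Alternating Γ F C

  -- The orbit of (a , b) consists of the arcs of `F` or of their reverses. In the second case the
  -- condition is contraposed, as every edge carries exactly one of the two directions.
  Alternating⇒F : ∀ {a b} → a ∼ b → ∀ {k} (C : Cycle Γ k) → Alternating Γ (Oriented Γ (IsAut Γ) a b) C → AlternatingF C
  Alternating⇒F {a} {b} ab C alt i = [ same , opposite ]′ (∼⇒F ab)
    where
    x = vtx C i
    y = vtx C (suc i)
    z = vtx C (suc (suc i))
    same : F a b → F x y ⇔ F z y
    same f = mk⇔ (λ g → Oriented⇒F f (Equivalence.to (alt i) (F-transitive f g)))
                 (λ g → Oriented⇒F f (Equivalence.from (alt i) (F-transitive f g)))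
    swap : ∀ {x y} → F b a → Oriented Γ (IsAut Γ) a b x y → F y x
    swap f (g , mg , refl , refl) = key g mg f
    swap⁻¹ : ∀ {x y} → F b a → F y x → Oriented Γ (IsAut Γ) a b x y
    swap⁻¹ f f' = let (g , mg , e , e') = F-transitive f f' in g , mg , e' , e
    opposite : F b a → F x y ⇔ F z y
    opposite f = mk⇔
      (λ g → [ (λ g' → ⊥-elim (F-excl g (swap f (Equivalence.from (alt i) (swap⁻¹ f g'))))) , (λ g' → g') ]′ (∼⇒F (edges C (suc i))))
      (λ g → [ (λ g' → g') , (λ g' → ⊥-elim (F-excl g (swap f (Equivalence.to (alt i) (swap⁻¹ f g'))))) ]′ (∼⇒F (edges C i)))

  private
    -- Two successive signed steps of the same width either cancel or agree; without turning back
    -- they agree.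
    other : ∀ e f {x y z W W' : ℤ} → Cong r W W' → Cong r y (x + sgn e * W) → Cong r z (y + sgn f * W') → ¬ Cong r z x → Cong r z (x + + 2 * sgn e * W)
    other Fin.zero Fin.zero {x} {y} {z} {W} {W'} c h₁ h₂ _ = lin₃ (+ 1) (+ 1) (- (+ 1)) h₁ h₂ c (lem x y z W W')
      where lem : ∀ x y z W W' → z - (x + + 2 * + 1 * W) ≡ + 1 * (y - (x + + 1 * W)) + + 1 * (z - (y + + 1 * W')) + - (+ 1) * (W - W')
            lem = solve-∀
    other (Fin.suc Fin.zero) (Fin.suc Fin.zero) {x} {y} {z} {W} {W'} c h₁ h₂ _ = lin₃ (+ 1) (+ 1) (+ 1) h₁ h₂ c (lem x y z W W')
      where lem : ∀ x y z W W' → z - (x + + 2 * - (+ 1) * W) ≡ + 1 * (y - (x + - (+ 1) * W)) + + 1 * (z - (y + - (+ 1) * W')) + + 1 * (W - W')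
            lem = solve-∀
    other Fin.zero (Fin.suc Fin.zero) {x} {y} {z} {W} {W'} c h₁ h₂ ¬h = ⊥-elim (¬h (lin₃ (+ 1) (+ 1) (+ 1) h₁ h₂ c (lem x y z W W')))
      where lem : ∀ x y z W W' → z - x ≡ + 1 * (y - (x + + 1 * W)) + + 1 * (z - (y + - (+ 1) * W')) + + 1 * (W - W')
            lem = solve-∀
    other (Fin.suc Fin.zero) Fin.zero {x} {y} {z} {W} {W'} c h₁ h₂ ¬h = ⊥-elim (¬h (lin₃ (+ 1) (+ 1) (- (+ 1)) h₁ h₂ c (lem x y z W W')))
      where lem : ∀ x y z W W' → z - x ≡ + 1 * (y - (x + - (+ 1) * W)) + + 1 * (z - (y + + 1 * W')) + - (+ 1) * (W - W')
            lem = solve-∀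

  negate : Fin 2 → Fin 2
  negate Fin.zero = Fin.suc Fin.zero
  negate (Fin.suc _) = Fin.zero

  sgn-negate : ∀ e → sgn (negate e) ≡ - sgn e
  sgn-negate Fin.zero = refl
  sgn-negate (Fin.suc Fin.zero) = refl

  sameLayer : ∀ {i i' j j'} → Cong m i i' → U i j ≢ U i' j' → ¬ Cong r j j'
  sameLayer c ne h = ne (U-≋ c h)

  next-tail : ∀ {i j e z} → F z (U (i + + 1) (j + sgn e * w i)) → z ≢ U i j → z ≡ U i (j + + 2 * sgn e * w i)
  next-tail {i} {j} {e} {z} (i' , j' , f , ez , ey) ne = trans ez (U-≋ c (other e (negate f) wc ≋-refl k (sameLayer c (ne ∘ trans ez))))
    where
    lem : ∀ i i' → i' - i ≡ - (+ 1) * (i + + 1 - (i' + + 1))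
    lem = solve-∀
    c : Cong m i' i
    c = lin₁ (- (+ 1)) (proj₁ (U-inj ey)) (lem i i')
    wc : Cong r (w i) (w i')
    wc = w-≋ (≋-sym c)
    lem₂ : ∀ y j f w → j - (y + - f * w) ≡ - (+ 1) * (y - (j + f * w))
    lem₂ = solve-∀
    k : Cong r j' (j + sgn e * w i + sgn (negate f) * w i')
    k = subst (λ s → Cong r j' (j + sgn e * w i + s * w i')) (sym (sgn-negate f))
      (lin₁ (- (+ 1)) (proj₂ (U-inj ey)) (lem₂ (j + sgn e * w i) j' (sgn f) (w i')))

  next-head : ∀ {i j e z} → F (U i j) z → z ≢ U (i + + 1) (j - sgn e * w i) → z ≡ U (i + + 1) (j + sgn e * w i)
  next-head {i} {j} {e} {z} (i' , j' , f , ex , ez) ne = trans ez (U-≋ c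
      (≋-trans (other e f (w-≋ (proj₁ (U-inj ex))) (≡⇒≋ (lem j (sgn e * w i))) (+-≋ (≋-sym (proj₂ (U-inj ex))) ≋-refl) (sameLayer c (ne ∘ trans ez)))
        (≡⇒≋ (lem₂ j (sgn e) (w i)))))
    where
    c : Cong m (i' + + 1) (i + + 1)
    c = +-≋ (≋-sym (proj₁ (U-inj ex))) ≋-refl
    lem : ∀ j x → j ≡ j - x + x
    lem = solve-∀
    lem₂ : ∀ j e w → j - e * w + + 2 * e * w ≡ j + e * w
    lem₂ = solve-∀

  w⁻¹ : ∀ i → Cong r (w (- i) * w i) (+ 1)
  w⁻¹ i = ≋-trans (≡⇒≋ (ℤₚ.*-comm (w (- i)) (w i))) (w-inv i)

  -- As 2 and `w i` are units, double steps reach every position of the layer. Counting with `suc l`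
  -- leaves room for a preceding vertex, which `layer⇒edge` needs.
  solve-step : ∀ i e x y → ∃ λ l → Cong r (x + + 2 * + suc l * sgn e * w i) y
  solve-step i e x y = let (c , k) = ≋-residue 0<r ((y - x) * h * sgn e * w (- i) - + 1) in toℕ c ,
      lin₃ (- (+ 2 * sgn e * w i)) (+ 2 * h * (y - x) * (sgn e * sgn e)) (y - x)
        k (w⁻¹ i) (lin₂ {x = + 2 * h * (sgn e * sgn e)} {y = + 1} (sgn e * sgn e) (+ 1) 2h≋1 (≡⇒≋ (sgn²≡1 e)) (lem₁ h (sgn e))) (lem x y (+ toℕ c) h (sgn e) (w i) (w (- i)))
    where
    lem₁ : ∀ h s → + 2 * h * (s * s) - + 1 ≡ s * s * (+ 2 * h - + 1) + + 1 * (s * s - + 1)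
    lem₁ = solve-∀
    lem : ∀ x y c h s w v → x + + 2 * (+ 1 + c) * s * w - y ≡
      - (+ 2 * s * w) * ((y - x) * h * s * v - + 1 - c) + + 2 * h * (y - x) * (s * s) * (v * w - + 1) + (y - x) * (+ 2 * h * (s * s) - + 1)
    lem = solve-∀

  -- An alternating cycle zigzags between the layers `i` and `i + + 1`, always advancing with the
  -- sign `e`. The offset `s` is the index of its first tail.
  record Shape {k} (C : Cycle Γ k) : Set where
    field
      s   : ℕ
      s≤1 : s ≤ 1
      i j : ℤ
      e   : Fin 2
      even : ∀ l → vtx C (s ℕ.+ l ℕ.* 2) ≡ U i (j + + 2 * + l * sgn e * w i)
      odd  : ∀ l → vtx C (suc (s ℕ.+ l ℕ.* 2)) ≡ U (i + + 1) (j + + 2 * + l * sgn e * w i + sgn e * w i)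

  shape : ∀ {k} (C : Cycle Γ k) → AlternatingF C → Shape C
  shape C alt = [ (λ f → build 0 z≤n f) , (λ f → build 1 (s≤s z≤n) (start f)) ]′ (∼⇒F (edges C 0))
    where
    v = vtx C
    start : F (v 1) (v 0) → F (v 1) (v 2)
    start f = [ (λ f' → f') , (λ f' → ⊥-elim (F-excl f (Equivalence.from (alt 0) f'))) ]′ (∼⇒F (edges C 1))
    build : ∀ s → s ≤ 1 → F (v s) (v (suc s)) → Shape C
    build s s≤1 (i , j , e , e₀ , e₁) = record { s = s ; s≤1 = s≤1 ; i = i ; j = j ; e = e ; even = proj₁ ∘ both ; odd = proj₂ ∘ both }
      where
      pos : ℕ → ℤ
      pos l = j + + 2 * + l * sgn e * w i
      Both : ℕ → Set
      Both l = v (s ℕ.+ l ℕ.* 2) ≡ U i (pos l) × v (suc (s ℕ.+ l ℕ.* 2)) ≡ U (i + + 1) (pos l + sgn e * w i)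
      lem₀ : ∀ j e w → j ≡ j + + 2 * + 0 * e * w
      lem₀ = solve-∀
      lem₁ : ∀ j l e w → j + + 2 * l * e * w + + 2 * e * w ≡ j + + 2 * (+ 1 + l) * e * w
      lem₁ = solve-∀
      lem₂ : ∀ j l e w → j + + 2 * (+ 1 + l) * e * w - e * w ≡ j + + 2 * l * e * w + e * w
      lem₂ = solve-∀
      index : ∀ l → s ℕ.+ suc l ℕ.* 2 ≡ suc (suc (s ℕ.+ l ℕ.* 2))
      index l = trans (ℕₚ.+-suc s (suc (l ℕ.* 2))) (cong suc (ℕₚ.+-suc s (l ℕ.* 2)))
      both : ∀ l → Both l
      both zero = trans (cong v (ℕₚ.+-identityʳ s)) (trans e₀ (cong (U i) (lem₀ j (sgn e) (w i)))) ,
                  trans (cong (v ∘ suc) (ℕₚ.+-identityʳ s)) (trans e₁ (cong (λ z → U (i + + 1) (z + sgn e * w i)) (lem₀ j (sgn e) (w i))))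
      both (suc l) = trans (cong v (index l)) tail , trans (cong (v ∘ suc) (index l)) head
        where
        x = s ℕ.+ l ℕ.* 2
        ih = both l
        f₀ : F (v x) (v (suc x))
        f₀ = i , pos l , e , proj₁ ih , proj₂ ih
        f₁ : F (v (suc (suc x))) (v (suc x))
        f₁ = Equivalence.to (alt x) f₀
        f₂ : F (v (suc (suc x))) (v (suc (suc (suc x))))
        f₂ = [ (λ f → f) , (λ f → ⊥-elim (F-excl f₁ (Equivalence.from (alt (suc x)) f))) ]′ (∼⇒F (edges C (suc (suc x))))
        tail : v (suc (suc x)) ≡ U i (pos (suc l))
        tail = trans (next-tail {i} {pos l} {e} (subst (F _) (proj₂ ih) f₁) (λ z → no-backtrack C x (trans z (sym (proj₁ ih)))))
          (cong (U i) (lem₁ j (+ l) (sgn e) (w i)))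
        head : v (suc (suc (suc x))) ≡ U (i + + 1) (pos (suc l) + sgn e * w i)
        head = next-head {i} {pos (suc l)} {e} (subst (λ z → F z (v (suc (suc (suc x))))) tail f₂)
          (λ z → no-backtrack C (suc x) (trans z (trans (cong (U (i + + 1)) (lem₂ j (+ l) (sgn e) (w i))) (sym (proj₂ ih)))))

  OnLayer : ℤ → V Γ → Set
  OnLayer i v = ∃ λ j → v ≡ U i j

  LayerEdge : ℤ → V Γ → V Γ → Set
  LayerEdge i u v = ∃₂ λ j e → u ≡ U i j × v ≡ U (i + + 1) (j + sgn e * w i)

  LayerEdge-≋ : ∀ {i i' u v} → Cong m i i' → LayerEdge i u v → LayerEdge i' u v
  LayerEdge-≋ c (j , e , eu , ev) = j , e , trans eu (U-≋ c ≋-refl) ,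
    trans ev (U-≋ (+-≋ c ≋-refl) (+-≋ (≋-refl {x = j}) (*-≋ (≋-refl {x = sgn e}) (w-≋ c))))

  module _ {k} {C : Cycle Γ k} (S : Shape C) where
    open Shape S

    private
      v = vtx C

      index : ∀ x → ∃ λ y → v x ≡ v (s ℕ.+ y) × v (suc x) ≡ v (suc (s ℕ.+ y))
      index x = (x ℕ.+ k) ℕ.∸ s , trans (sym (periodic C x)) (cong v eq) , trans (sym (periodic C (suc x))) (cong (v ∘ suc) eq)
        where
        eq : x ℕ.+ k ≡ s ℕ.+ ((x ℕ.+ k) ℕ.∸ s)
        eq = sym (ℕₚ.m+[n∸m]≡n (ℕₚ.≤-trans s≤1 (ℕₚ.≤-trans (ℕₚ.≤-trans (s≤s z≤n) (len≥3 C)) (ℕₚ.m≤n+m k x))))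

      suc-index : ∀ l → suc (s ℕ.+ suc (l ℕ.* 2)) ≡ s ℕ.+ suc l ℕ.* 2
      suc-index l = sym (ℕₚ.+-suc s (suc (l ℕ.* 2)))

    onLayers : ∀ {u} → OnCycle Γ C u → OnLayer i u ⊎ OnLayer (i + + 1) u
    onLayers (x , refl) = let (y , e , _) = index x in go y e (parity y)
      where
      go : ∀ y → v x ≡ v (s ℕ.+ y) → (∃ λ l → y ≡ l ℕ.* 2) ⊎ (∃ λ l → y ≡ suc (l ℕ.* 2)) → OnLayer i (v x) ⊎ OnLayer (i + + 1) (v x)
      go y e (inj₁ (l , refl)) = inj₁ (_ , trans e (even l))
      go y e (inj₂ (l , refl)) = inj₂ (_ , trans e (trans (cong v (ℕₚ.+-suc s (l ℕ.* 2))) (odd l)))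

    onLayers⁻¹ : ∀ {u} → OnLayer i u ⊎ OnLayer (i + + 1) u → OnCycle Γ C u
    onLayers⁻¹ (inj₁ (y , refl)) = let (l , c) = solve-step i e j y in s ℕ.+ suc l ℕ.* 2 , trans (even (suc l)) (U-≋ ≋-refl c)
    onLayers⁻¹ (inj₂ (y , refl)) = let (l , c) = solve-step i e (j + sgn e * w i) y in
      suc (s ℕ.+ suc l ℕ.* 2) , trans (odd (suc l)) (U-≋ ≋-refl (≋-trans (≡⇒≋ (lem j (+ 2 * + suc l * sgn e * w i) (sgn e * w i))) c))
      where lem : ∀ j x y → j + x + y ≡ j + y + x
            lem = solve-∀

    edge⇒layer : ∀ {u u'} → EdgeOf Γ C u u' → LayerEdge i u u' ⊎ LayerEdge i u' u
    edge⇒layer {u} {u'} (x , d) = let (y , e , e') = index x in [ (λ { (refl , refl) → go y e e' (parity y) }) , (λ { (refl , refl) → Sum.swap (go y e e' (parity y)) }) ]′ d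
      where
      lem : ∀ j l e w → j + + 2 * l * e * w + e * w ≡ j + + 2 * (+ 1 + l) * e * w + - e * w
      lem = solve-∀
      go : ∀ y → v x ≡ v (s ℕ.+ y) → v (suc x) ≡ v (suc (s ℕ.+ y)) → (∃ λ l → y ≡ l ℕ.* 2) ⊎ (∃ λ l → y ≡ suc (l ℕ.* 2)) →
        LayerEdge i (v x) (v (suc x)) ⊎ LayerEdge i (v (suc x)) (v x)
      go y a b (inj₁ (l , refl)) = inj₁ (_ , e , trans a (even l) , trans b (odd l))
      go y a b (inj₂ (l , refl)) = inj₂ (_ , negate e , trans b (trans (cong v (suc-index l)) (even (suc l))) ,
        trans a (trans (cong v (ℕₚ.+-suc s (l ℕ.* 2))) (trans (odd l) (cong (U (i + + 1))
          (trans (lem j (+ l) (sgn e) (w i)) (cong (λ z → j + + 2 * + suc l * sgn e * w i + z * w i) (sym (sgn-negate e))))))))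

    -- At a tail of the cycle the arc of sign `e` is the edge that follows, and the arc of opposite
    -- sign the edge that precedes.
    layer⇒edge : ∀ {u u'} → LayerEdge i u u' → EdgeOf Γ C u u' × EdgeOf Γ C u' u
    layer⇒edge (y , f , refl , refl) = let (l , c) = solve-step i e j y in go l c (same e f)
      where
      same : ∀ e f → sgn f ≡ sgn e ⊎ sgn f ≡ - sgn e
      same Fin.zero Fin.zero = inj₁ refl
      same Fin.zero (Fin.suc Fin.zero) = inj₂ refl
      same (Fin.suc Fin.zero) Fin.zero = inj₂ refl
      same (Fin.suc Fin.zero) (Fin.suc Fin.zero) = inj₁ refl
      lem : ∀ j l e w y → j + + 2 * l * e * w + e * w - (y + - e * w) ≡ + 1 * (j + + 2 * (+ 1 + l) * e * w - y)
      lem = solve-∀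
      go : ∀ l → Cong r (j + + 2 * + suc l * sgn e * w i) y → sgn f ≡ sgn e ⊎ sgn f ≡ - sgn e →
        EdgeOf Γ C (U i y) (U (i + + 1) (y + sgn f * w i)) × EdgeOf Γ C (U (i + + 1) (y + sgn f * w i)) (U i y)
      go l c (inj₁ p) = (x , inj₁ (a , b)) , (x , inj₂ (a , b))
        where
        x = s ℕ.+ suc l ℕ.* 2
        a : v x ≡ U i y
        a = trans (even (suc l)) (U-≋ ≋-refl c)
        b : v (suc x) ≡ U (i + + 1) (y + sgn f * w i)
        b = trans (odd (suc l)) (U-≋ ≋-refl (+-≋ c (≡⇒≋ (cong (_* w i) (sym p)))))
      go l c (inj₂ p) = (x , inj₂ (b , a)) , (x , inj₁ (b , a))
        where
        x = suc (s ℕ.+ l ℕ.* 2)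
        a : v (suc x) ≡ U i y
        a = trans (cong v (sym (trans (ℕₚ.+-suc s (suc (l ℕ.* 2))) (cong suc (ℕₚ.+-suc s (l ℕ.* 2)))))) (trans (even (suc l)) (U-≋ ≋-refl c))
        b : v x ≡ U (i + + 1) (y + sgn f * w i)
        b = trans (odd l) (U-≋ ≋-refl (≋-trans (lin₁ (+ 1) c (lem j (+ l) (sgn e) (w i) y)) (≡⇒≋ (cong (λ z → y + z * w i) (sym p)))))

    -- The two lengths divide each other: `r` double steps return to the start, and conversely going
    -- once around is an even number of steps, as a head is no tail, and its half is a multiple of
    -- `r`.
    length≡2r : k ≡ 2 ℕ.* r
    length≡2r = ℕD.∣-antisym k∣2r (2r∣k (parity k))
      where
      2e≋ : ∀ l → Cong r (+ l) (+ 0) → U i (j + + 2 * + l * sgn e * w i) ≡ U i (j + + 2 * + 0 * sgn e * w i)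
      2e≋ l c = U-≋ ≋-refl (+-≋ (≋-refl {x = j}) (*-≋ (*-≋ (*-≋ (≋-refl {x = + 2}) c) (≋-refl {x = sgn e})) (≋-refl {x = w i})))
      k∣2r : k ℕD.∣ 2 ℕ.* r
      k∣2r = subst (k ℕD.∣_) (ℕₚ.*-comm r 2) (≋0⇒∣ (lin₁ (+ 1)
        (vtx-inj C {s ℕ.+ r ℕ.* 2} {s ℕ.+ 0} (trans (even r) (trans (2e≋ r r≋0) (sym (even 0)))))
        (trans (lem (+ s) (+ (r ℕ.* 2))) (cong₂ (λ a b → + 1 * (a - b)) (sym (ℤₚ.pos-+ s (r ℕ.* 2))) (sym (ℤₚ.pos-+ s 0))))))
        where lem : ∀ s r → r - + 0 ≡ + 1 * (s + r - (s + + 0))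
              lem = solve-∀
      closes : v (s ℕ.+ k) ≡ v (s ℕ.+ 0)
      closes = trans (periodic C s) (cong v (sym (ℕₚ.+-identityʳ s)))
      2r∣k : (∃ λ l → k ≡ l ℕ.* 2) ⊎ (∃ λ l → k ≡ suc (l ℕ.* 2)) → 2 ℕ.* r ℕD.∣ k
      2r∣k (inj₁ (l , eq)) = subst (2 ℕ.* r ℕD.∣_) (trans (ℕₚ.*-comm 2 l) (sym eq)) (ℕD.*-monoʳ-∣ 2 (≋0⇒∣ zero-l))
        where
        c : Cong r (j + + 2 * + l * sgn e * w i) (j + + 2 * + 0 * sgn e * w i)
        c = proj₂ (U-inj (trans (sym (even l)) (trans (cong (λ z → v (s ℕ.+ z)) (sym eq)) (trans closes (even 0)))))
        lem : ∀ j l s w v h → l - + 0 ≡ s * v * h * (j + + 2 * l * s * w - (j + + 2 * + 0 * s * w)) + - (+ 2 * l * h * (s * s)) * (v * w - + 1) + - l * (+ 2 * h * (s * s) - + 1)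
        lem = solve-∀
        lem₂ : ∀ h s → + 2 * h * (s * s) - + 1 ≡ s * s * (+ 2 * h - + 1) + + 1 * (s * s - + 1)
        lem₂ = solve-∀
        zero-l : Cong r (+ l) (+ 0)
        zero-l = lin₃ (sgn e * w (- i) * h) (- (+ 2 * + l * h * (sgn e * sgn e))) (- + l) c (w⁻¹ i)
          (lin₂ {x = + 2 * h * (sgn e * sgn e)} {y = + 1} (sgn e * sgn e) (+ 1) 2h≋1 (≡⇒≋ (sgn²≡1 e)) (lem₂ h (sgn e)))
          (lem j (+ l) (sgn e) (w i) (w (- i)) h)
      2r∣k (inj₂ (l , eq)) = ⊥-elim (1≢0 (lin₁ (+ 1) (proj₁ (U-inj (trans (sym (odd l))
          (trans (cong v (sym (trans (cong (s ℕ.+_) eq) (ℕₚ.+-suc s (l ℕ.* 2))))) (trans closes (even 0)))))) (lem i)))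
        where
        lem : ∀ i → + 1 - + 0 ≡ + 1 * (i + + 1 - i)
        lem = solve-∀
        1≢0 : ¬ Cong m (+ 1) (+ 0)
        1≢0 c with ≋-small (ℕₚ.≤-trans (s≤s (s≤s z≤n)) 3≤m) 0<m c
        ... | ()

  layer : ∀ i → Σ (Sub.Subset (Graph.n Γ)) λ S → (∀ v → (v Sub.∈ S) ⇔ OnLayer i v) × Sub.∣ S ∣ ≡ r
  layer i = S , (λ v → mk⇔ (in⇒ v) (in⇐ v)) , trans (sym (length-elements S)) (trans
      (unique-length (elements-unique S) (Uniqueₚ.map⁺ (λ {x} {y} e → ≋-Fin (proj₂ (U-inj e))) (Uniqueₚ.allFin⁺ r)) sub₁ sub₂)
      (trans (Listₚ.length-map at (List.allFin r)) (Listₚ.length-tabulate {n = r} (λ k → k))))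
    where
    lay : V Γ → ℤ
    lay v = proj₁ (U-onto v)
    S : Sub.Subset (Graph.n Γ)
    S = Vec.tabulate (λ v → does (≋? {m} (lay v) i))
    in⇒ : ∀ v → v Sub.∈ S → OnLayer i v
    in⇒ v p = _ , trans (proj₂ (proj₂ (U-onto v))) (U-≋ (witness (≋? {m} (lay v) i)
      (trans (sym (Vecₚ.lookup∘tabulate (λ v → does (≋? {m} (lay v) i)) v)) (Vecₚ.[]=⇒lookup p))) ≋-refl)
      where
      witness : ∀ {A : Set} (d : Dec A) → does d ≡ true → A
      witness (yes a) _ = a
    in⇐ : ∀ v → OnLayer i v → v Sub.∈ S
    in⇐ v (j , e) = Vecₚ.lookup⇒[]= v S (trans (Vecₚ.lookup∘tabulate _ v)
      (dec-true (≋? {m} (lay v) i) (proj₁ (U-inj (trans (sym (proj₂ (proj₂ (U-onto v)))) e)))))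
    at : Fin r → V Γ
    at x = U i (+ toℕ x)
    sub₁ : ∀ {v} → v ∈ elements S → v ∈ List.map at (List.allFin r)
    sub₁ {v} p = let (j , e) = in⇒ v (∈-elements⁻ S p) ; (c , h) = ≋-residue 0<r j in
      subst (_∈ List.map at (List.allFin r)) (trans (U-≋ ≋-refl (≋-sym h)) (sym e)) (∈ₚ.∈-map⁺ at (∈ₚ.∈-allFin c))
    sub₂ : ∀ {v} → v ∈ List.map at (List.allFin r) → v ∈ elements S
    sub₂ {v} p = let (c , _ , e) = ∈ₚ.∈-map⁻ at p in ∈-elements⁺ S (in⇐ v (+ toℕ c , e))

  module _ {k k'} {C : Cycle Γ k} {C' : Cycle Γ k'} (S : Shape C) (S' : Shape C')
    (¬same : ¬ SameCycle Γ C C') {x : V Γ} (x∈ : OnCycle Γ C x) (x∈' : OnCycle Γ C' x) where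

    private
     i = Shape.i S
     i' = Shape.i S'
     i≢i' : ¬ Cong m i i'
     i≢i' c = ¬same λ u v → mk⇔ (transfer S S' c) (transfer S' S (≋-sym c))
       where
       transfer : ∀ {k k'} {C : Cycle Γ k} {C' : Cycle Γ k'} (S : Shape C) (S' : Shape C') → Cong m (Shape.i S) (Shape.i S') →
         ∀ {u v} → EdgeOf Γ C u v → EdgeOf Γ C' u v
       transfer S S' c d = [ (λ l → proj₁ (layer⇒edge S' (LayerEdge-≋ c l))) , (λ l → proj₂ (layer⇒edge S' (LayerEdge-≋ c l))) ]′ (edge⇒layer S d)
     OnLayer-≋ : ∀ {i i' v} → OnLayer i v → OnLayer i' v → Cong m i i'
     OnLayer-≋ (_ , e) (_ , e') = proj₁ (U-inj (trans (sym e) e'))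
     OnLayer-cong : ∀ {i i' v} → Cong m i i' → OnLayer i v → OnLayer i' v
     OnLayer-cong c (j , e) = j , trans e (U-≋ c ≋-refl)
     pred : ∀ {x y} → Cong m (x + + 1) (y + + 1) → Cong m x y
     pred {x} {y} c = lin₁ (+ 1) c (lem x y)
       where lem : ∀ x y → x - y ≡ + 1 * (x + + 1 - (y + + 1))
             lem = solve-∀
     apart : ∀ {x y} → Cong m x (y + + 1) → Cong m y (x + + 1) → ⊥
     apart {x} {y} c c' = 3≤⇒2≢0 3≤m (lin₂ (- (+ 1)) (- (+ 1)) c c' (lem x y))
       where lem : ∀ x y → + 2 - + 0 ≡ - (+ 1) * (x - (y + + 1)) + - (+ 1) * (y - (x + + 1))
             lem = solve-∀
     meet : Cong m i (i' + + 1) ⊎ Cong m i' (i + + 1)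
     meet with onLayers S x∈ | onLayers S' x∈'
     ... | inj₁ p | inj₁ p' = ⊥-elim (i≢i' (OnLayer-≋ p p'))
     ... | inj₁ p | inj₂ p' = inj₁ (OnLayer-≋ p p')
     ... | inj₂ p | inj₁ p' = inj₂ (≋-sym (OnLayer-≋ p p'))
     ... | inj₂ p | inj₂ p' = ⊥-elim (i≢i' (pred (OnLayer-≋ p p')))
     Result : Set
     Result = Σ (Sub.Subset (Graph.n Γ)) λ S → (∀ v → (v Sub.∈ S) ⇔ (OnCycle Γ C v × OnCycle Γ C' v)) × 2 ℕ.* Sub.∣ S ∣ ≡ k
     both₁ : Cong m i (i' + + 1) → ∀ v → OnLayer i v ⇔ (OnCycle Γ C v × OnCycle Γ C' v)
     both₁ c v = mk⇔ (λ p → onLayers⁻¹ S (inj₁ p) , onLayers⁻¹ S' (inj₂ (OnLayer-cong c p))) back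
       where
       back : OnCycle Γ C v × OnCycle Γ C' v → OnLayer i v
       back (p , p') with onLayers S p | onLayers S' p'
       ... | inj₁ z | _      = z
       ... | inj₂ z | inj₁ y = ⊥-elim (apart c (≋-sym (OnLayer-≋ z y)))
       ... | inj₂ z | inj₂ y = ⊥-elim (i≢i' (pred (OnLayer-≋ z y)))
     both₂ : Cong m i' (i + + 1) → ∀ v → OnLayer i' v ⇔ (OnCycle Γ C v × OnCycle Γ C' v)
     both₂ c v = mk⇔ (λ p → onLayers⁻¹ S (inj₂ (OnLayer-cong c p)) , onLayers⁻¹ S' (inj₁ p)) back
       where
       back : OnCycle Γ C v × OnCycle Γ C' v → OnLayer i' v
       back (p , p') with onLayers S' p' | onLayers S p
       ... | inj₁ z | _      = z
       ... | inj₂ z | inj₁ y = ⊥-elim (apart c (≋-sym (OnLayer-≋ z y)))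
       ... | inj₂ z | inj₂ y = ⊥-elim (i≢i' (≋-sym (pred (OnLayer-≋ z y))))
     finish : ∀ l → (∀ v → OnLayer l v ⇔ (OnCycle Γ C v × OnCycle Γ C' v)) → Result
     finish l eqv = let (L , mem , card) = layer l in L ,
       (λ v → mk⇔ (Equivalence.to (eqv v) ∘ Equivalence.to (mem v)) (Equivalence.from (mem v) ∘ Equivalence.from (eqv v))) ,
       trans (cong (2 ℕ.*_) card) (sym (length≡2r S))

    -- Alternating cycles on the same pair of layers have the same edges. Two different ones with a
    -- common vertex thus lie on adjacent pairs, which for `m` ≥ 3 overlap in one layer, that is in
    -- `r` vertices.
    share-layer : Σ (Sub.Subset (Graph.n Γ)) λ L → (∀ v → (v Sub.∈ L) ⇔ (OnCycle Γ C v × OnCycle Γ C' v)) × 2 ℕ.* Sub.∣ L ∣ ≡ k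
    share-layer = [ (λ c → finish i (both₁ c)) , (λ c → finish i' (both₂ c)) ]′ meet

  tightly-attached : TightlyAttached Γ (Aut Γ)
  tightly-attached a b ab C C' alt alt' ¬same (x , x∈ , x∈') =
    share-layer (shape C (Alternating⇒F ab C alt)) (shape C' (Alternating⇒F ab C' alt')) ¬same x∈ x∈'

-- The Doyle-Holt graph

-- The vertex (i , j) of X_o(3,9;4) is coded by the number 9 i + j.
weight : ℕ → ℤ
weight 0 = + 1
weight 1 = + 4
weight 2 = + 7
weight (suc (suc (suc i))) = weight i

StepC : ℕ → ℕ → Set
StepC c d = Cong 3 (+ (d ℕM./ 9)) (+ (c ℕM./ 9) + + 1) ×
  (Cong 9 (+ (d ℕM.% 9)) (+ (c ℕM.% 9) + + 1 * weight (c ℕM./ 9)) ⊎ Cong 9 (+ (d ℕM.% 9)) (+ (c ℕM.% 9) + - (+ 1) * weight (c ℕM./ 9)))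

AdjC : ℕ → ℕ → Set
AdjC c d = StepC c d ⊎ StepC d c

step? : ∀ c d → Dec (StepC c d)
step? c d = ≋? _ _ ×-dec (≋? _ _ ⊎-dec ≋? _ _)

AdjC? : ∀ c d → Dec (AdjC c d)
AdjC? c d = step? c d ⊎-dec step? d c

consistent : ℕ → ℕ → List (ℕ × ℕ) → Bool
consistent c d [] = true
consistent c d ((c' , d') ∷ asg) = does (does (AdjC? c c') Bool.≟ does (AdjC? d d')) ∧ consistent c d asg

-- A backtracking search: each listed vertex is tried on all 27 vertices, and both adjacency and
-- non-adjacency to the vertices already assigned must be kept.
extends : List ℕ → List (ℕ × ℕ) → Bool
extends []       asg = true
extends (c ∷ cs) asg = any (λ d → consistent c d asg ∧ extends cs ((c , d) ∷ asg)) (upTo 27)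

-- The other neighbours 17, 20, 25 of 0 and the neighbour 2 of 10 come first. Each further vertex is
-- adjacent to two earlier ones, which keeps the search narrow: 22 to 17 and 2, 12 to 25 and 2, 4 to
-- 20 and 12, 24 to 10 and 4.
ball : List ℕ
ball = 17 ∷ 20 ∷ 25 ∷ 2 ∷ 22 ∷ 12 ∷ 4 ∷ 24 ∷ []

-- The codes 0 and 10 stand for (0 , 0) and (1 , 1), the ends of an arc whose reversal is to be
-- refuted.
flipped : List (ℕ × ℕ)
flipped = (10 , 0) ∷ (0 , 10) ∷ []

extends-flipped : extends ball flipped ≡ false
extends-flipped = refl

module _ (f : ℕ → ℕ) (f<27 : ∀ c → f c < 27) (f-adj : ∀ c d → AdjC c d ⇔ AdjC (f c) (f d)) where

  private
    does-⇔ : ∀ {A B : Set} (a? : Dec A) (b? : Dec B) → A ⇔ B → does a? ≡ does b?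
    does-⇔ (yes a) (yes b) h = refl
    does-⇔ (yes a) (no ¬b) h = ⊥-elim (¬b (Equivalence.to h a))
    does-⇔ (no ¬a) (yes b) h = ⊥-elim (¬a (Equivalence.from h b))
    does-⇔ (no ¬a) (no ¬b) h = refl

    consistent-sound : ∀ c asg → All (λ x → f (proj₁ x) ≡ proj₂ x) asg → Bool.T (consistent c (f c) asg)
    consistent-sound c [] [] = _
    consistent-sound c ((c' , _) ∷ asg) (refl ∷ h) = Equivalence.from Boolₚ.T-∧
      (subst Bool.T (sym (Dec.dec-true (_ Bool.≟ _) (does-⇔ (AdjC? c c') (AdjC? (f c) (f c')) (f-adj c c')))) _ , consistent-sound c asg h)

  extends-sound : ∀ cs asg → All (λ x → f (proj₁ x) ≡ proj₂ x) asg → Bool.T (extends cs asg)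
  extends-sound [] asg h = _
  extends-sound (c ∷ cs) asg h = Anyₚ.any⁺ (λ d → consistent c d asg ∧ extends cs ((c , d) ∷ asg)) (Any.map (λ { refl → Equivalence.from Boolₚ.T-∧
    (consistent-sound c asg h , extends-sound cs ((c , f c) ∷ asg) (refl ∷ h)) }) (∈ₚ.∈-upTo⁺ (f<27 c)))

  no-flip : f 10 ≡ 0 → f 0 ≡ 10 → ⊥
  no-flip e e' = contra (trans (sym (extends-true ball flipped (e ∷ e' ∷ []))) extends-flipped)
    where
    -- Stated with ≡ so that the search is not run again when types are compared.
    extends-true : ∀ cs asg → All (λ x → f (proj₁ x) ≡ proj₂ x) asg → extends cs asg ≡ true
    extends-true cs asg h = Equivalence.to Boolₚ.T-≡ (extends-sound cs asg h)
    contra : true ≢ false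
    contra ()

module DoyleHolt {Γ : Graph} (P : Pres Γ 3 9 (+ 4)) where
  open Pres P
  open Affine P (s≤s z≤n)

  private
    _∼_ = _~_ Γ

    w-weight : ∀ i → Cong 9 (w (+ i)) (weight i)
    w-weight 0 = w-0
    w-weight 1 = ≋-trans (w-suc (+ 0)) (*-≋ {x = + 4} ≋-refl w-0)
    w-weight 2 = ≋-trans (w-suc (+ 1)) (≋-trans (*-≋ {x = + 4} ≋-refl (w-weight 1)) (by (+ 1) refl))
    w-weight (suc (suc (suc i))) = ≋-trans (w-≋ (by (+ 1) (ℤₚ.+-comm (+ 3) (+ i)))) (w-weight i)

    dec : ℕ → V Γ
    dec c = U (+ (c ℕM./ 9)) (+ (c ℕM.% 9))

    dec-step : ∀ c d → StepC c d → F (dec c) (dec d)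
    dec-step c d (l , k) = [ go Fin.zero , go (Fin.suc Fin.zero) ]′ k
      where
      go : ∀ e → Cong 9 (+ (d ℕM.% 9)) (+ (c ℕM.% 9) + sgn e * weight (c ℕM./ 9)) → F (dec c) (dec d)
      go e k = + (c ℕM./ 9) , + (c ℕM.% 9) , e , refl ,
        U-≋ l (≋-trans k (+-≋ (≋-refl {x = + (c ℕM.% 9)}) (*-≋ (≋-refl {x = sgn e}) (≋-sym (w-weight (c ℕM./ 9))))))

    step-dec : ∀ c d → Step (+ (c ℕM./ 9)) (+ (c ℕM.% 9)) (+ (d ℕM./ 9)) (+ (d ℕM.% 9)) → StepC c d
    step-dec c d (l , e , k) = l , go e (≋-trans k (+-≋ (≋-refl {x = + (c ℕM.% 9)}) (*-≋ (≋-refl {x = sgn e}) (w-weight (c ℕM./ 9)))))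
      where
      go : ∀ e → Cong 9 (+ (d ℕM.% 9)) (+ (c ℕM.% 9) + sgn e * weight (c ℕM./ 9)) → _ ⊎ _
      go Fin.zero k = inj₁ k
      go (Fin.suc Fin.zero) k = inj₂ k

    dec-adj : ∀ c d → AdjC c d ⇔ (dec c ∼ dec d)
    dec-adj c d = mk⇔ [ F⇒∼ ∘ dec-step c d , ∼-sym ∘ F⇒∼ ∘ dec-step d c ]′ (λ h → Sum.map (step-dec c d) (step-dec d c) (adj⁻ h))

    code : Fin 3 → Fin 9 → ℕ
    code a b = toℕ b ℕ.+ toℕ a ℕ.* 9

    code-props : ∀ a b → code a b < 27 × code a b ℕM./ 9 ≡ toℕ a × code a b ℕM.% 9 ≡ toℕ b
    code-props = Dec.toWitness {a? = Finₚ.all? λ a → Finₚ.all? λ b →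
      (code a b ℕ.<? 27) ×-dec ((code a b ℕM./ 9 ℕ.≟ toℕ a) ×-dec (code a b ℕM.% 9 ℕ.≟ toℕ b))} _

    enc : V Γ → ℕ
    enc v = let (i , j , _) = U-onto v in code (proj₁ (≋-residue {3} (s≤s z≤n) i)) (proj₁ (≋-residue {9} (s≤s z≤n) j))

    enc<27 : ∀ v → enc v < 27
    enc<27 v = let (i , j , _) = U-onto v in proj₁ (code-props (proj₁ (≋-residue {3} (s≤s z≤n) i)) (proj₁ (≋-residue {9} (s≤s z≤n) j)))

    dec-enc : ∀ v → dec (enc v) ≡ v
    dec-enc v = let (i , j , e) = U-onto v
                    (a , h) = ≋-residue {3} (s≤s z≤n) i ; (b , k) = ≋-residue {9} (s≤s z≤n) j
                    (_ , p , p') = code-props a b in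
      trans (cong₂ (λ x y → U (+ x) (+ y)) p p') (trans (U-≋ (≋-sym h) (≋-sym k)) (sym e))

    enc-dec : ∀ c → c < 27 → enc (dec c) ≡ c
    enc-dec c c<27 = let (h , k) = U-inj (dec-enc (dec c)) ; x = enc (dec c) in
      trans (ℕM.m≡m%n+[m/n]*n x 9) (trans (cong₂ (λ a b → a ℕ.+ b ℕ.* 9)
        (≋-small (ℕM.m%n<n x 9) (ℕM.m%n<n c 9) k) (≋-small (ℕM.m<n*o⇒m/o<n {x} {3} (enc<27 (dec c))) (ℕM.m<n*o⇒m/o<n {c} {3} c<27) h))
        (sym (ℕM.m≡m%n+[m/n]*n c 9)))

    refute : (act : V Γ → V Γ) → (∀ x y → (x ∼ y) ⇔ (act x ∼ act y)) → act (dec 10) ≡ dec 0 → act (dec 0) ≡ dec 10 → ⊥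
    refute act act-adj e₁ e₀ = no-flip φ (λ c → enc<27 (act (dec c))) φ-adj
        (trans (cong enc e₁) (enc-dec 0 (s≤s z≤n))) (trans (cong enc e₀) (enc-dec 10 (ℕₚ.m≤m+n 11 16)))
      where
      φ : ℕ → ℕ
      φ c = enc (act (dec c))
      φ-adj : ∀ c d → AdjC c d ⇔ AdjC (φ c) (φ d)
      φ-adj c d = mk⇔
        (λ h → Equivalence.from (dec-adj (φ c) (φ d)) (subst₂ _∼_ (sym (dec-enc (act (dec c)))) (sym (dec-enc (act (dec d))))
          (Equivalence.to (act-adj (dec c) (dec d)) (Equivalence.to (dec-adj c d) h))))
        (λ h → Equivalence.from (dec-adj c d) (Equivalence.from (act-adj (dec c) (dec d))
          (subst₂ _∼_ (dec-enc (act (dec c))) (dec-enc (act (dec d))) (Equivalence.to (dec-adj (φ c) (φ d)) h))))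

  key : ∀ α → IsAut Γ α → ∀ {u v} → F u v → F (α ⟨$⟩ʳ u) (α ⟨$⟩ʳ v)
  key α mα {u} {v} f = [ (λ f' → f') , (λ f' → ⊥-elim (flip f')) ]′ (∼⇒F (Equivalence.to (mα u v) (F⇒∼ f)))
    where
    arc : F (dec 0) (dec 10)
    arc = + 0 , + 0 , Fin.zero , refl , U-≋ ≋-refl (≋-sym (≋-trans (+-≋ (≋-refl {x = + 0}) (*-≋ (≋-refl {x = + 1}) w-0)) ≋-refl))
    flip : F (α ⟨$⟩ʳ v) (α ⟨$⟩ʳ u) → ⊥
    -- Affine maps move any arc to any other, so the reversed arc may be taken to be the one from
    -- `dec 0` to `dec 10`.
    flip f' = let (β , mβ , e₀ , e₁) = F-transitive arc f ; (γ , mγ , e₂ , e₃) = F-transitive f' arc in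
      refute (λ x → γ ⟨$⟩ʳ (α ⟨$⟩ʳ (β ⟨$⟩ʳ x)))
        (λ x y → mk⇔ (Equivalence.to (mγ _ _) ∘ Equivalence.to (mα _ _) ∘ Equivalence.to (mβ x y))
                     (Equivalence.from (mβ x y) ∘ Equivalence.from (mα _ _) ∘ Equivalence.from (mγ _ _)))
        (trans (cong (λ z → γ ⟨$⟩ʳ (α ⟨$⟩ʳ z)) e₁) e₂) (trans (cong (λ z → γ ⟨$⟩ʳ (α ⟨$⟩ʳ z)) e₀) e₃)

  private
    -- Four steps up and one down, a total of three layers; at the code 17 two arcs point to the
    -- same vertex.
    pent : ℕ → ℕ
    pent 0 = 0
    pent 1 = 10
    pent 2 = 23
    pent 3 = 7
    pent 4 = 17
    pent (suc (suc (suc (suc (suc i))))) = pent i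

    pent-props : ∀ i j → pent (toℕ i) < 27 × (pent (toℕ {5} i) ≡ pent (toℕ {5} j) → toℕ i ≡ toℕ j)
    pent-props = Dec.toWitness {a? = Finₚ.all? λ i → Finₚ.all? λ j →
      (pent (toℕ i) ℕ.<? 27) ×-dec ((pent (toℕ i) ℕ.≟ pent (toℕ j)) →-dec (toℕ i ℕ.≟ toℕ j))} _

  pentagon : Cycle Γ 5
  pentagon = record { len≥3 = s≤s (s≤s (s≤s z≤n)) ; vtx = dec ∘ pent ; periodic = λ i → cong (dec ∘ pent) (ℕₚ.+-comm i 5)
                    ; distinct = dist ; edges = edge }
    where
    below : ∀ {i} (i<5 : i < 5) → pent i < 27
    below i<5 = subst (λ z → pent z < 27) (Finₚ.toℕ-fromℕ< i<5) (proj₁ (pent-props (Fin.fromℕ< i<5) Fin.zero))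
    dist : ∀ i j → i < 5 → j < 5 → dec (pent i) ≡ dec (pent j) → i ≡ j
    dist i j i<5 j<5 e = subst₂ (λ x y → pent x ≡ pent y → x ≡ y) (Finₚ.toℕ-fromℕ< i<5) (Finₚ.toℕ-fromℕ< j<5)
      (proj₂ (pent-props (Fin.fromℕ< i<5) (Fin.fromℕ< j<5)))
      (trans (sym (enc-dec (pent i) (below i<5))) (trans (cong enc e) (enc-dec (pent j) (below j<5))))
    edge : ∀ i → dec (pent i) ∼ dec (pent (suc i))
    edge 0 = Equivalence.to (dec-adj 0 10) (Dec.from-yes (AdjC? 0 10))
    edge 1 = Equivalence.to (dec-adj 10 23) (Dec.from-yes (AdjC? 10 23))
    edge 2 = Equivalence.to (dec-adj 23 7) (Dec.from-yes (AdjC? 23 7))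
    edge 3 = Equivalence.to (dec-adj 7 17) (Dec.from-yes (AdjC? 7 17))
    edge 4 = Equivalence.to (dec-adj 17 0) (Dec.from-yes (AdjC? 17 0))
    edge (suc (suc (suc (suc (suc i))))) = edge i

  pentagon-arcs : F (vtx pentagon 3) (vtx pentagon 4) × F (vtx pentagon 5) (vtx pentagon 4)
  pentagon-arcs = dec-step 7 17 (Dec.from-yes (step? 7 17)) , dec-step 0 17 (Dec.from-yes (step? 0 17))

-- Automorphisms of X_o(5,r;q)

bit : Fin 2 → ℤ
bit Fin.zero = + 0
bit (Fin.suc _) = + 1

module _ {r : ℕ} {q : ℤ} (q⁵≋1 : Cong r (q * q * q * q * q) (+ 1)) where

  -- A nonempty proper subset sum of the powers of a primitive fifth root of unity is a unit of ℤ[ζ₅];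
  -- the coefficients below are the inverses.
  subset-sum : ∀ d₁ d₂ d₃ d₄ →
    Cong r ((q - + 1) * (bit d₁ * q + bit d₂ * (q * q) + bit d₃ * (q * q * q) + bit d₄ * (q * q * q * q))) (+ 0) →
    (d₁ ≡ Fin.zero × d₂ ≡ Fin.zero × d₃ ≡ Fin.zero × d₄ ≡ Fin.zero) ⊎ Cong r q (+ 1)
  subset-sum Fin.zero Fin.zero Fin.zero Fin.zero _ = inj₁ (refl , refl , refl , refl)
  subset-sum Fin.zero Fin.zero Fin.zero (Fin.suc Fin.zero) c = inj₂ (lin₂ (+ 0 + q * (+ 1)) (+ 1 + q * (- (+ 1))) c q⁵≋1 (lem q))
    where lem : ∀ q → q - + 1 ≡ (+ 0 + q * (+ 1)) * ((q - + 1) * (+ 0 * q + + 0 * (q * q) + + 0 * (q * q * q) + + 1 * (q * q * q * q)) - + 0) + (+ 1 + q * (- (+ 1))) * (q * q * q * q * q - + 1)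
          lem = solve-∀
  subset-sum Fin.zero Fin.zero (Fin.suc Fin.zero) Fin.zero c = inj₂ (lin₂ (+ 0 + q * (+ 0 + q * (+ 1))) (+ 1 + q * (- (+ 1))) c q⁵≋1 (lem q))
    where lem : ∀ q → q - + 1 ≡ (+ 0 + q * (+ 0 + q * (+ 1))) * ((q - + 1) * (+ 0 * q + + 0 * (q * q) + + 1 * (q * q * q) + + 0 * (q * q * q * q)) - + 0) + (+ 1 + q * (- (+ 1))) * (q * q * q * q * q - + 1)
          lem = solve-∀
  subset-sum Fin.zero Fin.zero (Fin.suc Fin.zero) (Fin.suc Fin.zero) c = inj₂ (lin₂ (- (+ 1) + q * (+ 0 + q * (+ 0 + q * (- (+ 1))))) (+ 1 + q * (- (+ 1) + q * (+ 0 + q * (+ 1)))) c q⁵≋1 (lem q))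
    where lem : ∀ q → q - + 1 ≡ (- (+ 1) + q * (+ 0 + q * (+ 0 + q * (- (+ 1))))) * ((q - + 1) * (+ 0 * q + + 0 * (q * q) + + 1 * (q * q * q) + + 1 * (q * q * q * q)) - + 0) + (+ 1 + q * (- (+ 1) + q * (+ 0 + q * (+ 1)))) * (q * q * q * q * q - + 1)
          lem = solve-∀
  subset-sum Fin.zero (Fin.suc Fin.zero) Fin.zero Fin.zero c = inj₂ (lin₂ (+ 0 + q * (+ 0 + q * (+ 0 + q * (+ 1)))) (+ 1 + q * (- (+ 1))) c q⁵≋1 (lem q))
    where lem : ∀ q → q - + 1 ≡ (+ 0 + q * (+ 0 + q * (+ 0 + q * (+ 1)))) * ((q - + 1) * (+ 0 * q + + 1 * (q * q) + + 0 * (q * q * q) + + 0 * (q * q * q * q)) - + 0) + (+ 1 + q * (- (+ 1))) * (q * q * q * q * q - + 1)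
          lem = solve-∀
  subset-sum Fin.zero (Fin.suc Fin.zero) Fin.zero (Fin.suc Fin.zero) c = inj₂ (lin₂ (+ 0 + q * (+ 1 + q * (+ 1 + q * (+ 1)))) (+ 1 + q * (- (+ 1) + q * (+ 0 + q * (- (+ 1))))) c q⁵≋1 (lem q))
    where lem : ∀ q → q - + 1 ≡ (+ 0 + q * (+ 1 + q * (+ 1 + q * (+ 1)))) * ((q - + 1) * (+ 0 * q + + 1 * (q * q) + + 0 * (q * q * q) + + 1 * (q * q * q * q)) - + 0) + (+ 1 + q * (- (+ 1) + q * (+ 0 + q * (- (+ 1))))) * (q * q * q * q * q - + 1)
          lem = solve-∀
  subset-sum Fin.zero (Fin.suc Fin.zero) (Fin.suc Fin.zero) Fin.zero c = inj₂ (lin₂ (+ 1 + q * (+ 0 + q * (+ 1 + q * (+ 1)))) (+ 1 + q * (- (+ 1) + q * (- (+ 1)))) c q⁵≋1 (lem q))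
    where lem : ∀ q → q - + 1 ≡ (+ 1 + q * (+ 0 + q * (+ 1 + q * (+ 1)))) * ((q - + 1) * (+ 0 * q + + 1 * (q * q) + + 1 * (q * q * q) + + 0 * (q * q * q * q)) - + 0) + (+ 1 + q * (- (+ 1) + q * (- (+ 1)))) * (q * q * q * q * q - + 1)
          lem = solve-∀
  subset-sum Fin.zero (Fin.suc Fin.zero) (Fin.suc Fin.zero) (Fin.suc Fin.zero) c = inj₂ (lin₂ (+ 0 + q * (+ 1 + q * (+ 0 + q * (+ 1)))) (+ 1 + q * (- (+ 1) + q * (+ 0 + q * (- (+ 1))))) c q⁵≋1 (lem q))
    where lem : ∀ q → q - + 1 ≡ (+ 0 + q * (+ 1 + q * (+ 0 + q * (+ 1)))) * ((q - + 1) * (+ 0 * q + + 1 * (q * q) + + 1 * (q * q * q) + + 1 * (q * q * q * q)) - + 0) + (+ 1 + q * (- (+ 1) + q * (+ 0 + q * (- (+ 1))))) * (q * q * q * q * q - + 1)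
          lem = solve-∀
  subset-sum (Fin.suc Fin.zero) Fin.zero Fin.zero Fin.zero c = inj₂ (lin₂ (- (+ 1) + q * (- (+ 1) + q * (- (+ 1) + q * (- (+ 1))))) (+ 1) c q⁵≋1 (lem q))
    where lem : ∀ q → q - + 1 ≡ (- (+ 1) + q * (- (+ 1) + q * (- (+ 1) + q * (- (+ 1))))) * ((q - + 1) * (+ 1 * q + + 0 * (q * q) + + 0 * (q * q * q) + + 0 * (q * q * q * q)) - + 0) + (+ 1) * (q * q * q * q * q - + 1)
          lem = solve-∀
  subset-sum (Fin.suc Fin.zero) Fin.zero Fin.zero (Fin.suc Fin.zero) c = inj₂ (lin₂ (+ 0 + q * (+ 0 + q * (- (+ 1) + q * (- (+ 1))))) (+ 1 + q * (- (+ 1) + q * (+ 0 + q * (+ 1)))) c q⁵≋1 (lem q))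
    where lem : ∀ q → q - + 1 ≡ (+ 0 + q * (+ 0 + q * (- (+ 1) + q * (- (+ 1))))) * ((q - + 1) * (+ 1 * q + + 0 * (q * q) + + 0 * (q * q * q) + + 1 * (q * q * q * q)) - + 0) + (+ 1 + q * (- (+ 1) + q * (+ 0 + q * (+ 1)))) * (q * q * q * q * q - + 1)
          lem = solve-∀
  subset-sum (Fin.suc Fin.zero) Fin.zero (Fin.suc Fin.zero) Fin.zero c = inj₂ (lin₂ (- (+ 1) + q * (- (+ 1))) (+ 1) c q⁵≋1 (lem q))
    where lem : ∀ q → q - + 1 ≡ (- (+ 1) + q * (- (+ 1))) * ((q - + 1) * (+ 1 * q + + 0 * (q * q) + + 1 * (q * q * q) + + 0 * (q * q * q * q)) - + 0) + (+ 1) * (q * q * q * q * q - + 1)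
          lem = solve-∀
  subset-sum (Fin.suc Fin.zero) Fin.zero (Fin.suc Fin.zero) (Fin.suc Fin.zero) c = inj₂ (lin₂ (+ 0 + q * (+ 1 + q * (+ 1))) (+ 1 + q * (- (+ 1) + q * (- (+ 1)))) c q⁵≋1 (lem q))
    where lem : ∀ q → q - + 1 ≡ (+ 0 + q * (+ 1 + q * (+ 1))) * ((q - + 1) * (+ 1 * q + + 0 * (q * q) + + 1 * (q * q * q) + + 1 * (q * q * q * q)) - + 0) + (+ 1 + q * (- (+ 1) + q * (- (+ 1)))) * (q * q * q * q * q - + 1)
          lem = solve-∀
  subset-sum (Fin.suc Fin.zero) (Fin.suc Fin.zero) Fin.zero Fin.zero c = inj₂ (lin₂ (- (+ 1) + q * (+ 0 + q * (- (+ 1)))) (+ 1) c q⁵≋1 (lem q))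
    where lem : ∀ q → q - + 1 ≡ (- (+ 1) + q * (+ 0 + q * (- (+ 1)))) * ((q - + 1) * (+ 1 * q + + 1 * (q * q) + + 0 * (q * q * q) + + 0 * (q * q * q * q)) - + 0) + (+ 1) * (q * q * q * q * q - + 1)
          lem = solve-∀
  subset-sum (Fin.suc Fin.zero) (Fin.suc Fin.zero) Fin.zero (Fin.suc Fin.zero) c = inj₂ (lin₂ (- (+ 1) + q * (- (+ 1) + q * (- (+ 1)))) (+ 1 + q * (+ 0 + q * (+ 1))) c q⁵≋1 (lem q))
    where lem : ∀ q → q - + 1 ≡ (- (+ 1) + q * (- (+ 1) + q * (- (+ 1)))) * ((q - + 1) * (+ 1 * q + + 1 * (q * q) + + 0 * (q * q * q) + + 1 * (q * q * q * q)) - + 0) + (+ 1 + q * (+ 0 + q * (+ 1))) * (q * q * q * q * q - + 1)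
          lem = solve-∀
  subset-sum (Fin.suc Fin.zero) (Fin.suc Fin.zero) (Fin.suc Fin.zero) Fin.zero c = inj₂ (lin₂ (- (+ 1) + q * (- (+ 1) + q * (+ 0 + q * (- (+ 1))))) (+ 1 + q * (+ 0 + q * (+ 1))) c q⁵≋1 (lem q))
    where lem : ∀ q → q - + 1 ≡ (- (+ 1) + q * (- (+ 1) + q * (+ 0 + q * (- (+ 1))))) * ((q - + 1) * (+ 1 * q + + 1 * (q * q) + + 1 * (q * q * q) + + 0 * (q * q * q * q)) - + 0) + (+ 1 + q * (+ 0 + q * (+ 1))) * (q * q * q * q * q - + 1)
          lem = solve-∀
  subset-sum (Fin.suc Fin.zero) (Fin.suc Fin.zero) (Fin.suc Fin.zero) (Fin.suc Fin.zero) c = inj₂ (lin₂ (- (+ 1)) (+ 1) c q⁵≋1 (lem q))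
    where lem : ∀ q → q - + 1 ≡ (- (+ 1)) * ((q - + 1) * (+ 1 * q + + 1 * (q * q) + + 1 * (q * q * q) + + 1 * (q * q * q * q)) - + 0) + (+ 1) * (q * q * q * q * q - + 1)
          lem = solve-∀

  -- If D is the sum of the powers whose sign differs from the first, the given sum is ± (S - 2 D)
  -- with S = 1 + q + ... + q⁴. The factor q - 1 kills S, and halving leaves the hypothesis of
  -- `subset-sum`.
  signs-equal : ∀ h → Cong r (+ 2 * h) (+ 1) → ¬ Cong r q (+ 1) → ∀ e₀ e₁ e₂ e₃ e₄ →
    Cong r (sgn e₀ + sgn e₁ * q + sgn e₂ * (q * q) + sgn e₃ * (q * q * q) + sgn e₄ * (q * q * q * q)) (+ 0) →
    e₁ ≡ e₀ × e₂ ≡ e₀ × e₃ ≡ e₀ × e₄ ≡ e₀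
  signs-equal h 2h≋1 q≢1 e₀ e₁ e₂ e₃ e₄ c =
    let (d₁ , f₁ , g₁) = diff e₀ e₁ ; (d₂ , f₂ , g₂) = diff e₀ e₂ ; (d₃ , f₃ , g₃) = diff e₀ e₃ ; (d₄ , f₄ , g₄) = diff e₀ e₄ in
    [ (λ { (z₁ , z₂ , z₃ , z₄) → g₁ z₁ , g₂ z₂ , g₃ z₃ , g₄ z₄ }) , (λ z → ⊥-elim (q≢1 z)) ]′
    (subset-sum d₁ d₂ d₃ d₄ (reduce d₁ d₂ d₃ d₄ (subst (λ s → Cong r s (+ 0))
      (cong₂ _+_ (cong₂ _+_ (cong₂ _+_ (cong (λ z → sgn e₀ + z * q) f₁) (cong (_* (q * q)) f₂)) (cong (_* (q * q * q)) f₃)) (cong (_* (q * q * q * q)) f₄)) c)))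
    where
    diff : ∀ e f → ∃ λ d → sgn f ≡ sgn e * (+ 1 - + 2 * bit d) × (d ≡ Fin.zero → f ≡ e)
    diff Fin.zero Fin.zero = Fin.zero , refl , λ _ → refl
    diff Fin.zero (Fin.suc Fin.zero) = Fin.suc Fin.zero , refl , λ ()
    diff (Fin.suc Fin.zero) Fin.zero = Fin.suc Fin.zero , refl , λ ()
    diff (Fin.suc Fin.zero) (Fin.suc Fin.zero) = Fin.zero , refl , λ _ → refl
    lem : ∀ q h s x₁ x₂ x₃ x₄ → let D = x₁ * q + x₂ * (q * q) + x₃ * (q * q * q) + x₄ * (q * q * q * q) in
      (q - + 1) * D - + 0 ≡
      - ((q - + 1) * s * h) * (s + s * (+ 1 - + 2 * x₁) * q + s * (+ 1 - + 2 * x₂) * (q * q) + s * (+ 1 - + 2 * x₃) * (q * q * q) + s * (+ 1 - + 2 * x₄) * (q * q * q * q) - + 0)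
      + (s * s * h) * (q * q * q * q * q - + 1)
      + - ((q - + 1) * D) * (+ 2 * h * (s * s) - + 1)
    lem = solve-∀
    lem₂ : ∀ h s → + 2 * h * (s * s) - + 1 ≡ s * s * (+ 2 * h - + 1) + + 1 * (s * s - + 1)
    lem₂ = solve-∀
    reduce : ∀ d₁ d₂ d₃ d₄ →
      Cong r (sgn e₀ + sgn e₀ * (+ 1 - + 2 * bit d₁) * q + sgn e₀ * (+ 1 - + 2 * bit d₂) * (q * q) + sgn e₀ * (+ 1 - + 2 * bit d₃) * (q * q * q) + sgn e₀ * (+ 1 - + 2 * bit d₄) * (q * q * q * q)) (+ 0) →
      Cong r ((q - + 1) * (bit d₁ * q + bit d₂ * (q * q) + bit d₃ * (q * q * q) + bit d₄ * (q * q * q * q))) (+ 0)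
    reduce d₁ d₂ d₃ d₄ c = lin₃ (- ((q - + 1) * sgn e₀ * h)) (sgn e₀ * sgn e₀ * h) (- ((q - + 1) * (bit d₁ * q + bit d₂ * (q * q) + bit d₃ * (q * q * q) + bit d₄ * (q * q * q * q))))
      c q⁵≋1 (lin₂ {x = + 2 * h * (sgn e₀ * sgn e₀)} {y = + 1} (sgn e₀ * sgn e₀) (+ 1) 2h≋1 (≡⇒≋ (sgn²≡1 e₀)) (lem₂ h (sgn e₀)))
      (lem q h (sgn e₀) (bit d₁) (bit d₂) (bit d₃) (bit d₄))

-- The expression is even and at most 6 in absolute value, so it must be 0. Then 2 (sgn d₁ + sgn
-- d₄), which is 0 or ± 4, equals sgn d₂ + sgn d₃, which is 0 or ± 2; both are 0.
hexagon-layers : ∀ d₁ d₂ d₃ d₄ → 5 ℕD.∣ ℤ.∣ + 2 * sgn d₁ - sgn d₂ - sgn d₃ + + 2 * sgn d₄ ∣ → sgn d₃ ≡ - sgn d₂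
hexagon-layers = Dec.toWitness {a? = Finₚ.all? λ d₁ → Finₚ.all? λ d₂ → Finₚ.all? λ d₃ → Finₚ.all? λ d₄ →
  (5 ℕD.∣? ℤ.∣ + 2 * sgn d₁ - sgn d₂ - sgn d₃ + + 2 * sgn d₄ ∣) →-dec (sgn d₃ ℤ.≟ - sgn d₂)} _

-- Relations for a fifth root of unity

module FifthRoot {r : ℕ} {q : ℤ} (3≤r : 3 ≤ r) (q≢1 : ¬ Cong r q (+ 1))
  (S≋0 : Cong r (+ 1 + q + q * q + q * q * q + q * q * q * q) (+ 0)) where

  q⁵≋1 : Cong r (q * q * q * q * q) (+ 1)
  q⁵≋1 = lin₁ (q - + 1) S≋0 (lem q)
    where lem : ∀ q → q * q * q * q * q - + 1 ≡ (q - + 1) * (+ 1 + q + q * q + q * q * q + q * q * q * q - + 0)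
          lem = solve-∀

  1≢0 : ¬ Cong r (+ 1) (+ 0)
  1≢0 h with ≋-small {r} {1} {0} (ℕₚ.≤-trans (s≤s (s≤s z≤n)) 3≤r) (ℕₚ.≤-trans (s≤s z≤n) 3≤r) h
  ... | ()

  q²≢1 : ¬ Cong r (q * q) (+ 1)
  q²≢1 h = q≢1 (lin₂ (+ 1) (- (q * (q * q + + 1))) q⁵≋1 h (lem q))
    where lem : ∀ q → q - + 1 ≡ + 1 * (q * q * q * q * q - + 1) + - (q * (q * q + + 1)) * (q * q - + 1)
          lem = solve-∀

  private
    -- The form of a hexagon relation after division by the step width of its first layer; the
    -- arguments are partial sums of 1 + q + ... + q⁴.
    Relation : ℤ → ℤ → ℤ → Set
    Relation x a c = Cong r (- (+ 2) * x + + 2 * a - c) (+ 0)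

    p₂ p₃ p₄ : ℤ
    p₂ = + 1 + q
    p₃ = + 1 + q + q * q
    p₄ = + 1 + q + q * q + q * q * q

    -- q + 1 is a unit, with inverse - (q + q³).
    2q≋1 : Cong r ((+ 2 * q - + 1) * (q + + 1)) (+ 0) → Cong r (+ 2 * q) (+ 1)
    2q≋1 h = lin₂ (- (q + q * q * q)) (+ 2 * q - + 1) h S≋0 (lem q)
      where lem : ∀ q → + 2 * q - + 1 ≡ - (q + q * q * q) * ((+ 2 * q - + 1) * (q + + 1) - + 0) + (+ 2 * q - + 1) * (+ 1 + q + q * q + q * q * q + q * q * q * q - + 0)
            lem = solve-∀

  -- The subscripts are the two directions left open by a hexagon whose image starts upwards. Here
  -- and in `rel₋₊` the relation is a unit times (2 q - 1) (q + 1).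
  rel₊₊ : Relation (+ 1) p₃ p₂ → Cong r (+ 2 * q) (+ 1)
  rel₊₊ h = 2q≋1 (lin₁ (+ 1) h (lem q))
    where lem : ∀ q → (+ 2 * q - + 1) * (q + + 1) - + 0 ≡ + 1 * (- (+ 2) * + 1 + + 2 * (+ 1 + q + q * q) - (+ 1 + q) - + 0)
          lem = solve-∀

  rel₋₊ : Relation (+ 1) p₄ p₃ → Cong r (+ 2 * q) (+ 1)
  rel₋₊ h = 2q≋1 (lin₃ (- (q * q)) (+ 1) (+ 2) h S≋0 q⁵≋1 (lem q))
    where lem : ∀ q → (+ 2 * q - + 1) * (q + + 1) - + 0 ≡ - (q * q) * (- (+ 2) * + 1 + + 2 * (+ 1 + q + q * q + q * q * q) - (+ 1 + q + q * q) - + 0) + + 1 * (+ 1 + q + q * q + q * q * q + q * q * q * q - + 0) + + 2 * (q * q * q * q * q - + 1)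
          lem = solve-∀

  -- The left side is 2 (q + q² + q³) = - 2 (1 + q⁴), and 1 + q⁴ = q⁴ (q + 1) is a unit; so 2 would
  -- vanish.
  rel₋₋ : Relation (+ 1) p₄ (+ 0) → ⊥
  rel₋₋ h = 3≤⇒2≢0 3≤r (lin₃ ((q + q * q * q) * q) (+ 2 - + 2 * q * (q + q * q * q)) (+ 2 * (q + q * q * q)) h S≋0 q⁵≋1 (lem q))
    where lem : ∀ q → + 2 - + 0 ≡ (q + q * q * q) * q * (- (+ 2) * + 1 + + 2 * (+ 1 + q + q * q + q * q * q) - + 0 - + 0) + (+ 2 - + 2 * q * (q + q * q * q)) * (+ 1 + q + q * q + q * q * q + q * q * q * q - + 0) + + 2 * (q + q * q * q) * (q * q * q * q * q - + 1)
          lem = solve-∀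

  -- Here (q - 1)² = 0, hence 5 = 0.
  rel₊₋ : Relation (+ 1) p₃ p₄ → ⊥
  rel₊₋ h = [ (λ e → contradiction 3≤r e) , (λ e → mod5 e q≢1 d²≋0) ]′ (∣prime prime-5 (≋0⇒∣ 5≋0))
    where
    contradiction : ∀ {r} → 3 ≤ r → r ≢ 1
    contradiction (s≤s ()) refl
    lem₁ : ∀ q → (q - + 1) * (q - + 1) - + 0 ≡ (q + q * q * q) * (- (+ 2) * + 1 + + 2 * (+ 1 + q + q * q) - (+ 1 + q + q * q + q * q * q) - + 0) + (q - + 1) * (q - + 1) * (+ 1 + q + q * q + q * q * q + q * q * q * q - + 0)
    lem₁ = solve-∀
    d²≋0 : Cong r ((q - + 1) * (q - + 1)) (+ 0)
    d²≋0 = lin₂ (q + q * q * q) ((q - + 1) * (q - + 1)) h S≋0 (lem₁ q)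
    lem₂ : ∀ q → + 5 - + 0 ≡ (+ 1 - + 2 * (q - + 1)) * (+ 1 + q + q * q + q * q * q + q * q * q * q - + 0) + (+ 10 + + 15 * (q - + 1) + + 9 * ((q - + 1) * (q - + 1)) + + 2 * ((q - + 1) * (q - + 1) * (q - + 1))) * ((q - + 1) * (q - + 1) - + 0)
    lem₂ = solve-∀
    5≋0 : Cong r (+ 5) (+ 0)
    5≋0 = lin₂ (+ 1 - + 2 * (q - + 1)) (+ 10 + + 15 * (q - + 1) + + 9 * ((q - + 1) * (q - + 1)) + + 2 * ((q - + 1) * (q - + 1) * (q - + 1))) S≋0 d²≋0 (lem₂ q)
    squares : ∀ (c : Fin 5) → 5 ℕD.∣ ℤ.∣ (+ toℕ c - + 1) * (+ toℕ c - + 1) - + 0 ∣ → toℕ c ≡ 1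
    squares = Dec.toWitness {a? = Finₚ.all? λ c → (5 ℕD.∣? ℤ.∣ (+ toℕ c - + 1) * (+ toℕ c - + 1) - + 0 ∣) →-dec (toℕ c ℕ.≟ 1)} _
    mod5 : ∀ {r q} → r ≡ 5 → ¬ Cong r q (+ 1) → Cong r ((q - + 1) * (q - + 1)) (+ 0) → ⊥
    mod5 {q = q} refl q≢1 d²≋0 = let (c , k) = ≋-residue {5} (s≤s z≤n) q ; k' = +-≋ k (≋-refl {x = - (+ 1)}) in
      q≢1 (≋-trans k (≡⇒≋ (cong +_ (squares c (≋⇒mod (≋-trans (≋-sym (*-≋ k' k')) d²≋0))))))

  private
    -- 32 = 32 q⁵ = (2 q)⁵ = 1.
    31≋0 : Cong r (+ 2 * q) (+ 1) → Cong r (+ 31) (+ 0)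
    31≋0 h = lin₂ (- (+ 32)) (+ 16 * (q * q * q * q) + + 8 * (q * q * q) + + 4 * (q * q) + + 2 * q + + 1) q⁵≋1 h (lem q)
      where lem : ∀ q → + 31 - + 0 ≡ - (+ 32) * (q * q * q * q * q - + 1) + (+ 16 * (q * q * q * q) + + 8 * (q * q * q) + + 4 * (q * q) + + 2 * q + + 1) * (+ 2 * q - + 1)
            lem = solve-∀

  -- The hexagon whose image starts downwards. With 2 q = 1, eight times the left side is an
  -- integer, here - 14, and 20 * 14 = 9 * 31 + 1. In the next three cases the integers are - 26, -
  -- 14 and - 20, again prime to 31.
  rel'₊₊ : Cong r (+ 2 * q) (+ 1) → Relation p₄ (+ 1) (+ 0) → ⊥
  rel'₊₊ h k = 1≢0 (lin₃ (- (+ 160)) (- (+ 9)) (+ 20 * (- (+ 2) * (+ 4 * (q * q) + + 6 * q + + 7))) k (31≋0 h) h (lem q))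
    where lem : ∀ q → + 1 - + 0 ≡ - (+ 160) * (- (+ 2) * (+ 1 + q + q * q + q * q * q) + + 2 * + 1 - + 0 - + 0) + - (+ 9) * (+ 31 - + 0) + + 20 * (- (+ 2) * (+ 4 * (q * q) + + 6 * q + + 7)) * (+ 2 * q - + 1)
          lem = solve-∀

  rel'₊₋ : Cong r (+ 2 * q) (+ 1) → Relation p₄ (+ 1) p₂ → ⊥
  rel'₊₋ h k = 1≢0 (lin₃ (- (+ 48)) (- (+ 5)) (+ 6 * (- (+ 2) * (+ 4 * (q * q) + + 6 * q + + 7) - + 4)) k (31≋0 h) h (lem q))
    where lem : ∀ q → + 1 - + 0 ≡ - (+ 48) * (- (+ 2) * (+ 1 + q + q * q + q * q * q) + + 2 * + 1 - (+ 1 + q) - + 0) + - (+ 5) * (+ 31 - + 0) + + 6 * (- (+ 2) * (+ 4 * (q * q) + + 6 * q + + 7) - + 4) * (+ 2 * q - + 1)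
          lem = solve-∀

  rel'₋₊ : Cong r (+ 2 * q) (+ 1) → Relation p₄ p₂ (+ 1) → ⊥
  rel'₋₊ h k = 1≢0 (lin₃ (- (+ 160)) (- (+ 9)) (+ 20 * (- (+ 2) * (+ 4 * (q * q) + + 6 * q + + 7) + + 8)) k (31≋0 h) h (lem q))
    where lem : ∀ q → + 1 - + 0 ≡ - (+ 160) * (- (+ 2) * (+ 1 + q + q * q + q * q * q) + + 2 * (+ 1 + q) - + 1 - + 0) + - (+ 9) * (+ 31 - + 0) + + 20 * (- (+ 2) * (+ 4 * (q * q) + + 6 * q + + 7) + + 8) * (+ 2 * q - + 1)
          lem = solve-∀

  rel'₋₋ : Cong r (+ 2 * q) (+ 1) → Relation p₄ p₂ p₃ → ⊥
  rel'₋₋ h k = 1≢0 (lin₃ (- (+ 112)) (- (+ 9)) (+ 14 * (- (+ 2) * (+ 4 * (q * q) + + 6 * q + + 7) + + 8 - (+ 4 * q + + 6))) k (31≋0 h) h (lem q))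
    where lem : ∀ q → + 1 - + 0 ≡ - (+ 112) * (- (+ 2) * (+ 1 + q + q * q + q * q * q) + + 2 * (+ 1 + q) - (+ 1 + q + q * q) - + 0) + - (+ 9) * (+ 31 - + 0) + + 14 * (- (+ 2) * (+ 4 * (q * q) + + 6 * q + + 7) + + 8 - (+ 4 * q + + 6)) * (+ 2 * q - + 1)
          lem = solve-∀

-- Images of the 5-cycles under automorphisms

module FiveLayers {Γ : Graph} {r : ℕ} {q : ℤ} (P : Pres Γ 5 r q) (3≤r : 3 ≤ r)
  (h : ℤ) (2h≋1 : Cong r (+ 2 * h) (+ 1)) (q≢1 : ¬ Cong r q (+ 1))
  (S≋0 : Cong r (+ 1 + q + q * q + q * q * q + q * q * q * q) (+ 0)) where

  open Pres P
  open Affine P (s≤s z≤n)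
  open FiveWalks P
  open FifthRoot 3≤r q≢1 S≋0

  private
    _∼_ = _~_ Γ

    q⁵ : Cong r (q * q * q * q * q) (+ 1)
    q⁵ = q⁵≋1

  private
    pN : ℕ → ℤ
    pN zero    = + 0
    pN (suc k) = pN k + w (+ k)

  -- p i stands for 1 + q + ... + q^(i-1)
  p : ℤ → ℤ
  p i = pN (toℕ (proj₁ (≋-residue {5} (s≤s z≤n) i)))

  p-≋ : ∀ {i i'} → Cong 5 i i' → Cong r (p i) (p i')
  p-≋ {i} {i'} c = ≡⇒≋ (cong (pN ∘ toℕ) (≋-Fin (≋-trans (≋-sym (proj₂ (≋-residue (s≤s z≤n) i))) (≋-trans c (proj₂ (≋-residue (s≤s z≤n) i'))))))

  -- Between the layers 4 and 0 this requires that 1 + q + ... + q⁴ vanishes.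
  p-suc : ∀ i → Cong r (p (i + + 1)) (p i + w i)
  p-suc i = let (a , c) = ≋-residue {5} (s≤s z≤n) i ; (b , d) = ≋-residue {5} (s≤s z≤n) (i + + 1) in
      ≋-trans (go a b (≋-trans (≋-sym d) (+-≋ c ≋-refl))) (+-≋ (≋-refl {x = pN (toℕ a)}) (w-≋ (≋-sym c)))
    where
    lem : ∀ q w₀ w₁ w₂ w₃ w₄ → + 0 - (+ 0 + w₀ + w₁ + w₂ + w₃ + w₄) ≡
      - w₀ * (+ 1 + q + q * q + q * q * q + q * q * q * q - + 0) +
      - (+ 1) * (w₁ + w₂ - (w₀ * q + w₀ * (q * q))) + - (+ 1) * (w₃ + w₄ - (w₀ * (q * q * q) + w₀ * (q * q * q * q)))
    lem = solve-∀
    total : Cong r (+ 0) (pN 5)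
    total = lin₃ (- w (+ 0)) (- (+ 1)) (- (+ 1)) S≋0 (+-≋ (wq (+ 0)) (wq² (+ 0))) (+-≋ (wq³ (+ 0)) (wq⁴ (+ 0)))
      (lem q (w (+ 0)) (w (+ 1)) (w (+ 2)) (w (+ 3)) (w (+ 4)))
    small : ∀ (b : Fin 5) k → k < 5 → Cong 5 (+ toℕ b) (+ k) → Cong r (pN (toℕ b)) (pN k)
    small b k k<5 c = ≡⇒≋ (cong pN (≋-small (Finₚ.toℕ<n b) k<5 c))
    go : ∀ (a b : Fin 5) → Cong 5 (+ toℕ b) (+ toℕ a + + 1) → Cong r (pN (toℕ b)) (pN (toℕ a) + w (+ toℕ a))
    go Fin.zero b c = small b 1 (s≤s (s≤s z≤n)) c
    go (Fin.suc Fin.zero) b c = small b 2 (s≤s (s≤s (s≤s z≤n))) c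
    go (Fin.suc (Fin.suc Fin.zero)) b c = small b 3 (s≤s (s≤s (s≤s (s≤s z≤n)))) c
    go (Fin.suc (Fin.suc (Fin.suc Fin.zero))) b c = small b 4 (s≤s (s≤s (s≤s (s≤s (s≤s z≤n))))) c
    go (Fin.suc (Fin.suc (Fin.suc (Fin.suc Fin.zero)))) b c = ≋-trans (small b 0 (s≤s z≤n) (≋-trans c r≋0)) total

  -- The lines ℓ e a, along which the sign e is constant, turn out to be the 5-cycles of Γ.
  ℓ : Fin 2 → ℤ → ℤ → V Γ
  ℓ e a k = U k (a + sgn e * p k)

  ℓ-≋ : ∀ e {a a' k k'} → Cong r a a' → Cong 5 k k' → ℓ e a k ≡ ℓ e a' k'
  ℓ-≋ e c d = U-≋ d (+-≋ c (*-≋ (≋-refl {x = sgn e}) (p-≋ d)))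

  ℓ-layer : ∀ e a {k k'} → Cong 5 k k' → ℓ e a k ≡ ℓ e a k'
  ℓ-layer e a {k} {k'} = ℓ-≋ e {a} {a} {k} {k'} ≋-refl

  ℓ-inj : ∀ e {a a' k k'} → ℓ e a k ≡ ℓ e a' k' → Cong r a a' × Cong 5 k k'
  ℓ-inj e {a} {a'} {k} {k'} eq = let (d , c) = U-inj eq in
    lin₂ (+ 1) (- sgn e) c (p-≋ d) (lem a a' (sgn e) (p k) (p k')) , d
    where lem : ∀ a a' e x y → a - a' ≡ + 1 * (a + e * x - (a' + e * y)) + - e * (x - y)
          lem = solve-∀

  ℓ-F : ∀ e a k → F (ℓ e a k) (ℓ e a (k + + 1))
  ℓ-F e a k = k , a + sgn e * p k , e , refl , U-≋ ≋-refl (lin₁ (sgn e) (p-suc k) (lem a (sgn e) (p k) (p (k + + 1)) (w k)))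
    where lem : ∀ a e x y w → a + e * y - (a + e * x + e * w) ≡ e * (y - (x + w))
          lem = solve-∀

  -- By `signs-equal` all steps of the cycle have the sign of the first, so the cycle stays on one
  -- line.
  five-cycle⁺ : ∀ {v₀ v₁ v₂ v₃ v₄} → F v₀ v₁ → F v₁ v₂ → F v₂ v₃ → F v₃ v₄ → F v₄ v₀ →
    ∃₂ λ e a → ∃ λ i → v₀ ≡ ℓ e a i × v₁ ≡ ℓ e a (i + + 1) × v₂ ≡ ℓ e a (i + + 2) × v₃ ≡ ℓ e a (i + + 3) × v₄ ≡ ℓ e a (i + + 4)
  five-cycle⁺ f₀ f₁ f₂ f₃ f₄ =
    let (i , j , e₀ , e₁ , e₂ , e₃ , e₄ , x₀ , y₁ , y₂ , y₃ , y₄ , s) = winding-sum f₀ f₁ f₂ f₃ f₄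
        (z₁ , z₂ , z₃ , z₄) = signs-equal q⁵ h 2h≋1 q≢1 e₀ e₁ e₂ e₃ e₄ s
    in e₀ , j - sgn e₀ * p i , i , trans x₀ (cong (U i) (l₀ j (sgn e₀) (p i))) ,
       (let a = j - sgn e₀ * p i
            j₁ = j + sgn e₀ * w i
            j₂ = j₁ + sgn e₁ * w (i + + 1)
            j₃ = j₂ + sgn e₂ * w (i + + 1 + + 1)
            k₁ = along {a} {i} {j} {e₀} {e₀} refl (on₀ i j e₀) y₁
            k₂ = along {a} {i + + 1} {j₁} {e₀} {e₁} z₁ (at {a} {i + + 1} {j₁} {e₀} (trans (sym y₁) k₁)) y₂
            k₃ = along {a} {i + + 1 + + 1} {j₂} {e₀} {e₂} z₂ (at {a} {i + + 1 + + 1} {j₂} {e₀} (trans (sym y₂) k₂)) y₃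
            k₄ = along {a} {i + + 1 + + 1 + + 1} {j₃} {e₀} {e₃} z₃ (at {a} {i + + 1 + + 1 + + 1} {j₃} {e₀} (trans (sym y₃) k₃)) y₄
        in k₁ , trans k₂ (cong (ℓ e₀ a) (n₂ i)) , trans k₃ (cong (ℓ e₀ a) (n₃ i)) , trans k₄ (cong (ℓ e₀ a) (n₄ i)))
    where
    n₂ : ∀ i → i + + 1 + + 1 ≡ i + + 2
    n₂ = solve-∀
    n₃ : ∀ i → i + + 1 + + 1 + + 1 ≡ i + + 3
    n₃ = solve-∀
    n₄ : ∀ i → i + + 1 + + 1 + + 1 + + 1 ≡ i + + 4
    n₄ = solve-∀
    l₀ : ∀ j e x → j ≡ j - e * x + e * x
    l₀ = solve-∀
    on₀ : ∀ i j e → Cong r j (j - sgn e * p i + sgn e * p i)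
    on₀ i j e = ≡⇒≋ (l₀ j (sgn e) (p i))
    lem₂ : ∀ a e x y w j → j + e * w - (a + e * y) ≡ + 1 * (j - (a + e * x)) + - e * (y - (x + w))
    lem₂ = solve-∀
    along : ∀ {a i j e e' v} → e' ≡ e → Cong r j (a + sgn e * p i) → v ≡ U (i + + 1) (j + sgn e' * w i) → v ≡ ℓ e a (i + + 1)
    along {a} {i} {j} {e} refl c y = trans y (U-≋ ≋-refl (lin₂ (+ 1) (- sgn e) c (p-suc i) (lem₂ a (sgn e) (p i) (p (i + + 1)) (w i) j)))
    at : ∀ {a i j e} → U i j ≡ ℓ e a i → Cong r j (a + sgn e * p i)
    at eq = proj₂ (U-inj eq)

  -- The image of a line is a 5-cycle, hence a line again; it is traversed from layer `i` in the
  -- direction `d`.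
  record Image (α : Permutation′ (Graph.n Γ)) (e : Fin 2) (a : ℤ) : Set where
    field
      e' : Fin 2
      a' i : ℤ
      d  : Fin 2
      maps : ∀ k → α ⟨$⟩ʳ ℓ e a k ≡ ℓ e' a' (i + sgn d * k)

  private
    fiveway : (Q : ℤ → Set) → (∀ {k k'} → Cong 5 k k' → Q k → Q k') → Q (+ 0) → Q (+ 1) → Q (+ 2) → Q (+ 3) → Q (+ 4) → ∀ k → Q k
    fiveway Q resp q₀ q₁ q₂ q₃ q₄ k = let (c , h) = ≋-residue {5} (s≤s z≤n) k in resp (≋-sym h) (go c)
      where
      go : ∀ c → Q (+ toℕ c)
      go Fin.zero = q₀
      go (Fin.suc Fin.zero) = q₁
      go (Fin.suc (Fin.suc Fin.zero)) = q₂
      go (Fin.suc (Fin.suc (Fin.suc Fin.zero))) = q₃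
      go (Fin.suc (Fin.suc (Fin.suc (Fin.suc Fin.zero)))) = q₄

  image : ∀ α → IsAut Γ α → ∀ e a → Image α e a
  image α mα e a = go (five-cycle-directed (step (+ 0)) (step (+ 1)) (step (+ 2)) (step (+ 3))
      (subst (λ z → (α ⟨$⟩ʳ ℓ e a (+ 4)) ∼ (α ⟨$⟩ʳ z)) (ℓ-layer e a (r≋0 {5})) (step (+ 4))))
    where
    v : ℤ → V Γ
    v k = α ⟨$⟩ʳ ℓ e a k
    step : ∀ k → v k ∼ v (k + + 1)
    step k = Equivalence.to (mα _ _) (F⇒∼ (ℓ-F e a k))
    respects : ∀ e' a' i d {k k'} → Cong 5 k k' → v k ≡ ℓ e' a' (i + sgn d * k) → v k' ≡ ℓ e' a' (i + sgn d * k')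
    respects e' a' i d c eq = trans (cong (α ⟨$⟩ʳ_) (ℓ-layer e a (≋-sym c))) (trans eq (ℓ-layer e' a' (+-≋ (≋-refl {x = i}) (*-≋ (≋-refl {x = sgn d}) c))))
    z₀ : ∀ i → i ≡ i + + 1 * + 0
    z₀ = solve-∀
    z₁ : ∀ i → i + + 4 ≡ i + + 4 + - (+ 1) * + 0
    z₁ = solve-∀
    y₁ : ∀ i → i + + 3 ≡ i + + 4 + - (+ 1) * + 1
    y₁ = solve-∀
    y₂ : ∀ i → i + + 2 ≡ i + + 4 + - (+ 1) * + 2
    y₂ = solve-∀
    y₃ : ∀ i → i + + 1 ≡ i + + 4 + - (+ 1) * + 3
    y₃ = solve-∀
    y₄ : ∀ i → i ≡ i + + 4 + - (+ 1) * + 4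
    y₄ = solve-∀
    go : (∃ λ d → Along d (v (+ 0)) (v (+ 1)) × Along d (v (+ 1)) (v (+ 2)) × Along d (v (+ 2)) (v (+ 3)) × Along d (v (+ 3)) (v (+ 4)) × Along d (v (+ 4)) (v (+ 0))) → Image α e a
    go (Fin.zero , a₀ , a₁ , a₂ , a₃ , a₄) =
      let (e' , a' , i , x₀ , x₁ , x₂ , x₃ , x₄) = five-cycle⁺ a₀ a₁ a₂ a₃ a₄ in
      record { e' = e' ; a' = a' ; i = i ; d = Fin.zero ; maps = fiveway (λ k → v k ≡ ℓ e' a' (i + + 1 * k)) (respects e' a' i Fin.zero)
        (trans x₀ (cong (ℓ e' a') (z₀ i))) x₁ x₂ x₃ x₄ }
    go (Fin.suc Fin.zero , a₀ , a₁ , a₂ , a₃ , a₄) =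
      let (e' , a' , i , x₄ , x₃ , x₂ , x₁ , x₀) = five-cycle⁺ a₃ a₂ a₁ a₀ a₄ in
      record { e' = e' ; a' = a' ; i = i + + 4 ; d = Fin.suc Fin.zero ; maps = fiveway (λ k → v k ≡ ℓ e' a' (i + + 4 + - (+ 1) * k)) (respects e' a' (i + + 4) (Fin.suc Fin.zero))
        (trans x₀ (cong (ℓ e' a') (z₁ i))) (trans x₁ (cong (ℓ e' a') (y₁ i))) (trans x₂ (cong (ℓ e' a') (y₂ i))) (trans x₃ (cong (ℓ e' a') (y₃ i))) (trans x₄ (cong (ℓ e' a') (y₄ i))) }

  private
    pos neg : Fin 2
    pos = Fin.zero
    neg = Fin.suc Fin.zero

    opposite : ∀ e e' → (e ≡ e' → ⊥) → sgn e' ≡ - sgn e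
    opposite Fin.zero Fin.zero ne = ⊥-elim (ne refl)
    opposite Fin.zero (Fin.suc Fin.zero) ne = refl
    opposite (Fin.suc Fin.zero) Fin.zero ne = refl
    opposite (Fin.suc Fin.zero) (Fin.suc Fin.zero) ne = ⊥-elim (ne refl)

    sgn-injective : ∀ e e' → sgn e ≡ sgn e' → e ≡ e'
    sgn-injective Fin.zero Fin.zero _ = refl
    sgn-injective (Fin.suc Fin.zero) (Fin.suc Fin.zero) _ = refl

  meet : ∀ {a b k} → Cong r b (a + + 2 * p k) → ℓ pos a k ≡ ℓ neg b k
  meet {a} {b} {k} c = U-≋ ≋-refl (lin₁ (- (+ 1)) c (lem a b (p k)))
    where lem : ∀ a b p → a + + 1 * p - (b + - (+ 1) * p) ≡ - (+ 1) * (b - (a + + 2 * p))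
          lem = solve-∀

  module _ (α : Permutation′ (Graph.n Γ)) where
    open Image

    at : ∀ {e a} → Image α e a → ℤ → ℤ
    at I k = i I + sgn (d I) * k

    -- Two lines with a common vertex have different types; so have their images, which also share just one vertex.
    types : ∀ {a b k} (I : Image α pos a) (J : Image α neg b) → Cong r b (a + + 2 * p k) → sgn (e' J) ≡ - sgn (e' I)
    types {a} {b} {k} I J c = opposite (e' I) (e' J) λ eq → absurd eq
      where
      common : ∀ {e₂ a₂} → e' I ≡ e₂ → ℓ (e' I) (a' I) (at I k) ≡ ℓ e₂ a₂ (at J k) → Cong r (a' I) a₂ × Cong 5 (at I k) (at J k)
      common {_} {a₂} refl eq = ℓ-inj (e' I) {a' I} {a₂} {at I k} {at J k} eq
      shared : ℓ (e' I) (a' I) (at I k) ≡ ℓ (e' J) (a' J) (at J k)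
      shared = trans (sym (maps I k)) (trans (cong (α ⟨$⟩ʳ_) (meet {a} {b} {k} c)) (maps J k))
      next : ∀ (e₂ : Fin 2) → e' I ≡ e₂ → ∀ {a₂} {x y : ℤ} → Cong r (a' I) a₂ → Cong 5 x y → ℓ (e' I) (a' I) x ≡ ℓ e₂ a₂ y
      next _ refl {a₂} {x} {y} c c' = ℓ-≋ (e' I) {a' I} {a₂} {x} {y} c c'
      lem₀ : ∀ i d k j d' → i + d * (k + d * d') - (j + d' * (k + + 1)) ≡ + 1 * (i + d * k - (j + d' * k)) + d' * (d * d - + 1)
      lem₀ = solve-∀
      absurd : e' I ≡ e' J → ⊥
      absurd eq =
        let (c₁ , c₂) = common {e' J} {a' J} eq shared
            x = k + sgn (d I) * sgn (d J)
            same : ℓ pos a x ≡ ℓ neg b (k + + 1)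
            same = perm-injective α (trans (maps I x) (trans (next (e' J) eq {a' J} c₁
              (lin₂ (+ 1) (sgn (d J)) c₂ (≡⇒≋ (sgn²≡1 (d I))) (lem₀ (i I) (sgn (d I)) k (i J) (sgn (d J))))) (sym (maps J (k + + 1)))))
            (c₃ , c₄) = U-inj same
        in go (d I) (d J) c₃ c₄
        where
        n₁ : ∀ k → + 2 - + 0 ≡ - (+ 1) * (k + - (+ 1) - (k + + 1))
        n₁ = solve-∀
        n₂ : ∀ w a b p p' → w * + 2 - + 0 ≡ + 1 * (a + + 1 * p' - (b + - (+ 1) * p')) + + 1 * (b - (a + + 2 * p)) + - (+ 2) * (p' - (p + w))
        n₂ = solve-∀
        clash : Cong 5 (k + - (+ 1)) (k + + 1) → ⊥
        clash c = 3≤⇒2≢0 {5} (s≤s (s≤s (s≤s z≤n))) (lin₁ (- (+ 1)) c (n₁ k))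
        twice : Cong r (a + + 1 * p (k + + 1)) (b + - (+ 1) * p (k + + 1)) → ⊥
        twice c₄ = 3≤⇒2≢0 3≤r (cancel-w k (lin₃ (+ 1) (+ 1) (- (+ 2)) c₄ c (p-suc k) (n₂ (w k) a b (p k) (p (k + + 1)))))
        go : ∀ d d' → Cong 5 (k + sgn d * sgn d') (k + + 1) → Cong r (a + + 1 * p (k + sgn d * sgn d')) (b + - (+ 1) * p (k + + 1)) → ⊥
        go Fin.zero Fin.zero _ c₄ = twice c₄
        go Fin.zero (Fin.suc Fin.zero) c₃ _ = clash c₃
        go (Fin.suc Fin.zero) Fin.zero c₃ _ = clash c₃
        go (Fin.suc Fin.zero) (Fin.suc Fin.zero) _ c₄ = twice c₄

    -- The images meet where the lines do. Their types being opposite, the condition of `meet` holds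
    -- for the new labels, with the sign of the image of the positive line.
    crossing : ∀ {a b k} (I : Image α pos a) (J : Image α neg b) → Cong r b (a + + 2 * p k) →
      Cong 5 (at J k) (at I k) × Cong r (a' J) (a' I + + 2 * sgn (e' I) * p (at I k))
    crossing {a} {b} {k} I J c =
      let (c₁ , c₂) = U-inj (trans (sym (maps I k)) (trans (cong (α ⟨$⟩ʳ_) (meet {a} {b} {k} c)) (maps J k))) in
      ≋-sym c₁ , lin₃ (- (+ 1)) (- sgn (e' I)) (- p (at J k)) c₂ (p-≋ c₁) (≡⇒≋ (types I J c))
        (lem (a' I) (a' J) (sgn (e' I)) (sgn (e' J)) (p (at I k)) (p (at J k)))
      where lem : ∀ a b e f x y → b - (a + + 2 * e * x) ≡ - (+ 1) * (a + e * x - (b + f * y)) + - e * (x - y) + - y * (f - - e)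
            lem = solve-∀

    module _ (mα : IsAut Γ α) where

      private
        I⟨_⟩ : ∀ a → Image α pos a
        I⟨ a ⟩ = image α mα pos a
        J⟨_⟩ : ∀ b → Image α neg b
        J⟨ b ⟩ = image α mα neg b

      -- The six lines through the vertices at layers k₁, k₀, k₂, k₁, k₀, k₂ (k₁ = k₀ ± 1, k₂ = k₁ ± 1) close up.
      hexagon : ∀ {a b} (I : Image α pos a) (J : Image α neg b) (k₀ : ℤ) (x X : Fin 2) →
        let k₁ = k₀ + sgn x ; λ₀ = at I k₁ in
        Cong r b (a + + 2 * p k₁) → sgn X ≡ sgn (d I) * sgn x → sgn (d J) ≡ - sgn (d I) →
        ∃₂ λ δ δ' → Cong r (p λ₀ - + 2 * p (λ₀ + sgn X) + + 2 * p (λ₀ + sgn X + + 2 * sgn δ) - p (λ₀ + sgn X + + 2 * sgn δ - sgn δ')) (+ 0)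
      hexagon {a} {b} I J k₀ x X c₁₁ eX dJ = δ₂ , δ₂' , relation
        where
        k₁ k₂ a₂ b₂ a₃ b₃ λ₀ : ℤ
        k₁ = k₀ + sgn x
        k₂ = k₀ + + 2 * sgn x
        -- The lines `I`, `J`, `A₂`, `B₂`, `A₃`, `B₃` meet successively in the layers k₁, k₀, k₂,
        -- k₁, k₀, k₂. Each layer enters the labels once with + and once with -, so `B₃` meets `I`
        -- again.
        a₂ = b - + 2 * p k₀
        b₂ = a₂ + + 2 * p k₂
        a₃ = b₂ - + 2 * p k₁
        b₃ = a₃ + + 2 * p k₀
        λ₀ = at I k₁
        A₂ = I⟨ a₂ ⟩
        A₃ = I⟨ a₃ ⟩
        B₂ = J⟨ b₂ ⟩
        B₃ = J⟨ b₃ ⟩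
        sub-add : ∀ u v → u ≡ u - v + v
        sub-add = solve-∀
        c₂₁ : Cong r b (a₂ + + 2 * p k₀)
        c₂₁ = ≡⇒≋ (sub-add b (+ 2 * p k₀))
        c₃₂ : Cong r b₂ (a₃ + + 2 * p k₁)
        c₃₂ = ≡⇒≋ (sub-add b₂ (+ 2 * p k₁))
        c₁₃ : Cong r b₃ (a + + 2 * p k₂)
        c₁₃ = lin₁ (+ 1) c₁₁ (lem a b (p k₀) (p k₁) (p k₂))
          where lem : ∀ a b p₀ p₁ p₂ → b - + 2 * p₀ + + 2 * p₂ - + 2 * p₁ + + 2 * p₀ - (a + + 2 * p₂) ≡ + 1 * (b - (a + + 2 * p₁))
                lem = solve-∀
        x₁₁ = crossing {a} {b} {k₁} I J c₁₁
        x₂₁ = crossing {a₂} {b} {k₀} A₂ J c₂₁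
        x₂₂ = crossing {a₂} {b₂} {k₂} A₂ B₂ ≋-refl
        x₃₂ = crossing {a₃} {b₂} {k₁} A₃ B₂ c₃₂
        x₃₃ = crossing {a₃} {b₃} {k₀} A₃ B₃ ≋-refl
        x₁₃ = crossing {a} {b₃} {k₂} I B₃ c₁₃
        ε : ℤ
        ε = sgn (e' I)
        neg-inj : ∀ {u v y : ℤ} → y ≡ - u → y ≡ - v → u ≡ v
        neg-inj e f = ℤₚ.neg-injective (trans (sym e) f)
        ε₂ : sgn (e' A₂) ≡ ε
        ε₂ = neg-inj (types {a₂} {b} {k₀} A₂ J c₂₁) (types {a} {b} {k₁} I J c₁₁)
        ε₃ : sgn (e' A₃) ≡ ε
        ε₃ = trans (neg-inj (types {a₃} {b₂} {k₁} A₃ B₂ c₃₂) (types {a₂} {b₂} {k₂} A₂ B₂ ≋-refl)) ε₂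
        δ₂ = proj₁ (sgn-* (d A₂) x)
        δ₂' = proj₁ (sgn-* (d B₂) x)
        δ₃ = proj₁ (sgn-* (d A₃) x)
        δ₃' = proj₁ (sgn-* (d B₃) x)
        eq₂ = proj₂ (sgn-* (d A₂) x)
        eq₂' = proj₂ (sgn-* (d B₂) x)
        eq₃ = proj₂ (sgn-* (d A₃) x)
        eq₃' = proj₂ (sgn-* (d B₃) x)
        m₁ m₂ : ℤ
        m₁ = λ₀ + sgn X
        m₂ = m₁ + + 2 * sgn δ₂
        twoSteps : ∀ {e a} (K : Image α e a) δ → sgn δ ≡ sgn (d K) * sgn x → Cong 5 (at K k₂) (at K k₀ + + 2 * sgn δ)
        twoSteps K δ e = lin₁ (- (+ 2)) (≡⇒≋ e) (lem (i K) (sgn (d K)) k₀ (sgn x) (sgn δ))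
          where lem : ∀ i d k x s → i + d * (k + + 2 * x) - (i + d * k + + 2 * s) ≡ - (+ 2) * (s - d * x)
                lem = solve-∀
        down₁ : ∀ {e a} (K : Image α e a) δ → sgn δ ≡ sgn (d K) * sgn x → Cong 5 (at K k₀) (at K k₁ - sgn δ)
        down₁ K δ e = lin₁ (+ 1) (≡⇒≋ e) (lem (i K) (sgn (d K)) k₀ (sgn x) (sgn δ))
          where lem : ∀ i d k x s → i + d * k - (i + d * (k + x) - s) ≡ + 1 * (s - d * x)
                lem = solve-∀
        down₂ : ∀ {e a} (K : Image α e a) δ → sgn δ ≡ sgn (d K) * sgn x → Cong 5 (at K k₁) (at K k₂ - sgn δ)
        down₂ K δ e = lin₁ (+ 1) (≡⇒≋ e) (lem (i K) (sgn (d K)) k₀ (sgn x) (sgn δ))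
          where lem : ∀ i d k x s → i + d * (k + x) - (i + d * (k + + 2 * x) - s) ≡ + 1 * (s - d * x)
                lem = solve-∀
        I-k₂ : Cong 5 (at I k₂) m₁
        I-k₂ = lin₁ (- (+ 1)) (≡⇒≋ eX) (lem (i I) (sgn (d I)) k₀ (sgn x) (sgn X))
          where lem : ∀ i d k x s → i + d * (k + + 2 * x) - (i + d * (k + x) + s) ≡ - (+ 1) * (s - d * x)
                lem = solve-∀
        -- Since `J` is traversed against `I`, the layer k₀ on `J` has the same image as k₂, on the
        -- other side of k₁, on `I`.
        A₂-k₀ : Cong 5 (at A₂ k₀) m₁
        A₂-k₀ = ≋-trans (≋-sym (proj₁ x₂₁)) (lin₃ (+ 1) (- sgn x) (- (+ 1)) (proj₁ x₁₁) (≡⇒≋ dJ) (≡⇒≋ eX)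
            (lem (i J) (sgn (d J)) k₀ (sgn x) (sgn X) (i I) (sgn (d I))))
          where lem : ∀ j e k x X i d → j + e * k - (i + d * (k + x) + X) ≡
                  + 1 * (j + e * (k + x) - (i + d * (k + x))) + - x * (e - - d) + - (+ 1) * (X - d * x)
                lem = solve-∀
        A₂-k₂ : Cong 5 (at A₂ k₂) m₂
        A₂-k₂ = ≋-trans (twoSteps A₂ δ₂ eq₂) (+-≋ A₂-k₀ ≋-refl)
        A₃-k₁ : Cong 5 (at A₃ k₁) (m₂ - sgn δ₂')
        A₃-k₁ = ≋-trans (≋-sym (proj₁ x₃₂)) (≋-trans (down₂ B₂ δ₂' eq₂') (+-≋ (≋-trans (proj₁ x₂₂) A₂-k₂) ≋-refl))
        A₃-k₀ : Cong 5 (at A₃ k₀) (m₂ - sgn δ₂' - sgn δ₃)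
        A₃-k₀ = ≋-trans (down₁ A₃ δ₃ eq₃) (+-≋ A₃-k₁ ≋-refl)
        closing : Cong 5 m₁ (m₂ - sgn δ₂' - sgn δ₃ + + 2 * sgn δ₃')
        closing = ≋-trans (≋-sym I-k₂) (≋-trans (≋-sym (proj₁ x₁₃)) (≋-trans (twoSteps B₃ δ₃' eq₃') (+-≋ (≋-trans (proj₁ x₃₃) A₃-k₀) ≋-refl)))
        -- The image of the hexagon returns to its layer too, which fixes the direction of `A₃`
        -- relative to that of `B₂`.
        turn : sgn δ₃ ≡ - sgn δ₂'
        turn = hexagon-layers δ₂ δ₂' δ₃ δ₃' (subst (5 ℕD.∣_) (cong ℤ.∣_∣ (ℤₚ.+-identityʳ s)) (≋⇒mod (lin₁ {x = s} {y = + 0} (- (+ 1)) closing (lem m₁ (sgn δ₂) (sgn δ₂') (sgn δ₃) (sgn δ₃')))))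
          where s = + 2 * sgn δ₂ - sgn δ₂' - sgn δ₃ + + 2 * sgn δ₃'
                lem : ∀ m u v w z → + 2 * u - v - w + + 2 * z - + 0 ≡ - (+ 1) * (m - (m + + 2 * u - v - w + + 2 * z))
                lem = solve-∀
        A₃-k₀' : Cong 5 (at A₃ k₀) m₂
        A₃-k₀' = ≋-trans A₃-k₀ (lin₁ (- (+ 1)) (≡⇒≋ turn) (lem m₂ (sgn δ₂') (sgn δ₃)))
          where lem : ∀ m v w → m - v - w - m ≡ - (+ 1) * (w - - v)
                lem = solve-∀
        at' : ∀ {e a} (K : Image α e a) k l {f} → sgn (e' K) ≡ ε → Cong 5 (at K k) l →
          Cong r f (a' K + + 2 * sgn (e' K) * p (at K k)) → Cong r f (a' K + + 2 * ε * p l)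
        at' K k l e c f = ≋-trans f (+-≋ (≋-refl {x = a' K}) (*-≋ (≡⇒≋ (cong (+ 2 *_) e)) (p-≋ c)))
        y₁₁ : Cong r (a' J) (a' I + + 2 * ε * p λ₀)
        y₁₁ = proj₂ x₁₁
        y₂₁ : Cong r (a' J) (a' A₂ + + 2 * ε * p m₁)
        y₂₁ = at' A₂ k₀ m₁ ε₂ A₂-k₀ (proj₂ x₂₁)
        y₂₂ : Cong r (a' B₂) (a' A₂ + + 2 * ε * p m₂)
        y₂₂ = at' A₂ k₂ m₂ ε₂ A₂-k₂ (proj₂ x₂₂)
        y₃₂ : Cong r (a' B₂) (a' A₃ + + 2 * ε * p (m₂ - sgn δ₂'))
        y₃₂ = at' A₃ k₁ (m₂ - sgn δ₂') ε₃ A₃-k₁ (proj₂ x₃₂)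
        y₃₃ : Cong r (a' B₃) (a' A₃ + + 2 * ε * p m₂)
        y₃₃ = at' A₃ k₀ m₂ ε₃ A₃-k₀' (proj₂ x₃₃)
        y₁₃ : Cong r (a' B₃) (a' I + + 2 * ε * p m₁)
        y₁₃ = at' I k₂ m₁ refl I-k₂ (proj₂ x₁₃)
        R : ℤ
        R = p λ₀ - + 2 * p m₁ + + 2 * p m₂ - p (m₂ - sgn δ₂')
        -- Going around the image, each meeting changes the label by ± 2 ε p of its layer, with
        -- alternating signs; these six changes cancel.
        doubled : Cong r (+ 2 * ε * R) (+ 0)
        doubled = lin₃ (- (+ 1)) (- (+ 1)) (- (+ 1)) (diff y₁₁ y₂₁) (diff y₂₂ y₃₂) (diff y₃₃ y₁₃)
            (lem (a' I) (a' A₂) (a' A₃) ε (p λ₀) (p m₁) (p m₂) (p (m₂ - sgn δ₂')))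
          where
          diff : ∀ {u v w} → Cong r u v → Cong r u w → Cong r (w - v) (+ 0)
          diff {u} {v} {w} h₁ h₂ = lin₂ (+ 1) (- (+ 1)) h₁ h₂ (lem' u v w)
            where lem' : ∀ u v w → w - v - + 0 ≡ + 1 * (u - v) + - (+ 1) * (u - w)
                  lem' = solve-∀
          lem : ∀ a b c e p₀ p₁ p₂ p₃ → + 2 * e * (p₀ - + 2 * p₁ + + 2 * p₂ - p₃) - + 0 ≡
            - (+ 1) * ((b + + 2 * e * p₁) - (a + + 2 * e * p₀) - + 0) +
            - (+ 1) * ((c + + 2 * e * p₃) - (b + + 2 * e * p₂) - + 0) +
            - (+ 1) * ((a + + 2 * e * p₁) - (c + + 2 * e * p₂) - + 0)
          lem = solve-∀
        relation : Cong r R (+ 0)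
        relation = lin₃ (h * ε) (- (ε * ε * R)) (- R) doubled 2h≋1 (≡⇒≋ (sgn²≡1 (e' I))) (lem h ε R)
          where lem : ∀ h e R → R - + 0 ≡ h * e * (+ 2 * e * R - + 0) + - (e * e * R) * (+ 2 * h - + 1) + - R * (e * e - + 1)
                lem = solve-∀

      private
        p₁ : ∀ l → Cong r (p (l + + 1)) (p l + w l * + 1)
        p₁ l = ≋-trans (p-suc l) (≡⇒≋ (cong (λ z → p l + z) (sym (ℤₚ.*-identityʳ (w l)))))
        p₂ : ∀ l → Cong r (p (l + + 2)) (p l + w l * (+ 1 + q))
        p₂ l = ≋-trans (≡⇒≋ (cong p (n l))) (lin₃ (+ 1) (+ 1) (+ 1) (p-suc (l + + 1)) (p₁ l) (wq l) (lem (p l) (p (l + + 1)) (p (l + + 1 + + 1)) (w l) (w (l + + 1)) q))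
          where n : ∀ l → l + + 2 ≡ l + + 1 + + 1
                n = solve-∀
                lem : ∀ a b c w v q → c - (a + w * (+ 1 + q)) ≡ + 1 * (c - (b + v)) + + 1 * (b - (a + w * + 1)) + + 1 * (v - w * q)
                lem = solve-∀
        p₃ : ∀ l → Cong r (p (l + + 3)) (p l + w l * (+ 1 + q + q * q))
        p₃ l = ≋-trans (≡⇒≋ (cong p (n l))) (lin₃ (+ 1) (+ 1) (+ 1) (p-suc (l + + 2)) (p₂ l) (wq² l) (lem (p l) (p (l + + 2)) (p (l + + 2 + + 1)) (w l) (w (l + + 2)) q))
          where n : ∀ l → l + + 3 ≡ l + + 2 + + 1
                n = solve-∀
                lem : ∀ a b c w v q → c - (a + w * (+ 1 + q + q * q)) ≡ + 1 * (c - (b + v)) + + 1 * (b - (a + w * (+ 1 + q))) + + 1 * (v - w * (q * q))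
                lem = solve-∀
        p₄ : ∀ l → Cong r (p (l + + 4)) (p l + w l * (+ 1 + q + q * q + q * q * q))
        p₄ l = ≋-trans (≡⇒≋ (cong p (n l))) (lin₃ (+ 1) (+ 1) (+ 1) (p-suc (l + + 3)) (p₃ l) (wq³ l) (lem (p l) (p (l + + 3)) (p (l + + 3 + + 1)) (w l) (w (l + + 3)) q))
          where n : ∀ l → l + + 4 ≡ l + + 3 + + 1
                n = solve-∀
                lem : ∀ a b c w v q → c - (a + w * (+ 1 + q + q * q + q * q * q)) ≡ + 1 * (c - (b + v)) + + 1 * (b - (a + w * (+ 1 + q + q * q))) + + 1 * (v - w * (q * q * q))
                lem = solve-∀
        p₀ : ∀ l → Cong r (p l) (p l + w l * + 0)
        p₀ l = ≡⇒≋ (lem (p l) (w l))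
          where lem : ∀ x y → x ≡ x + y * + 0
                lem = solve-∀

        Hex : ℤ → Fin 2 → Fin 2 → Fin 2 → Set
        Hex l X δ δ' = Cong r (p l - + 2 * p (l + sgn X) + + 2 * p (l + sgn X + + 2 * sgn δ) - p (l + sgn X + + 2 * sgn δ - sgn δ')) (+ 0)

        scale : ∀ l {x y z} πx πa πc → Cong r (p x) (p l + w l * πx) → Cong r (p y) (p l + w l * πa) → Cong r (p z) (p l + w l * πc) →
          Cong r (p l - + 2 * p x + + 2 * p y - p z) (+ 0) → Cong r (- (+ 2) * πx + + 2 * πa - πc) (+ 0)
        scale l {x} {y} {z} πx πa πc hx ha hc c = cancel-w l (lin₂ (+ 1) (- (+ 1)) c
            (lin₃ {x = - (+ 2) * p x + + 2 * p y - p z} {y = - (+ 2) * (p l + w l * πx) + + 2 * (p l + w l * πa) - (p l + w l * πc)} (- (+ 2)) (+ 2) (- (+ 1)) hx ha hc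
              (lem₁ (p x) (p y) (p z) (p l + w l * πx) (p l + w l * πa) (p l + w l * πc)))
            (lem₂ (p l) (p x) (p y) (p z) (w l) πx πa πc))
          where
          lem₁ : ∀ x y z a b c → - (+ 2) * x + + 2 * y - z - (- (+ 2) * a + + 2 * b - c) ≡ - (+ 2) * (x - a) + + 2 * (y - b) + - (+ 1) * (z - c)
          lem₁ = solve-∀
          lem₂ : ∀ l x y z w a b c → w * (- (+ 2) * a + + 2 * b - c) - + 0 ≡ + 1 * (l - + 2 * x + + 2 * y - z - + 0) +
            - (+ 1) * (- (+ 2) * x + + 2 * y - z - (- (+ 2) * (l + w * a) + + 2 * (l + w * b) - (l + w * c)))
          lem₂ = solve-∀

        on : ∀ {l x} n {π} → (∀ l → Cong r (p (l + n)) (p l + w l * π)) → Cong 5 x (l + n) → Cong r (p x) (p l + w l * π)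
        on {l} n h c = ≋-trans (p-≋ c) (h l)

        on₀ : ∀ {l x} → Cong 5 x l → Cong r (p x) (p l + w l * + 0)
        on₀ {l} c = ≋-trans (p-≋ c) (p₀ l)

        l₂ : ∀ l → l + + 1 + + 2 * + 1 - + 1 ≡ l + + 2
        l₂ = solve-∀
        l₃ : ∀ l → l + + 1 + + 2 * + 1 ≡ l + + 3
        l₃ = solve-∀
        l₄ : ∀ l → l + + 1 + + 2 * + 1 - - (+ 1) ≡ l + + 4
        l₄ = solve-∀
        l₋₁ : ∀ l → l + + 1 + + 2 * - (+ 1) ≡ l + + 4 + - (+ 1) * + 5
        l₋₁ = solve-∀
        l₋₂ : ∀ l → l + + 1 + + 2 * - (+ 1) - + 1 ≡ l + + 3 + - (+ 1) * + 5
        l₋₂ = solve-∀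
        l₀ : ∀ l → l + + 1 + + 2 * - (+ 1) - - (+ 1) ≡ l
        l₀ = solve-∀
        m₋₁ : ∀ l → l + - (+ 1) ≡ l + + 4 + - (+ 1) * + 5
        m₋₁ = solve-∀
        m₁ : ∀ l → l + - (+ 1) + + 2 * + 1 ≡ l + + 1
        m₁ = solve-∀
        m₀ : ∀ l → l + - (+ 1) + + 2 * + 1 - + 1 ≡ l
        m₀ = solve-∀
        m₂ : ∀ l → l + - (+ 1) + + 2 * + 1 - - (+ 1) ≡ l + + 2
        m₂ = solve-∀
        m₋₃ : ∀ l → l + - (+ 1) + + 2 * - (+ 1) ≡ l + + 2 + - (+ 1) * + 5
        m₋₃ = solve-∀
        m₋₄ : ∀ l → l + - (+ 1) + + 2 * - (+ 1) - + 1 ≡ l + + 1 + - (+ 1) * + 5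
        m₋₄ = solve-∀
        m₋₂ : ∀ l → l + - (+ 1) + + 2 * - (+ 1) - - (+ 1) ≡ l + + 3 + - (+ 1) * + 5
        m₋₂ = solve-∀
        back : ∀ {x y} → x ≡ y + - (+ 1) * + 5 → Cong 5 x y
        back e = by (- (+ 1)) e

        right : ∀ l δ δ' → Hex l pos δ δ' → Cong r (+ 2 * q) (+ 1)
        right l Fin.zero Fin.zero c = rel₊₊ (scale l _ _ _ (p₁ l) (on (+ 3) p₃ (≡⇒≋ (l₃ l))) (on (+ 2) p₂ (≡⇒≋ (l₂ l))) c)
        right l Fin.zero (Fin.suc Fin.zero) c = ⊥-elim (rel₊₋ (scale l _ _ _ (p₁ l) (on (+ 3) p₃ (≡⇒≋ (l₃ l))) (on (+ 4) p₄ (≡⇒≋ (l₄ l))) c))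
        right l (Fin.suc Fin.zero) Fin.zero c = rel₋₊ (scale l _ _ _ (p₁ l) (on (+ 4) p₄ (back (l₋₁ l))) (on (+ 3) p₃ (back (l₋₂ l))) c)
        right l (Fin.suc Fin.zero) (Fin.suc Fin.zero) c = ⊥-elim (rel₋₋ (scale l _ _ _ (p₁ l) (on (+ 4) p₄ (back (l₋₁ l))) (on₀ (≡⇒≋ (l₀ l))) c))

        left : ∀ l δ δ' → Cong r (+ 2 * q) (+ 1) → Hex l neg δ δ' → ⊥
        left l Fin.zero Fin.zero t c = rel'₊₊ t (scale l _ _ _ (on (+ 4) p₄ (back (m₋₁ l))) (on (+ 1) p₁ (≡⇒≋ (m₁ l))) (on₀ (≡⇒≋ (m₀ l))) c)
        left l Fin.zero (Fin.suc Fin.zero) t c = rel'₊₋ t (scale l _ _ _ (on (+ 4) p₄ (back (m₋₁ l))) (on (+ 1) p₁ (≡⇒≋ (m₁ l))) (on (+ 2) p₂ (≡⇒≋ (m₂ l))) c)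
        left l (Fin.suc Fin.zero) Fin.zero t c = rel'₋₊ t (scale l _ _ _ (on (+ 4) p₄ (back (m₋₁ l))) (on (+ 2) p₂ (back (m₋₃ l))) (on (+ 1) p₁ (back (m₋₄ l))) c)
        left l (Fin.suc Fin.zero) (Fin.suc Fin.zero) t c = rel'₋₋ t (scale l _ _ _ (on (+ 4) p₄ (back (m₋₁ l))) (on (+ 2) p₂ (back (m₋₃ l))) (on (+ 3) p₃ (back (m₋₂ l))) c)

      -- Otherwise two hexagons start at the common vertex, one whose image goes up and one whose
      -- image goes down; `choose` finds the side on which to build them. The first yields 2 q = 1,
      -- and `left` refutes the second.
      same-direction : ∀ {a b k} (I : Image α pos a) (J : Image α neg b) → Cong r b (a + + 2 * p k) → d I ≡ d J
      same-direction {a} {b} {k} I J c with d I Fin.≟ d J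
      ... | yes e = e
      ... | no ne = ⊥-elim (left _ (proj₁ H₋) (proj₁ (proj₂ H₋)) (right _ (proj₁ H₊) (proj₁ (proj₂ H₊)) (proj₂ (proj₂ H₊))) (proj₂ (proj₂ H₋)))
        where
        choose : ∀ X e → ∃ λ x → sgn X ≡ sgn e * sgn x
        choose X Fin.zero = X , sym (ℤₚ.*-identityˡ (sgn X))
        choose Fin.zero (Fin.suc Fin.zero) = Fin.suc Fin.zero , refl
        choose (Fin.suc Fin.zero) (Fin.suc Fin.zero) = Fin.zero , refl
        sub-add : ∀ k x → k ≡ k - x + x
        sub-add = solve-∀
        hex : ∀ X → ∃₂ λ δ δ' → Hex (at I (k - sgn (proj₁ (choose X (d I))) + sgn (proj₁ (choose X (d I))))) X δ δ'
        hex X = let (x , e) = choose X (d I) in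
          hexagon I J (k - sgn x) x X (subst (λ z → Cong r b (a + + 2 * p z)) (sub-add k (sgn x)) c) e (opposite (d I) (d J) ne)
        H₊ = hex pos
        H₋ = hex neg

      p-zero : Cong r (p (+ 0)) (+ 0)
      p-zero = ≡⇒≋ (cong pN (≋-small (Finₚ.toℕ<n (proj₁ (≋-residue {5} (s≤s z≤n) (+ 0)))) (s≤s z≤n) (≋-sym (proj₂ (≋-residue {5} (s≤s z≤n) (+ 0))))))

      -- α reverses the positive lines, permuting their labels by an affine map with the two slopes w (i₀ - 1) and w (i₀ - 2) / q.
      no-reversal : ∀ {a₀} (I₀ : Image α pos a₀) → d I₀ ≡ neg → ⊥
      no-reversal {a₀} I₀ d₀ = q²≢1 final
        where
        i₀ ε f₀ : ℤ
        i₀ = i I₀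
        ε = sgn (e' I₀)
        f₀ = a' I₀
        record State (a f : ℤ) : Set where
          eta-equality
          constructor state
          field
            I  : Image α pos a
            dI : d I ≡ neg
            iI : Cong 5 (i I) i₀
            εI : sgn (e' I) ≡ ε
            fI : Cong r (a' I) f
        shift : ℤ → ℤ → ℤ
        shift k l = + 2 * ε * p (i₀ - k) - + 2 * ε * p (i₀ - l)
        lem₁ : ∀ i j k → j - i ≡ + 1 * (j + - (+ 1) * k - (i + - (+ 1) * k))
        lem₁ = solve-∀
        at≋ : ∀ {e a} (K : Image α e a) k → d K ≡ neg → Cong 5 (i K) i₀ → Cong 5 (at K k) (i₀ - k)
        at≋ K k e c = ≋-trans (≡⇒≋ (cong (λ z → i K + sgn z * k) e)) (+-≋ c (≡⇒≋ (ℤₚ.-1*i≡-i k)))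
        layers : ∀ {e a e₂ a₂} (K : Image α e a) (L : Image α e₂ a₂) k → d K ≡ neg → d L ≡ neg → Cong 5 (at L k) (at K k) → Cong 5 (i L) (i K)
        layers K L k dK dL c = lin₁ (+ 1) (subst₂ (λ x y → Cong 5 (i L + sgn x * k) (i K + sgn y * k)) dL dK c) (lem₁ (i K) (i L) k)
        -- Leads to another positive line through the negative line that meets the two in the layers
        -- `k` and `l`; by `same-direction` all of them are reversed.
        step : ∀ k l {a f} → State a f → State (a + + 2 * p k - + 2 * p l) (f + shift k l)
        step k l {a} {f} (state I dI iI εI fI) = state I' dI' iI' εI' fI'
          where
          b a₁ : ℤ
          b = a + + 2 * p k
          a₁ = b - + 2 * p l
          J = J⟨ b ⟩
          I' = I⟨ a₁ ⟩
          cb : Cong r b (a₁ + + 2 * p l)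
          cb = ≡⇒≋ (lem b (+ 2 * p l))
            where lem : ∀ u v → u ≡ u - v + v
                  lem = solve-∀
          dJ : d J ≡ neg
          dJ = trans (sym (same-direction {a} {b} {k} I J ≋-refl)) dI
          dI' : d I' ≡ neg
          dI' = trans (same-direction {a₁} {b} {l} I' J cb) dJ
          x = crossing {a} {b} {k} I J ≋-refl
          x' = crossing {a₁} {b} {l} I' J cb
          iI' : Cong 5 (i I') i₀
          iI' = ≋-trans (≋-sym (layers I' J l dI' dJ (proj₁ x'))) (≋-trans (layers I J k dI dJ (proj₁ x)) iI)
          εI' : sgn (e' I') ≡ ε
          εI' = trans (ℤₚ.neg-injective (trans (sym (types {a₁} {b} {l} I' J cb)) (types {a} {b} {k} I J ≋-refl))) εI
          value : ∀ {e c} (K : Image α e c) k g → sgn (e' K) ≡ ε → d K ≡ neg → Cong 5 (i K) i₀ →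
            Cong r g (a' K + + 2 * sgn (e' K) * p (at K k)) → Cong r g (a' K + + 2 * ε * p (i₀ - k))
          value K k g eK dK iK c = ≋-trans c (+-≋ (≋-refl {x = a' K}) (*-≋ (≡⇒≋ (cong (+ 2 *_) eK)) (p-≋ (at≋ K k dK iK))))
          lem₂ : ∀ a' f g b u v → a' - (f + (u - v)) ≡ - (+ 1) * (b - (a' + v)) + + 1 * (b - (g + u)) + + 1 * (g - f)
          lem₂ = solve-∀
          fI' : Cong r (a' I') (f + shift k l)
          fI' = lin₃ (- (+ 1)) (+ 1) (+ 1) (value I' l (a' J) εI' dI' iI' (proj₂ x')) (value I k (a' J) εI dI iI (proj₂ x)) fI
            (lem₂ (a' I') f (a' I) (a' J) (+ 2 * ε * p (i₀ - k)) (+ 2 * ε * p (i₀ - l)))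
        steps : ∀ n → ∃₂ λ a f → State a f × Cong r a (a₀ + + n * (+ 2 * p (+ 1) - + 2 * p (+ 0))) × Cong r f (f₀ + + n * shift (+ 1) (+ 0))
        steps zero = a₀ , f₀ , state I₀ d₀ ≋-refl refl ≋-refl , ≡⇒≋ (lem a₀ (+ 2 * p (+ 1) - + 2 * p (+ 0))) , ≡⇒≋ (lem f₀ (shift (+ 1) (+ 0)))
          where lem : ∀ a x → a ≡ a + + 0 * x
                lem = solve-∀
        steps (suc n) = let (a , f , s , ca , cf) = steps n in _ , _ , step (+ 1) (+ 0) s ,
            lin₁ (+ 1) ca (lem₃ a a₀ (+ n) (+ 2 * p (+ 1)) (+ 2 * p (+ 0))) , lin₁ (+ 1) cf (lem₄ f f₀ (+ n) (shift (+ 1) (+ 0)))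
          where lem₃ : ∀ a b n u v → a + u - v - (b + (+ 1 + n) * (u - v)) ≡ + 1 * (a - (b + n * (u - v)))
                lem₃ = solve-∀
                lem₄ : ∀ a b n u → a + u - (b + (+ 1 + n) * u) ≡ + 1 * (a - (b + n * u))
                lem₄ = solve-∀
        unique : ∀ {a a₁ f f₁} → State a f → State a₁ f₁ → Cong r a a₁ → Cong r f f₁
        unique {a} {a₁} {f} {f₁} (state I _ _ εI fI) (state I₁ _ _ εI₁ fI₁) c =
          ≋-trans (≋-sym fI) (≋-trans (labels (e' I) (e' I₁) (sgn-injective (e' I) (e' I₁) (trans εI (sym εI₁)))
            (trans (sym (maps I (+ 0))) (trans (cong (α ⟨$⟩ʳ_) (ℓ-≋ pos {a} {a₁} {+ 0} {+ 0} c ≋-refl)) (maps I₁ (+ 0))))) fI₁)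
          where
          labels : ∀ e e₁ → e ≡ e₁ → ∀ {a b k l} → ℓ e a k ≡ ℓ e₁ b l → Cong r a b
          labels e _ refl {a} {b} {k} {l} eq = proj₁ (ℓ-inj e {a} {b} {k} {l} eq)
        -- A step between the layers 1 and 0 adds 2 w 0 to the label, a step between 2 and 1 adds 2
        -- w 1 = 2 q w 0. With n = q modulo `r`, n steps of the first kind lead to the same line as
        -- one of the second; comparing image labels gives n q = 1.
        N : ∃ λ (n : Fin r) → Cong r q (+ toℕ n)
        N = ≋-residue (ℕₚ.≤-trans (s≤s z≤n) 3≤r) q
        n = toℕ (proj₁ N)
        S₁ = steps n
        S₂ : State (a₀ + + 2 * p (+ 2) - + 2 * p (+ 1)) (f₀ + shift (+ 2) (+ 1))
        S₂ = step (+ 2) (+ 1) (state I₀ d₀ ≋-refl refl ≋-refl)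
        labels≋ : Cong r (proj₁ S₁) (a₀ + + 2 * p (+ 2) - + 2 * p (+ 1))
        labels≋ = lin₂ (+ 1) (+ 2) (proj₁ (proj₂ (proj₂ (proj₂ S₁))))
            (lin₃ {x = + n * (p (+ 1) - p (+ 0))} {y = p (+ 2) - p (+ 1)} (+ n) (- (+ 1)) (- (+ 1)) (p-suc (+ 0)) (p-suc (+ 1))
              (lin₃ {x = w (+ 1)} {y = + n * w (+ 0)} (+ 1) (w (+ 0)) (+ 0) (wq (+ 0)) (proj₂ N) w-0 (lem₆ (w (+ 0)) (w (+ 1)) q (+ n)))
              (lem₇ (+ n) (p (+ 0)) (p (+ 1)) (p (+ 2)) (w (+ 0)) (w (+ 1))))
            (lem₈ (proj₁ S₁) a₀ (+ n) (p (+ 0)) (p (+ 1)) (p (+ 2)))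
          where
          lem₆ : ∀ w₀ w₁ q n → w₁ - n * w₀ ≡ + 1 * (w₁ - w₀ * q) + w₀ * (q - n) + + 0 * (w₀ - + 1)
          lem₆ = solve-∀
          lem₇ : ∀ n p₀ p₁ p₂ w₀ w₁ → n * (p₁ - p₀) - (p₂ - p₁) ≡ n * (p₁ - (p₀ + w₀)) + - (+ 1) * (p₂ - (p₁ + w₁)) + - (+ 1) * (w₁ - n * w₀)
          lem₇ = solve-∀
          lem₈ : ∀ a₁ a n p₀ p₁ p₂ → a₁ - (a + + 2 * p₂ - + 2 * p₁) ≡ + 1 * (a₁ - (a + n * (+ 2 * p₁ - + 2 * p₀))) + + 2 * (n * (p₁ - p₀) - (p₂ - p₁))
          lem₈ = solve-∀
        images≋ : Cong r (proj₁ (proj₂ S₁)) (f₀ + shift (+ 2) (+ 1))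
        images≋ = unique (proj₁ (proj₂ (proj₂ S₁))) S₂ labels≋
        y : ℤ
        y = w (i₀ - + 2)
        down : Cong r (p (i₀ - + 1)) (p (i₀ - + 2) + y)
        down = ≋-trans (≡⇒≋ (cong p (lem i₀))) (p-suc (i₀ - + 2))
          where lem : ∀ i → i - + 1 ≡ i - + 2 + + 1
                lem = solve-∀
        down' : Cong r (p (i₀ - + 0)) (p (i₀ - + 1) + y * q)
        down' = ≋-trans (≡⇒≋ (cong p (lem i₀))) (≋-trans (p-suc (i₀ - + 1)) (+-≋ (≋-refl {x = p (i₀ - + 1)}) (≋-trans (≡⇒≋ (cong w (lem' i₀))) (wq (i₀ - + 2)))))
          where lem : ∀ i → i - + 0 ≡ i - + 1 + + 1
                lem = solve-∀
                lem' : ∀ i → i - + 1 ≡ i - + 2 + + 1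
                lem' = solve-∀
        scaled : Cong r (y * (+ 2 * ε * (+ n * q - + 1))) (+ 0)
        scaled = lin₂ (+ 1) (- (+ 1)) slopes images
            (lem (+ n) ε (p (i₀ - + 0)) (p (i₀ - + 1)) (p (i₀ - + 2)) y q)
          where
          images : Cong r (+ n * shift (+ 1) (+ 0)) (shift (+ 2) (+ 1))
          images = lin₂ (- (+ 1)) (+ 1) (proj₂ (proj₂ (proj₂ (proj₂ S₁)))) images≋ (lem' (proj₁ (proj₂ S₁)) f₀ (+ n * shift (+ 1) (+ 0)) (shift (+ 2) (+ 1)))
            where lem' : ∀ f g u v → u - v ≡ - (+ 1) * (f - (g + u)) + + 1 * (f - (g + v))
                  lem' = solve-∀
          slopes : Cong r (+ n * (p (i₀ - + 1) - p (i₀ - + 0)) * (+ 2 * ε) - (p (i₀ - + 2) - p (i₀ - + 1)) * (+ 2 * ε)) (- (y * (+ 2 * ε * (+ n * q - + 1))))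
          slopes = lin₂ (- (+ n * (+ 2 * ε))) (+ 2 * ε) down' down (lem'' (+ n) ε (p (i₀ - + 0)) (p (i₀ - + 1)) (p (i₀ - + 2)) y q)
            where lem'' : ∀ n e p₀ p₁ p₂ y q → n * (p₁ - p₀) * (+ 2 * e) - (p₂ - p₁) * (+ 2 * e) - - (y * (+ 2 * e * (n * q - + 1))) ≡
                    - (n * (+ 2 * e)) * (p₀ - (p₁ + y * q)) + + 2 * e * (p₁ - (p₂ + y))
                  lem'' = solve-∀
          lem : ∀ n e p₀ p₁ p₂ y q → y * (+ 2 * e * (n * q - + 1)) - + 0 ≡
            + 1 * (n * (p₁ - p₀) * (+ 2 * e) - (p₂ - p₁) * (+ 2 * e) - - (y * (+ 2 * e * (n * q - + 1)))) +
            - (+ 1) * (n * (+ 2 * e * p₁ - + 2 * e * p₀) - (+ 2 * e * p₂ - + 2 * e * p₁))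
          lem = solve-∀
        final : Cong r (q * q) (+ 1)
        final = lin₃ (h * ε) (q * + 1) (- (+ n * q - + 1)) (cancel-w (i₀ - + 2) scaled) (proj₂ N)
            (lin₂ {x = + 2 * h * (ε * ε)} {y = + 1} (ε * ε) (+ 1) 2h≋1 (≡⇒≋ (sgn²≡1 (e' I₀))) (lem₁' h ε)) (lem₂' h ε q (+ n))
          where
          lem₁' : ∀ h s → + 2 * h * (s * s) - + 1 ≡ s * s * (+ 2 * h - + 1) + + 1 * (s * s - + 1)
          lem₁' = solve-∀
          lem₂' : ∀ h e q n → q * q - + 1 ≡ h * e * (+ 2 * e * (n * q - + 1) - + 0) + q * + 1 * (q - n) + - (n * q - + 1) * (+ 2 * h * (e * e) - + 1)
          lem₂' = solve-∀

  key : ∀ α → IsAut Γ α → ∀ {u v} → F u v → F (α ⟨$⟩ʳ u) (α ⟨$⟩ʳ v)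
  key α mα {u} {v} f = [ (λ f' → f') , (λ f' → ⊥-elim (flip f f')) ]′ (∼⇒F (Equivalence.to (mα u v) (F⇒∼ f)))
    where
    open Image
    l₀ : ∀ j e x → j ≡ j - e * x + e * x
    l₀ = solve-∀
    reversed : ∀ {e a} (I : Image α e a) k → F (α ⟨$⟩ʳ ℓ e a (k + + 1)) (α ⟨$⟩ʳ ℓ e a k) → d I ≡ neg
    reversed {e} {a} I k (i' , j' , _ , x , y) = go (d I) (proj₁ (U-inj (trans (sym (maps I (k + + 1))) x))) (proj₁ (U-inj (trans (sym (maps I k)) y)))
      where
      lem : ∀ i k j → + 2 - + 0 ≡ + 1 * (i + + 1 * (k + + 1) - j) + - (+ 1) * (i + + 1 * k - (j + + 1))
      lem = solve-∀
      go : ∀ d → Cong 5 (i I + sgn d * (k + + 1)) i' → Cong 5 (i I + sgn d * k) (i' + + 1) → d ≡ neg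
      go (Fin.suc Fin.zero) _ _ = refl
      go Fin.zero c c' = ⊥-elim (3≤⇒2≢0 {5} (s≤s (s≤s (s≤s z≤n))) (lin₂ (+ 1) (- (+ 1)) c c' (lem (i I) k i')))
    flip : F u v → F (α ⟨$⟩ʳ v) (α ⟨$⟩ʳ u) → ⊥
    flip (i₀ , j₀ , e , x , y) f' = go e (image α mα e (j₀ - sgn e * p i₀)) (reversed {e} {j₀ - sgn e * p i₀} (image α mα e (j₀ - sgn e * p i₀)) i₀ (subst₂ (λ v u → F (α ⟨$⟩ʳ v) (α ⟨$⟩ʳ u)) v≡ u≡ f'))
      where
      u≡ : u ≡ ℓ e (j₀ - sgn e * p i₀) i₀
      u≡ = trans x (cong (U i₀) (l₀ j₀ (sgn e) (p i₀)))
      lem : ∀ j e x y w → j + e * w - (j - e * x + e * y) ≡ - e * (y - (x + w))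
      lem = solve-∀
      v≡ : v ≡ ℓ e (j₀ - sgn e * p i₀) (i₀ + + 1)
      v≡ = trans y (U-≋ ≋-refl (lin₁ (- sgn e) (p-suc i₀) (lem j₀ (sgn e) (p i₀) (p (i₀ + + 1)) (w i₀))))
      go : ∀ e {a} (I : Image α e a) → d I ≡ neg → ⊥
      go Fin.zero I dI = no-reversal α mα I dI
      -- A negative line meets the positive line of the same label in layer 0, where `p` vanishes.
      go (Fin.suc Fin.zero) {a} J dJ = no-reversal α mα (image α mα pos a)
          (trans (same-direction α mα {a} {a} {+ 0} (image α mα pos a) J (lin₁ (- (+ 2)) (p-zero α mα) (lem₂ a (p (+ 0))))) dJ)
        where lem₂ : ∀ a p → a - (a + + 2 * p) ≡ - (+ 2) * (p - + 0)
              lem₂ = solve-∀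

-- Classification

Pres⇒IsoXo : ∀ {Γ m r q q'} → 0 < m → 0 < r → Pres Γ m r q → Cong r q q' → IsoXo Γ m r q'
Pres⇒IsoXo {Γ} {m} {r} {q} {q'} 0<m 0<r P qq' = mkIso Γ 0<r (λ i → U (+ i)) (λ i c → U-≋ ≋-refl c)
    (λ i<m i'<m e → let (c , d) = U-inj e in ≋-small i<m i'<m c , d)
    (λ v → let (i , j , e) = U-onto v ; (a , c) = ≋-residue 0<m i in toℕ a , Finₚ.toℕ<n a , j , sym (trans e (U-≋ c ≋-refl)))
    (λ {i} {i'} {j} {j'} _ _ x → Sum.map (arc i j i' j') (arc i' j' i j) (adj⁻ x))
    (λ {i} {i'} {j} {j'} _ _ → step i j i' j')
  where
  open Pres P
  w≋ : ∀ i → Cong r (w (+ i)) (q' ^ i)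
  w≋ zero = w-0
  w≋ (suc i) = ≋-trans (≡⇒≋ (cong w (ℤₚ.+-comm (+ 1) (+ i)))) (≋-trans (w-suc (+ i)) (*-≋ qq' (w≋ i)))
  arc : ∀ i j i' j' → Step (+ i) j (+ i') j' → Arc m r q' i j i' j'
  arc i j i' j' (c , Fin.zero , d) = c , inj₁ (≋-trans d (+-≋ (≋-refl {x = j}) (≋-trans (≡⇒≋ (ℤₚ.*-identityˡ (w (+ i)))) (w≋ i))))
  arc i j i' j' (c , Fin.suc Fin.zero , d) = c , inj₂ (≋-trans d (+-≋ (≋-refl {x = j}) (≋-trans (≡⇒≋ (ℤₚ.-1*i≡-i (w (+ i)))) (neg-≋ (w≋ i)))))
  step : ∀ i j i' j' → Arc m r q' i j i' j' → _~_ Γ (U (+ i) j) (U (+ i') j')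
  step i j i' j' (c , d) = [ (λ d → go Fin.zero (≋-trans d (+-≋ (≋-refl {x = j}) (≋-trans (≋-sym (w≋ i)) (≡⇒≋ (sym (ℤₚ.*-identityˡ (w (+ i)))))))))
                           , (λ d → go (Fin.suc Fin.zero) (≋-trans d (+-≋ (≋-refl {x = j}) (≋-trans (neg-≋ (≋-sym (w≋ i))) (≡⇒≋ (sym (ℤₚ.-1*i≡-i (w (+ i))))))))) ]′ d
    where
    go : ∀ e → Cong r j' (j + sgn e * w (+ i)) → _~_ Γ (U (+ i) j) (U (+ i') j')
    go e d = subst (_~_ Γ (U (+ i) j)) (sym (U-≋ c d)) (adj⁺ (+ i) j e)

flip-sgn : ∀ e → ∃ λ f → sgn f ≡ - sgn e
flip-sgn Fin.zero = Fin.suc Fin.zero , refl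
flip-sgn (Fin.suc Fin.zero) = Fin.zero , refl

-- X_o(m,r;q) ≅ X_o(m,r;q⁻¹), by reversing the order of the layers.
reversePres : ∀ {Γ m r q q'} → Cong r (q * q') (+ 1) → Pres Γ m r q → Pres Γ m r q'
reversePres {Γ} {m} {r} {q} {q'} qq' P = record
  -- With the offset 1 the arcs between the new layers 0 and 1 are the old ones there, reversed, so
  -- the weights still start with `w 0`.
  { U = λ i j → U (+ 1 - i) j ; w = λ i → w (- i)
  ; w-≋ = λ c → w-≋ (neg-≋ c) ; w-0 = w-0 ; w-suc = w-suc'
  ; U-≋ = λ c d → U-≋ (+-≋ (≋-refl {x = + 1}) (neg-≋ c)) d
  ; U-inj = λ {i} {i'} e → let (c , d) = U-inj e in lin₁ (- (+ 1)) c (l₁ i i') , d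
  ; U-onto = λ v → let (i , j , e) = U-onto v in + 1 - i , j , trans e (cong (λ i → U i j) (l₂ i))
  ; adj⁺ = adj⁺' ; adj⁻ = λ {i} {j} {i'} {j'} h → Sum.swap (Sum.map (step i j i' j') (step i' j' i j) (adj⁻ h)) }
  where
  open Pres P
  l₁ : ∀ i i' → i - i' ≡ - (+ 1) * (+ 1 - i - (+ 1 - i'))
  l₁ = solve-∀
  l₂ : ∀ i → i ≡ + 1 - (+ 1 - i)
  l₂ = solve-∀
  l₃ : ∀ i → - (i + + 1) + + 1 ≡ - i
  l₃ = solve-∀
  l₄ : ∀ q q' x y → x - q' * y ≡ - q' * (y - q * x) + - x * (q * q' - + 1)
  l₄ = solve-∀
  w-suc' : ∀ i → Cong r (w (- (i + + 1))) (q' * w (- i))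
  w-suc' i = lin₂ (- q') (- w (- (i + + 1))) (≋-trans (≡⇒≋ (cong w (sym (l₃ i)))) (w-suc (- (i + + 1)))) qq' (l₄ q q' (w (- (i + + 1))) (w (- i)))
  l₅ : ∀ i → - i + + 1 ≡ + 1 - i
  l₅ = solve-∀
  l₆ : ∀ i → - i ≡ + 1 - (i + + 1)
  l₆ = solve-∀
  l₇ : ∀ j e w → j + e * w + - e * w ≡ j
  l₇ = solve-∀
  adj⁺' : ∀ i j e → _~_ Γ (U (+ 1 - i) j) (U (+ 1 - (i + + 1)) (j + sgn e * w (- i)))
  adj⁺' i j e = let (f , eq) = flip-sgn e in
    subst₂ (_~_ Γ) (cong₂ U (l₅ i) (trans (cong (λ s → j + sgn e * w (- i) + s * w (- i)) eq) (l₇ j (sgn e) (w (- i)))))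
      (cong (λ i' → U i' (j + sgn e * w (- i))) (l₆ i))
      (Graph.sym Γ _ _ (adj⁺ (- i) (j + sgn e * w (- i)) f))
  l₈ : ∀ i i' → i - (i' + + 1) ≡ + 1 * (+ 1 - i' - (+ 1 - i + + 1))
  l₈ = solve-∀
  l₉ : ∀ i i' → + 1 - i - - i' ≡ - (+ 1) * (i - (i' + + 1))
  l₉ = solve-∀
  l₀ : ∀ j j' e x y → j - (j' + - e * y) ≡ - (+ 1) * (j' - (j + e * x)) + - e * (x - y)
  l₀ = solve-∀
  step : ∀ i j i' j' → Step (+ 1 - i) j (+ 1 - i') j' → Cong m i (i' + + 1) × ∃ λ e → Cong r j (j' + sgn e * w (- i'))
  step i j i' j' (c , e , d) = let (f , eq) = flip-sgn e ; c' = lin₁ (+ 1) c (l₈ i i') in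
    c' , f , subst (λ s → Cong r j (j' + s * w (- i'))) (sym eq)
      (lin₂ (- (+ 1)) (- sgn e) d (w-≋ (lin₁ (- (+ 1)) c' (l₉ i i'))) (l₀ j j' (sgn e) (w (+ 1 - i)) (w (- i'))))

module NoSquare {Γ : Graph} {m r : ℕ} {q : ℤ} (P : Pres Γ m r q) (3≤m : 3 ≤ m) (3≤r : 3 ≤ r) (girth : Girth Γ 5) where
  open Pres P

  -- For q = ± 1 the step from layer 1 to layer 2 can undo the one before it, and U 0 0, U 1 1, U 2
  -- 0, U 1 (-1) form a 4-cycle.
  q≢± : ∀ s → ¬ Cong r q (sgn s)
  q≢± s c = proj₂ girth 4 (s≤s (s≤s (s≤s (s≤s (s≤s z≤n))))) (cycle₄ Γ
      (adj⁺ (+ 0) (+ 0) Fin.zero) (subst (_~_ Γ (U (+ 1) j₊)) (U-≋ ≋-refl top₊) (adj⁺ (+ 1) j₊ t))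
      (Graph.sym Γ _ _ (subst (_~_ Γ (U (+ 1) j₋)) (U-≋ ≋-refl top₋) (adj⁺ (+ 1) j₋ s)))
      (Graph.sym Γ _ _ (adj⁺ (+ 0) (+ 0) (Fin.suc Fin.zero)))
      (λ e → 3≤⇒2≢0 3≤m (≋-sym (proj₁ (U-inj e))))
      (λ e → 3≤⇒2≢0 3≤r (lin₂ (+ 1) (- (+ 2)) (proj₂ (U-inj e)) w-0 (l₁ (w (+ 0))))))
    where
    t : Fin 2
    t = proj₁ (flip-sgn s)
    j₊ j₋ : ℤ
    j₊ = + 0 + + 1 * w (+ 0)
    j₋ = + 0 + - (+ 1) * w (+ 0)
    l₁ : ∀ w → + 2 - + 0 ≡ + 1 * (+ 0 + + 1 * w - (+ 0 + - (+ 1) * w)) + - (+ 2) * (w - + 1)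
    l₁ = solve-∀
    w₁ : Cong r (w (+ 1)) (sgn s * w (+ 0))
    w₁ = ≋-trans (w-suc (+ 0)) (*-≋ c ≋-refl)
    l₂ : ∀ s x y → + 0 + + 1 * x + - s * y - + 0 ≡ - s * (y - s * x) + - x * (s * s - + 1)
    l₂ = solve-∀
    l₃ : ∀ s x y → + 0 + - (+ 1) * x + s * y - + 0 ≡ s * (y - s * x) + x * (s * s - + 1)
    l₃ = solve-∀
    top₊ : Cong r (j₊ + sgn t * w (+ 1)) (+ 0)
    top₊ = ≋-trans (≡⇒≋ (cong (λ z → j₊ + z * w (+ 1)) (proj₂ (flip-sgn s))))
      (lin₂ (- sgn s) (- w (+ 0)) w₁ (≡⇒≋ (sgn²≡1 s)) (l₂ (sgn s) (w (+ 0)) (w (+ 1))))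
    top₋ : Cong r (j₋ + sgn s * w (+ 1)) (+ 0)
    top₋ = lin₂ (sgn s) (w (+ 0)) w₁ (≡⇒≋ (sgn²≡1 s)) (l₃ (sgn s) (w (+ 0)) (w (+ 1)))

five-layers : ∀ {Γ r q} → Pres Γ 5 r q → 3 ≤ r → (h : ℤ) → Cong r (+ 2 * h) (+ 1) → Cong r (q * q * q * q * q) (+ 1) →
  ¬ Cong r q (+ 1) → Cycle Γ 5 → Cong r (+ 1 + q + q * q + q * q * q + q * q * q * q) (+ 0)
five-layers {Γ} {r} {q} P 3≤r h 2h≋1 q⁵ q≢1 C = go (five-cycle-directed (edges C 0) (edges C 1) (edges C 2) (edges C 3)
    (subst (_~_ Γ (vtx C 4)) (periodic C 0) (edges C 4)))
  where
  open Pres P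
  open Affine P (s≤s z≤n)
  open FiveWalks P
  lem : ∀ s q → + 1 + q + q * q + q * q * q + q * q * q * q - + 0 ≡
    s * (s + s * q + s * (q * q) + s * (q * q * q) + s * (q * q * q * q) - + 0) + - (+ 1 + q + q * q + q * q * q + q * q * q * q) * (s * s - + 1)
  lem = solve-∀
  sum : ∀ {v₀ v₁ v₂ v₃ v₄} → F v₀ v₁ → F v₁ v₂ → F v₂ v₃ → F v₃ v₄ → F v₄ v₀ → Cong r (+ 1 + q + q * q + q * q * q + q * q * q * q) (+ 0)
  sum f₀ f₁ f₂ f₃ f₄ = let (_ , _ , e₀ , e₁ , e₂ , e₃ , e₄ , _ , _ , _ , _ , _ , s) = winding-sum f₀ f₁ f₂ f₃ f₄ in
    collapse e₀ e₁ e₂ e₃ e₄ (signs-equal q⁵ h 2h≋1 q≢1 e₀ e₁ e₂ e₃ e₄ s) s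
    where
    collapse : ∀ e₀ e₁ e₂ e₃ e₄ → e₁ ≡ e₀ × e₂ ≡ e₀ × e₃ ≡ e₀ × e₄ ≡ e₀ →
      Cong r (sgn e₀ + sgn e₁ * q + sgn e₂ * (q * q) + sgn e₃ * (q * q * q) + sgn e₄ * (q * q * q * q)) (+ 0) →
      Cong r (+ 1 + q + q * q + q * q * q + q * q * q * q) (+ 0)
    collapse e₀ _ _ _ _ (refl , refl , refl , refl) s =
      lin₂ (sgn e₀) (- (+ 1 + q + q * q + q * q * q + q * q * q * q)) s (≡⇒≋ (sgn²≡1 e₀)) (lem (sgn e₀) q)
  v = vtx C
  go : (∃ λ d → Along d (v 0) (v 1) × Along d (v 1) (v 2) × Along d (v 2) (v 3) × Along d (v 3) (v 4) × Along d (v 4) (v 0)) → Cong r (+ 1 + q + q * q + q * q * q + q * q * q * q) (+ 0)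
  go (Fin.zero , a₀ , a₁ , a₂ , a₃ , a₄) = sum a₀ a₁ a₂ a₃ a₄
  go (Fin.suc Fin.zero , a₀ , a₁ , a₂ , a₃ , a₄) = sum a₃ a₂ a₁ a₀ a₄

-- On three layers, exactly one step of a closed walk of length 5 is against the others.
detour : ∀ d₀ d₁ d₂ d₃ d₄ → 3 ℕD.∣ ℤ.∣ sgn d₀ + sgn d₁ + sgn d₂ + sgn d₃ + sgn d₄ ∣ → ∃ λ d → ∃ λ d' → sgn d' ≡ - sgn d ×
  ( (d₀ ≡ d × d₁ ≡ d × d₂ ≡ d × d₃ ≡ d × d₄ ≡ d')
  ⊎ (d₁ ≡ d × d₂ ≡ d × d₃ ≡ d × d₄ ≡ d × d₀ ≡ d')
  ⊎ (d₂ ≡ d × d₃ ≡ d × d₄ ≡ d × d₀ ≡ d × d₁ ≡ d')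
  ⊎ (d₃ ≡ d × d₄ ≡ d × d₀ ≡ d × d₁ ≡ d × d₂ ≡ d')
  ⊎ (d₄ ≡ d × d₀ ≡ d × d₁ ≡ d × d₂ ≡ d × d₃ ≡ d'))
detour = Dec.toWitness {a? = Finₚ.all? λ d₀ → Finₚ.all? λ d₁ → Finₚ.all? λ d₂ → Finₚ.all? λ d₃ → Finₚ.all? λ d₄ →
  (3 ℕD.∣? ℤ.∣ sgn d₀ + sgn d₁ + sgn d₂ + sgn d₃ + sgn d₄ ∣) →-dec Finₚ.any? λ d → Finₚ.any? λ d' → (sgn d' ℤ.≟ - sgn d) ×-dec
  ( ((d₀ Fin.≟ d) ×-dec ((d₁ Fin.≟ d) ×-dec ((d₂ Fin.≟ d) ×-dec ((d₃ Fin.≟ d) ×-dec (d₄ Fin.≟ d')))))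
  ⊎-dec ((d₁ Fin.≟ d) ×-dec ((d₂ Fin.≟ d) ×-dec ((d₃ Fin.≟ d) ×-dec ((d₄ Fin.≟ d) ×-dec (d₀ Fin.≟ d')))))
  ⊎-dec ((d₂ Fin.≟ d) ×-dec ((d₃ Fin.≟ d) ×-dec ((d₄ Fin.≟ d) ×-dec ((d₀ Fin.≟ d) ×-dec (d₁ Fin.≟ d')))))
  ⊎-dec ((d₃ Fin.≟ d) ×-dec ((d₄ Fin.≟ d) ×-dec ((d₀ Fin.≟ d) ×-dec ((d₁ Fin.≟ d) ×-dec (d₂ Fin.≟ d')))))
  ⊎-dec ((d₄ Fin.≟ d) ×-dec ((d₀ Fin.≟ d) ×-dec ((d₁ Fin.≟ d) ×-dec ((d₂ Fin.≟ d) ×-dec (d₃ Fin.≟ d'))))))} _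

module ThreeLayers {Γ : Graph} {r : ℕ} {q : ℤ} (P : Pres Γ 3 r q) (3≤r : 3 ≤ r) (h : ℤ) (2h≋1 : Cong r (+ 2 * h) (+ 1))
  (q³ : Cong r (q * q * q) (+ 1)) (q≢1 : ¬ Cong r q (+ 1)) where
  open Pres P
  open Affine P (s≤s z≤n)
  open Walks P (s≤s z≤n)

  Outcome : Set
  Outcome = r ≡ 9 × (Cong r q (+ 4) ⊎ Cong r q (+ 7))

  private
    divisors : ∀ (c : Fin 10) → toℕ c ℕD.∣ 9 → toℕ c ≡ 1 ⊎ toℕ c ≡ 3 ⊎ toℕ c ≡ 9
    divisors = Dec.toWitness {a? = Finₚ.all? λ c → (toℕ c ℕD.∣? 9) →-dec ((toℕ c ℕ.≟ 1) ⊎-dec ((toℕ c ℕ.≟ 3) ⊎-dec (toℕ c ℕ.≟ 9)))} _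

    r∈ : Cong r (+ 9) (+ 0) → r ≡ 3 ⊎ r ≡ 9
    r∈ c = go (subst (λ n → n ℕD.∣ 9 → n ≡ 1 ⊎ n ≡ 3 ⊎ n ≡ 9) (Finₚ.toℕ-fromℕ< r<10) (divisors (Fin.fromℕ< r<10)) r∣9)
      where
      r∣9 : r ℕD.∣ 9
      r∣9 = ≋0⇒∣ c
      r<10 : r < 10
      r<10 = s≤s (ℕD.∣⇒≤ r∣9)
      go : r ≡ 1 ⊎ r ≡ 3 ⊎ r ≡ 9 → r ≡ 3 ⊎ r ≡ 9
      go (inj₁ e) = ⊥-elim (ℕₚ.<⇒≱ (ℕ.s≤s (ℕₚ.≤-reflexive e)) (ℕₚ.≤-trans (s≤s (s≤s z≤n)) 3≤r))
      go (inj₂ e) = e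

    -- From 2 q = -1 and q³ = 1 one gets 9 = 0. Modulo 3 this means q = 1, modulo 9 it means q = 4.
    plusMinus : Cong r (+ 2 * q + + 1) (+ 0) → Outcome
    plusMinus c = [ (λ e → ⊥-elim (three e c q≢1)) , (λ e → e , inj₁ (nine e c)) ]′ (r∈ (lin₂ (- (+ 8)) (+ 4 * (q * q) - + 2 * q + + 1) q³ c (lem q)))
      where
      lem : ∀ q → + 9 - + 0 ≡ - (+ 8) * (q * q * q - + 1) + (+ 4 * (q * q) - + 2 * q + + 1) * (+ 2 * q + + 1 - + 0)
      lem = solve-∀
      three : ∀ {r} → r ≡ 3 → Cong r (+ 2 * q + + 1) (+ 0) → ¬ Cong r q (+ 1) → ⊥
      three refl c ne = ne (lin₂ (- (+ 1)) (q) c (r≋0 {3}) (lem₂ q))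
        where lem₂ : ∀ q → q - + 1 ≡ - (+ 1) * (+ 2 * q + + 1 - + 0) + q * (+ 3 - + 0)
              lem₂ = solve-∀
      nine : ∀ {r} → r ≡ 9 → Cong r (+ 2 * q + + 1) (+ 0) → Cong r q (+ 4)
      nine refl c = lin₂ (+ 5) (- (q + + 1)) c (r≋0 {9}) (lem₂ q)
        where lem₂ : ∀ q → q - + 4 ≡ + 5 * (+ 2 * q + + 1 - + 0) + - (q + + 1) * (+ 9 - + 0)
              lem₂ = solve-∀

    -- Now q = -2, and q³ = 1 again gives 9 = 0. The solution 7 is the inverse of 4 modulo 9, so it
    -- belongs to the same graph.
    minusPlus : Cong r (q + + 2) (+ 0) → Outcome
    minusPlus c = [ (λ e → ⊥-elim (three e c q≢1)) , (λ e → e , inj₂ (nine e c)) ]′ (r∈ (lin₂ (- (+ 1)) (q * q - + 2 * q + + 4) q³ c (lem q)))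
      where
      lem : ∀ q → + 9 - + 0 ≡ - (+ 1) * (q * q * q - + 1) + (q * q - + 2 * q + + 4) * (q + + 2 - + 0)
      lem = solve-∀
      three : ∀ {r} → r ≡ 3 → Cong r (q + + 2) (+ 0) → ¬ Cong r q (+ 1) → ⊥
      three refl c ne = ne (lin₂ (+ 1) (- (+ 1)) c (r≋0 {3}) (lem₂ q))
        where lem₂ : ∀ q → q - + 1 ≡ + 1 * (q + + 2 - + 0) + - (+ 1) * (+ 3 - + 0)
              lem₂ = solve-∀
      nine : ∀ {r} → r ≡ 9 → Cong r (q + + 2) (+ 0) → Cong r q (+ 7)
      nine refl c = lin₂ (+ 1) (- (+ 1)) c (r≋0 {9}) (lem₂ q)
        where lem₂ : ∀ q → q - + 7 ≡ + 1 * (q + + 2 - + 0) + - (+ 1) * (+ 9 - + 0)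
              lem₂ = solve-∀

    -- With q³ = 1, the factor q - 1 turns 3 + q + q² into 2 (q - 1) and 3 - q - q² into 4 (q - 1);
    -- the factor q + 1 turns 3 + q - q² into 2 (2 q + 1) and 3 - q + q² into 2 (q + 2).
    solve₃ : ∀ e₀ e₁ e₂ → Cong r (+ 3 * sgn e₀ + sgn e₁ * q + sgn e₂ * (q * q)) (+ 0) → Outcome
    solve₃ Fin.zero e₁ e₂ c = go e₁ e₂ c
      where
      l₁ : ∀ h q → q - + 1 ≡ h * (q - + 1) * (+ 3 * + 1 + + 1 * q + + 1 * (q * q) - + 0) + - h * (q * q * q - + 1) + - (q - + 1) * (+ 2 * h - + 1)
      l₁ = solve-∀
      l₂ : ∀ h q → q - + 1 ≡ h * h * (q - + 1) * (+ 3 * + 1 + - (+ 1) * q + - (+ 1) * (q * q) - + 0) + h * h * (q * q * q - + 1) + - ((q - + 1) * (+ 2 * h + + 1)) * (+ 2 * h - + 1)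
      l₂ = solve-∀
      l₃ : ∀ h q → + 2 * q + + 1 - + 0 ≡ h * (+ 1 + q) * (+ 3 * + 1 + + 1 * q + - (+ 1) * (q * q) - + 0) + h * (q * q * q - + 1) + - (+ 2 * q + + 1) * (+ 2 * h - + 1)
      l₃ = solve-∀
      l₄ : ∀ h q → q + + 2 - + 0 ≡ h * (+ 1 + q) * (+ 3 * + 1 + - (+ 1) * q + + 1 * (q * q) - + 0) + - h * (q * q * q - + 1) + - (q + + 2) * (+ 2 * h - + 1)
      l₄ = solve-∀
      go : ∀ e₁ e₂ → Cong r (+ 3 * + 1 + sgn e₁ * q + sgn e₂ * (q * q)) (+ 0) → Outcome
      go Fin.zero Fin.zero c = ⊥-elim (q≢1 (lin₃ (h * (q - + 1)) (- h) (- (q - + 1)) c q³ 2h≋1 (l₁ h q)))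
      go Fin.zero (Fin.suc Fin.zero) c = plusMinus (lin₃ (h * (+ 1 + q)) h (- (+ 2 * q + + 1)) c q³ 2h≋1 (l₃ h q))
      go (Fin.suc Fin.zero) Fin.zero c = minusPlus (lin₃ (h * (+ 1 + q)) (- h) (- (q + + 2)) c q³ 2h≋1 (l₄ h q))
      go (Fin.suc Fin.zero) (Fin.suc Fin.zero) c = ⊥-elim (q≢1 (lin₃ (h * h * (q - + 1)) (h * h) (- ((q - + 1) * (+ 2 * h + + 1))) c q³ 2h≋1 (l₂ h q)))
    solve₃ (Fin.suc Fin.zero) e₁ e₂ c = let (f₁ , x₁) = flip-sgn e₁ ; (f₂ , x₂) = flip-sgn e₂ in
        solve₃ Fin.zero f₁ f₂ (subst₂ (λ u v → Cong r (+ 3 * + 1 + u * q + v * (q * q)) (+ 0)) (sym x₁) (sym x₂)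
          (lin₁ (- (+ 1)) c (lem (sgn e₁) (sgn e₂) q)))
      where lem : ∀ u v q → + 3 * + 1 + - u * q + - v * (q * q) - + 0 ≡ - (+ 1) * (+ 3 * - (+ 1) + u * q + v * (q * q) - + 0)
            lem = solve-∀

    same? : ∀ e f → e ≡ f ⊎ sgn f ≡ - sgn e
    same? Fin.zero Fin.zero = inj₁ refl
    same? Fin.zero (Fin.suc Fin.zero) = inj₂ refl
    same? (Fin.suc Fin.zero) Fin.zero = inj₂ refl
    same? (Fin.suc Fin.zero) (Fin.suc Fin.zero) = inj₁ refl

  -- As v₁ ≠ v₄, the signs e₀ and e₄ are opposite; as v₃ lies in the layer of v₀ but differs from
  -- it, so are e₃ and e₄. The three equal contributions e₀, e₃, - e₄ make up the coefficient 3.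
  forward₄ : ∀ {v₀ v₁ v₂ v₃ v₄} → F v₀ v₁ → F v₁ v₂ → F v₂ v₃ → F v₃ v₄ → F v₀ v₄ → v₁ ≢ v₄ → v₀ ≢ v₃ → Outcome
  forward₄ {v₀} {v₁} {v₂} {v₃} {v₄} (i , j , e₀ , x₀ , y₁) f₁ f₂ f₃ f₄ v₁≢v₄ v₀≢v₃ =
    let (e₁ , y₂) = follow y₁ f₁ ; (e₂ , y₃) = follow y₂ f₂ ; (e₃ , y₄) = follow y₃ f₃ ; (e₄ , z₄) = follow x₀ f₄
    in go e₁ e₂ e₃ e₄ y₃ z₄ (same? e₀ e₄) (same? e₃ e₄) (proj₂ (U-inj (trans (sym y₄) z₄)))
    where
    i₃ : Cong 3 (i + + 1 + + 1 + + 1) i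
    i₃ = by (+ 1) (lem i)
      where lem : ∀ i → i + + 1 + + 1 + + 1 ≡ i + + 1 * + 3
            lem = solve-∀
    w₁ : Cong r (w (i + + 1)) (q * w i)
    w₁ = w-suc i
    w₂ : Cong r (w (i + + 1 + + 1)) (q * q * w i)
    w₂ = ≋-trans (w-suc (i + + 1)) (≋-trans (*-≋ (≋-refl {x = q}) w₁) (≡⇒≋ (sym (ℤₚ.*-assoc q q (w i)))))
    w₃ : Cong r (w (i + + 1 + + 1 + + 1)) (w i)
    w₃ = w-≋ i₃
    l₁ : ∀ j e₀ e₁ e₂ e₃ e₄ W₀ W₁ W₂ W₃ → e₃ ≡ e₄ → j + e₀ * W₀ + e₁ * W₁ + e₂ * W₂ - j ≡
      + 1 * (j + e₀ * W₀ + e₁ * W₁ + e₂ * W₂ + e₃ * W₃ - (j + e₄ * W₀)) + - e₃ * (W₃ - W₀)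
    l₁ j e₀ e₁ e₂ e₃ _ W₀ W₁ W₂ W₃ refl = lem j e₀ e₁ e₂ e₃ W₀ W₁ W₂ W₃
      where lem : ∀ j e₀ e₁ e₂ e₃ W₀ W₁ W₂ W₃ → j + e₀ * W₀ + e₁ * W₁ + e₂ * W₂ - j ≡
              + 1 * (j + e₀ * W₀ + e₁ * W₁ + e₂ * W₂ + e₃ * W₃ - (j + e₃ * W₀)) + - e₃ * (W₃ - W₀)
            lem = solve-∀
    l₂ : ∀ j e₀ e₁ e₂ e₃ e₄ W₀ W₁ W₂ W₃ q → e₄ ≡ - e₀ → e₄ ≡ - e₃ → W₀ * (+ 3 * e₀ + e₁ * q + e₂ * (q * q)) - + 0 ≡
      + 1 * (j + e₀ * W₀ + e₁ * W₁ + e₂ * W₂ + e₃ * W₃ - (j + e₄ * W₀)) + - (+ 1) * (e₁ * W₁ + e₂ * W₂ - (e₁ * (q * W₀) + e₂ * (q * q * W₀))) + - e₀ * (W₃ - W₀)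
    l₂ j e₀ e₁ e₂ e₃ e₄ W₀ W₁ W₂ W₃ q p p' = subst₂ (λ x y → W₀ * (+ 3 * e₀ + e₁ * q + e₂ * (q * q)) - + 0 ≡
        + 1 * (j + e₀ * W₀ + e₁ * W₁ + e₂ * W₂ + x * W₃ - (j + y * W₀)) + - (+ 1) * (e₁ * W₁ + e₂ * W₂ - (e₁ * (q * W₀) + e₂ * (q * q * W₀))) + - e₀ * (W₃ - W₀))
        (ℤₚ.neg-injective (trans (sym p) p')) (sym p) (lem j e₀ e₁ e₂ W₀ W₁ W₂ W₃ q)
      where lem : ∀ j e₀ e₁ e₂ W₀ W₁ W₂ W₃ q → W₀ * (+ 3 * e₀ + e₁ * q + e₂ * (q * q)) - + 0 ≡
              + 1 * (j + e₀ * W₀ + e₁ * W₁ + e₂ * W₂ + e₀ * W₃ - (j + - e₀ * W₀)) + - (+ 1) * (e₁ * W₁ + e₂ * W₂ - (e₁ * (q * W₀) + e₂ * (q * q * W₀))) + - e₀ * (W₃ - W₀)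
            lem = solve-∀
    cancel : ∀ {x} → Cong r (w i * x) (+ 0) → Cong r x (+ 0)
    cancel {x} c = lin₂ (- x) (w (- i)) (w-inv i) c (lem (w i) (w (- i)) x)
      where lem : ∀ w v x → x - + 0 ≡ - x * (w * v - + 1) + v * (w * x - + 0)
            lem = solve-∀
    go : ∀ e₁ e₂ e₃ e₄ → v₃ ≡ U (i + + 1 + + 1 + + 1) (j + sgn e₀ * w i + sgn e₁ * w (i + + 1) + sgn e₂ * w (i + + 1 + + 1)) →
      v₄ ≡ U (i + + 1) (j + sgn e₄ * w i) → e₀ ≡ e₄ ⊎ sgn e₄ ≡ - sgn e₀ → e₃ ≡ e₄ ⊎ sgn e₄ ≡ - sgn e₃ →
      Cong r (j + sgn e₀ * w i + sgn e₁ * w (i + + 1) + sgn e₂ * w (i + + 1 + + 1) + sgn e₃ * w (i + + 1 + + 1 + + 1)) (j + sgn e₄ * w i) → Outcome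
    go e₁ e₂ e₃ e₄ y₃ z₄ (inj₁ refl) _ _ = ⊥-elim (v₁≢v₄ (trans y₁ (sym z₄)))
    go e₁ e₂ e₃ e₄ y₃ z₄ (inj₂ _) (inj₁ p) c = ⊥-elim (v₀≢v₃ (trans x₀ (sym (trans y₃ (U-≋ i₃
      (lin₂ (+ 1) (- sgn e₃) c w₃ (l₁ j (sgn e₀) (sgn e₁) (sgn e₂) (sgn e₃) (sgn e₄) (w i) (w (i + + 1)) (w (i + + 1 + + 1)) (w (i + + 1 + + 1 + + 1)) (cong sgn p))))))))
    go e₁ e₂ e₃ e₄ y₃ z₄ (inj₂ p) (inj₂ p') c = solve₃ e₀ e₁ e₂ (cancel (lin₃ (+ 1) (- (+ 1)) (- sgn e₀) c
      (+-≋ (*-≋ (≋-refl {x = sgn e₁}) w₁) (*-≋ (≋-refl {x = sgn e₂}) w₂)) w₃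
      (l₂ j (sgn e₀) (sgn e₁) (sgn e₂) (sgn e₃) (sgn e₄) (w i) (w (i + + 1)) (w (i + + 1 + + 1)) (w (i + + 1 + + 1 + + 1)) q p p')))

  detour₅ : ∀ {v₀ v₁ v₂ v₃ v₄} d d' → sgn d' ≡ - sgn d → Along d v₀ v₁ → Along d v₁ v₂ → Along d v₂ v₃ → Along d v₃ v₄ → Along d' v₄ v₀ →
    v₁ ≢ v₄ → v₀ ≢ v₃ → Outcome
  detour₅ Fin.zero (Fin.suc Fin.zero) _ f₀ f₁ f₂ f₃ f₄ n₁ n₂ = forward₄ f₀ f₁ f₂ f₃ f₄ n₁ n₂
  detour₅ (Fin.suc Fin.zero) Fin.zero _ f₀ f₁ f₂ f₃ f₄ n₁ n₂ = forward₄ f₃ f₂ f₁ f₀ f₄ (n₂ ∘ sym) (n₁ ∘ sym)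

  three-layers : Cycle Γ 5 → Outcome
  three-layers C =
    let (d₀ , d₁ , d₂ , d₃ , d₄ , a₀ , a₁ , a₂ , a₃ , a₄ , c) = closed-walk (edges C 0) (edges C 1) (edges C 2) (edges C 3)
          (subst (_~_ Γ (v 4)) (periodic C 0) (edges C 4))
        (d , d' , o , cases) = detour d₀ d₁ d₂ d₃ d₄ c
    in go d d' o cases a₀ a₁ a₂ a₃ a₄
    where
    v = vtx C
    ne : ∀ i j → i < 5 → j < 5 → i ≢ j → v i ≢ v j
    ne i j i<5 j<5 i≢j e = i≢j (distinct C i j i<5 j<5 e)
    0<5 : 0 < 5
    0<5 = s≤s z≤n
    1<5 : 1 < 5
    1<5 = s≤s (s≤s z≤n)
    2<5 : 2 < 5
    2<5 = s≤s (s≤s (s≤s z≤n))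
    3<5 : 3 < 5
    3<5 = s≤s (s≤s (s≤s (s≤s z≤n)))
    4<5 : 4 < 5
    4<5 = s≤s (s≤s (s≤s (s≤s (s≤s z≤n))))
    go : ∀ {d₀ d₁ d₂ d₃ d₄} d d' → sgn d' ≡ - sgn d →
      ( (d₀ ≡ d × d₁ ≡ d × d₂ ≡ d × d₃ ≡ d × d₄ ≡ d')
      ⊎ (d₁ ≡ d × d₂ ≡ d × d₃ ≡ d × d₄ ≡ d × d₀ ≡ d')
      ⊎ (d₂ ≡ d × d₃ ≡ d × d₄ ≡ d × d₀ ≡ d × d₁ ≡ d')
      ⊎ (d₃ ≡ d × d₄ ≡ d × d₀ ≡ d × d₁ ≡ d × d₂ ≡ d')
      ⊎ (d₄ ≡ d × d₀ ≡ d × d₁ ≡ d × d₂ ≡ d × d₃ ≡ d')) →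
      Along d₀ (v 0) (v 1) → Along d₁ (v 1) (v 2) → Along d₂ (v 2) (v 3) → Along d₃ (v 3) (v 4) → Along d₄ (v 4) (v 0) → Outcome
    go d d' o (inj₁ (refl , refl , refl , refl , refl)) a₀ a₁ a₂ a₃ a₄ =
      detour₅ d d' o a₀ a₁ a₂ a₃ a₄ (ne 1 4 1<5 4<5 λ ()) (ne 0 3 0<5 3<5 λ ())
    go d d' o (inj₂ (inj₁ (refl , refl , refl , refl , refl))) a₀ a₁ a₂ a₃ a₄ =
      detour₅ d d' o a₁ a₂ a₃ a₄ a₀ (ne 2 0 2<5 0<5 λ ()) (ne 1 4 1<5 4<5 λ ())
    go d d' o (inj₂ (inj₂ (inj₁ (refl , refl , refl , refl , refl)))) a₀ a₁ a₂ a₃ a₄ =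
      detour₅ d d' o a₂ a₃ a₄ a₀ a₁ (ne 3 1 3<5 1<5 λ ()) (ne 2 0 2<5 0<5 λ ())
    go d d' o (inj₂ (inj₂ (inj₂ (inj₁ (refl , refl , refl , refl , refl))))) a₀ a₁ a₂ a₃ a₄ =
      detour₅ d d' o a₃ a₄ a₀ a₁ a₂ (ne 4 2 4<5 2<5 λ ()) (ne 3 1 3<5 1<5 λ ())
    go d d' o (inj₂ (inj₂ (inj₂ (inj₂ (refl , refl , refl , refl , refl))))) a₀ a₁ a₂ a₃ a₄ =
      detour₅ d d' o a₄ a₀ a₁ a₂ a₃ (ne 0 3 0<5 3<5 λ ()) (ne 4 2 4<5 2<5 λ ())

IsoFive : Graph → Set
IsoFive Γ = Σ ℕ λ r → Σ (Fin r) λ q → ¬ (2 ∣ r) × 3 ≤ r ×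
  ¬ ((+ toℕ q) ≡[mod r ] (+ 1)) × ¬ ((+ toℕ q) ≡[mod r ] (- (+ 1))) ×
  (((+ 1) ℤ.+ (+ toℕ q) ℤ.+ ((+ toℕ q) ℤ.^ 2) ℤ.+ ((+ toℕ q) ℤ.^ 3) ℤ.+ ((+ toℕ q) ℤ.^ 4)) ≡[mod r ] (+ 0)) ×
  IsoXo Γ 5 r (+ toℕ q)

TightHAT : (Γ : Graph) → Subgroup Γ → Set
TightHAT Γ G = HalfArcTransitiveOn Γ (mem G) × TightlyAttached Γ G

module FromFive {Γ : Graph} (iso : IsoFive Γ) where
  private
    r : ℕ
    r = proj₁ iso
    q : ℤ
    q = + toℕ (proj₁ (proj₂ iso))
    odd : ¬ (2 ∣ r)
    odd = proj₁ (proj₂ (proj₂ iso))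
    3≤r : 3 ≤ r
    3≤r = proj₁ (proj₂ (proj₂ (proj₂ iso)))
    q≢1 : ¬ Cong r q (+ 1)
    q≢1 c = proj₁ (proj₂ (proj₂ (proj₂ (proj₂ iso)))) (≋⇒mod c)
    S≋0 : Cong r (+ 1 + q + q * q + q * q * q + q * q * q * q) (+ 0)
    S≋0 = ≋-trans (≡⇒≋ (lem q)) (mod⇒≋ (proj₁ (proj₂ (proj₂ (proj₂ (proj₂ (proj₂ (proj₂ iso))))))))
      where lem : ∀ q → + 1 + q + q * q + q * q * q + q * q * q * q ≡ + 1 + q + q * (q * + 1) + q * (q * (q * + 1)) + q * (q * (q * (q * + 1)))
            lem = solve-∀
    q^5 : Cong r (q ^ 5) (+ 1)
    q^5 = ≋-trans (≡⇒≋ (lem q)) (FifthRoot.q⁵≋1 3≤r q≢1 S≋0)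
      where lem : ∀ q → q * (q * (q * (q * (q * + 1)))) ≡ q * q * q * q * q
            lem = solve-∀
    P : Pres Γ 5 r q
    P = IsoXo⇒Pres (s≤s z≤n) (ℕₚ.≤-trans (s≤s z≤n) 3≤r) q^5 (proj₂ (proj₂ (proj₂ (proj₂ (proj₂ (proj₂ (proj₂ iso)))))))
    2⁻¹ = half odd
    3≤5 : 3 ≤ 5
    3≤5 = s≤s (s≤s (s≤s z≤n))
    key₅ = FiveLayers.key P 3≤r (proj₁ 2⁻¹) (proj₂ 2⁻¹) q≢1 S≋0
    module Q = Consequences P (s≤s z≤n) 3≤5 3≤r (proj₁ 2⁻¹) (proj₂ 2⁻¹) key₅
    open Affine P (s≤s z≤n)
    open FiveWalks P

  tightHAT : TightHAT Γ (Aut Γ)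
  tightHAT = Q.half-arc-transitive , Q.tightly-attached

  -- Elements of any `G` are automorphisms, so `key₅` compares the orientation induced by `G` with
  -- the layers, around which every 5-cycle winds.
  all-directed : ∀ (G : Subgroup Γ) → HalfArcTransitiveOn Γ (mem G) → ∀ {a b} → _~_ Γ a b → (C : Cycle Γ 5) → Directed Γ (Oriented Γ (mem G) a b) C
  all-directed G hat {a} {b} ab C i = [ same , opposite ]′ (∼⇒F ab)
    where
    v = vtx C
    O = Oriented Γ (mem G) a b
    auts = IsSubgroup.auts (isSub G)
    along : ∃ λ d → ∀ i → Along d (v i) (v (suc i))
    along = let (d , a₀ , a₁ , a₂ , a₃ , a₄) = five-cycle-directed (edges C 0) (edges C 1) (edges C 2) (edges C 3)
                   (subst (_~_ Γ (v 4)) (periodic C 0) (edges C 4)) in d , go d a₀ a₁ a₂ a₃ a₄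
      where
      go : ∀ d → Along d (v 0) (v 1) → Along d (v 1) (v 2) → Along d (v 2) (v 3) → Along d (v 3) (v 4) → Along d (v 4) (v 0) → ∀ i → Along d (v i) (v (suc i))
      go d a₀ a₁ a₂ a₃ a₄ 0 = a₀
      go d a₀ a₁ a₂ a₃ a₄ 1 = a₁
      go d a₀ a₁ a₂ a₃ a₄ 2 = a₂
      go d a₀ a₁ a₂ a₃ a₄ 3 = a₃
      go d a₀ a₁ a₂ a₃ a₄ 4 = subst (Along d (v 4)) (sym (periodic C 0)) a₄
      go d a₀ a₁ a₂ a₃ a₄ (suc (suc (suc (suc (suc i))))) = subst₂ (Along d) (shift i) (shift (suc i)) (go d a₀ a₁ a₂ a₃ a₄ i)
        where
        shift : ∀ i → v i ≡ v (5 ℕ.+ i)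
        shift i = trans (sym (periodic C i)) (cong v (ℕₚ.+-comm i 5))
    orient : ∀ {x y} → _~_ Γ x y → O x y ⊎ O y x
    orient xy = [ (λ { (e , f) → inj₁ (_ , proj₁ (proj₂ (ET xy)) , e , f) }) , (λ { (e , f) → inj₂ (_ , proj₁ (proj₂ (ET xy)) , e , f) }) ]′ (proj₂ (proj₂ (ET xy)))
      where
      ET : ∀ {x y} → _~_ Γ x y → ∃ λ g → mem G g × ((g ⟨$⟩ʳ a ≡ x × g ⟨$⟩ʳ b ≡ y) ⊎ (g ⟨$⟩ʳ a ≡ y × g ⟨$⟩ʳ b ≡ x))
      ET {x} {y} xy = proj₁ (proj₂ hat) a b x y ab xy
    -- O agrees with F or with its reverse; in both cases it is constant along C.
    constant : (∀ {x y} → O x y → F x y) ⊎ (∀ {x y} → O x y → F y x) → O (v i) (v (suc i)) ⇔ O (v (suc i)) (v (suc (suc i)))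
    constant agree = mk⇔ (λ o → pick agree (proj₁ along) (proj₂ along i) (proj₂ along (suc i)) o (orient (edges C (suc i))))
                         (λ o → pick' agree (proj₁ along) (proj₂ along i) (proj₂ along (suc i)) o (orient (edges C i)))
      where
      x = v i
      y = v (suc i)
      z = v (suc (suc i))
      pick : (∀ {x y} → O x y → F x y) ⊎ (∀ {x y} → O x y → F y x) → ∀ d → Along d x y → Along d y z → O x y → O y z ⊎ O z y → O y z
      pick _ _ _ _ _ (inj₁ o') = o'
      pick (inj₁ t) Fin.zero f f' o (inj₂ o') = ⊥-elim (Q.F-excl f' (t o'))
      pick (inj₁ t) (Fin.suc Fin.zero) f f' o (inj₂ o') = ⊥-elim (Q.F-excl f (t o))
      pick (inj₂ t) Fin.zero f f' o (inj₂ o') = ⊥-elim (Q.F-excl f (t o))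
      pick (inj₂ t) (Fin.suc Fin.zero) f f' o (inj₂ o') = ⊥-elim (Q.F-excl f' (t o'))
      pick' : (∀ {x y} → O x y → F x y) ⊎ (∀ {x y} → O x y → F y x) → ∀ d → Along d x y → Along d y z → O y z → O x y ⊎ O y x → O x y
      pick' _ _ _ _ _ (inj₁ o') = o'
      pick' (inj₁ t) Fin.zero f f' o (inj₂ o') = ⊥-elim (Q.F-excl f (t o'))
      pick' (inj₁ t) (Fin.suc Fin.zero) f f' o (inj₂ o') = ⊥-elim (Q.F-excl f' (t o))
      pick' (inj₂ t) Fin.zero f f' o (inj₂ o') = ⊥-elim (Q.F-excl f' (t o))
      pick' (inj₂ t) (Fin.suc Fin.zero) f f' o (inj₂ o') = ⊥-elim (Q.F-excl f (t o'))
    same : F a b → O (v i) (v (suc i)) ⇔ O (v (suc i)) (v (suc (suc i)))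
    same f = constant (inj₁ λ { (g , mg , refl , refl) → key₅ g (auts g mg) f })
    opposite : F b a → O (v i) (v (suc i)) ⇔ O (v (suc i)) (v (suc (suc i)))
    opposite f = constant (inj₂ λ { (g , mg , refl , refl) → key₅ g (auts g mg) f })

module FromDoyleHolt {Γ : Graph} (iso : IsoXo Γ 3 9 (+ 4)) where
  private
    P : Pres Γ 3 9 (+ 4)
    -- 4³ = 64 = 1 + 7 * 9.
    P = IsoXo⇒Pres (s≤s z≤n) (s≤s z≤n) (by (+ 7) refl) iso
    module D = DoyleHolt P
    open Affine P (s≤s z≤n)
    module Q = Consequences P (s≤s z≤n) (s≤s (s≤s (s≤s z≤n))) (s≤s (s≤s (s≤s z≤n))) (+ 5) (by (+ 1) refl) D.key

  tightHAT : TightHAT Γ (Aut Γ)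
  tightHAT = Q.half-arc-transitive , Q.tightly-attached

  undirected : HasUndirected5Cycle Γ (Aut Γ)
  undirected = let (f , f') = D.pentagon-arcs in _ , _ , F⇒∼ f , D.pentagon ,
    λ dir → Q.F-excl f' (Q.Oriented⇒F f (Equivalence.to (dir 3) (F-transitive f f)))

classification : (Γ : Graph) → Tetravalent Γ → Connected Γ → Girth Γ 5 → (G : Subgroup Γ) → TightHAT Γ G →
  IsoXo Γ 3 9 (+ 4) ⊎ IsoFive Γ
classification Γ tet conn girth G (hat , tight) =
  dispatch (Attached.TightHAT⇒Xo Γ tet girth G hat (vtx (proj₁ girth) 0) (vtx (proj₁ girth) 1) (edges (proj₁ girth) 0) conn tight)
  where
  three : ∀ r q → 3 ≤ r → ¬ (2 ∣ r) → Cong r (q ^ 3) (+ 1) → IsoXo Γ 3 r q → IsoXo Γ 3 9 (+ 4)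
  three r q 3≤r odd q^3 iso = finish (ThreeLayers.three-layers P 3≤r (proj₁ (half odd)) (proj₂ (half odd))
      (≋-trans (≡⇒≋ (lem q)) q^3) (NoSquare.q≢± P (s≤s (s≤s (s≤s z≤n))) 3≤r girth Fin.zero) (proj₁ girth))
    where
    lem : ∀ q → q * q * q ≡ q * (q * (q * + 1))
    lem = solve-∀
    P : Pres Γ 3 r q
    P = IsoXo⇒Pres (s≤s z≤n) (ℕₚ.≤-trans (s≤s z≤n) 3≤r) q^3 iso
    finish : r ≡ 9 × (Cong r q (+ 4) ⊎ Cong r q (+ 7)) → IsoXo Γ 3 9 (+ 4)
    finish (e , c) = [ (λ c → direct e P c) , (λ c → inverse e P c) ]′ c
      where
      direct : ∀ {r q} → r ≡ 9 → Pres Γ 3 r q → Cong r q (+ 4) → IsoXo Γ 3 9 (+ 4)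
      direct refl P c = Pres⇒IsoXo (s≤s z≤n) (s≤s z≤n) P c
      inverse : ∀ {r q} → r ≡ 9 → Pres Γ 3 r q → Cong r q (+ 7) → IsoXo Γ 3 9 (+ 4)
      -- Reversing the layers replaces 7 by its inverse 4, as 7 * 4 = 1 + 3 * 9.
      inverse refl P c = Pres⇒IsoXo (s≤s z≤n) (s≤s z≤n) (reversePres (≋-trans (*-≋ c (≋-refl {x = + 4})) (by (+ 3) refl)) P) ≋-refl
  five : ∀ r q → 3 ≤ r → ¬ (2 ∣ r) → Cong r (q ^ 5) (+ 1) → IsoXo Γ 5 r q → IsoFive Γ
  five r q 3≤r odd q^5 iso = r , a , odd , 3≤r ,
      (λ x → q≢ Fin.zero (≋-trans c (mod⇒≋ x))) , (λ x → q≢ (Fin.suc Fin.zero) (≋-trans c (mod⇒≋ x))) ,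
      ≋⇒mod (≋-trans (≡⇒≋ (lem₂ (+ toℕ a))) (≋-trans (≋-sym (sum-≋ c)) S)) , Pres⇒IsoXo (s≤s z≤n) 0<r P c
    where
    0<r = ℕₚ.≤-trans (s≤s z≤n) 3≤r
    P : Pres Γ 5 r q
    P = IsoXo⇒Pres (s≤s z≤n) 0<r q^5 iso
    a : Fin r
    a = proj₁ (≋-residue 0<r q)
    c : Cong r q (+ toℕ a)
    c = proj₂ (≋-residue 0<r q)
    q≢ = NoSquare.q≢± P (s≤s (s≤s (s≤s z≤n))) 3≤r girth
    lem : ∀ q → q * q * q * q * q ≡ q * (q * (q * (q * (q * + 1))))
    lem = solve-∀
    lem₂ : ∀ q → + 1 + q + q * (q * + 1) + q * (q * (q * + 1)) + q * (q * (q * (q * + 1))) ≡ + 1 + q + q * q + q * q * q + q * q * q * q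
    lem₂ = solve-∀
    S : Cong r (+ 1 + q + q * q + q * q * q + q * q * q * q) (+ 0)
    S = five-layers P 3≤r (proj₁ (half odd)) (proj₂ (half odd)) (≋-trans (≡⇒≋ (lem q)) q^5) (q≢ Fin.zero) (proj₁ girth)
    sum-≋ : ∀ {x y} → Cong r x y → Cong r (+ 1 + x + x * x + x * x * x + x * x * x * x) (+ 1 + y + y * y + y * y * y + y * y * y * y)
    sum-≋ {x} {y} c = lin₁ (+ 1 + (x + y) + (x * x + x * y + y * y) + (x * x * x + x * x * y + x * y * y + y * y * y)) c (lem₃ x y)
      where lem₃ : ∀ x y → + 1 + x + x * x + x * x * x + x * x * x * x - (+ 1 + y + y * y + y * y * y + y * y * y * y) ≡
              (+ 1 + (x + y) + (x * x + x * y + y * y) + (x * x * x + x * x * y + x * y * y + y * y * y)) * (x - y)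
            lem₃ = solve-∀
  dispatch : (∃ λ m → ∃₂ λ r q → (m ≡ 3 ⊎ m ≡ 5) × 3 ≤ r × ¬ (2 ∣ r) × Cong r (q ^ m) (+ 1) × IsoXo Γ m r q) → IsoXo Γ 3 9 (+ 4) ⊎ IsoFive Γ
  dispatch (_ , r , q , inj₁ refl , 3≤r , odd , q^3 , iso) = inj₁ (three r q 3≤r odd q^3 iso)
  dispatch (_ , r , q , inj₂ refl , 3≤r , odd , q^5 , iso) = inj₂ (five r q 3≤r odd q^5 iso)

theorem4p1 : (Γ : Graph) → Tetravalent Γ → Connected Γ → Girth Γ 5 →
    ((Σ (Subgroup Γ) λ G → HalfArcTransitiveOn Γ (mem G) × TightlyAttached Γ G)
    ⇔
    (IsoXo Γ 3 9 (+ 4)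
    ⊎ Σ ℕ λ r → Σ (Fin r) λ q → ¬ (2 ∣ r) × 3 ≤ r ×
    ¬ ((+ toℕ q) ≡[mod r ] (+ 1)) ×
    ¬ ((+ toℕ q) ≡[mod r ] (- (+ 1))) ×
    (((+ 1) ℤ.+ (+ toℕ q) ℤ.+ ((+ toℕ q) ℤ.^ 2) ℤ.+ ((+ toℕ q) ℤ.^ 3) ℤ.+ ((+ toℕ q) ℤ.^ 4)) ≡[mod r ] (+ 0)) ×
    IsoXo Γ 5 r (+ toℕ q)))
    × ((Σ (Subgroup Γ) λ G → HalfArcTransitiveOn Γ (mem G) × TightlyAttached Γ G) →
    HalfArcTransitive Γ)
    × ((Σ (Subgroup Γ) λ G → HalfArcTransitiveOn Γ (mem G) × TightlyAttached Γ G ×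
    HasUndirected5Cycle Γ G)
    ⇔ IsoXo Γ 3 9 (+ 4))
theorem4p1 Γ tet conn girth = mk⇔ (λ { (G , x) → classify G x }) (λ x → Aut Γ , recognise x)
    , (λ { (G , x) → proj₁ (recognise (classify G x)) })
    , mk⇔ (λ { (G , hat , tight , und) → [ (λ iso → iso) , (λ iso → ⊥-elim (directed G hat und iso)) ]′ (classify G (hat , tight)) })
          (λ iso → Aut Γ , proj₁ (FromDoyleHolt.tightHAT {Γ} iso) , proj₂ (FromDoyleHolt.tightHAT {Γ} iso) , FromDoyleHolt.undirected {Γ} iso)
  where
  classify : ∀ G → TightHAT Γ G → IsoXo Γ 3 9 (+ 4) ⊎ IsoFive Γ
  classify = classification Γ tet conn girth
  recognise : IsoXo Γ 3 9 (+ 4) ⊎ IsoFive Γ → TightHAT Γ (Aut Γ)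
  recognise = [ FromDoyleHolt.tightHAT , FromFive.tightHAT ]′
  directed : ∀ G → HalfArcTransitiveOn Γ (mem G) → HasUndirected5Cycle Γ G → IsoFive Γ → ⊥
  directed G hat (a , b , ab , C , ¬dir) iso = ¬dir (FromFive.all-directed {Γ} iso G hat ab C)
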